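{- Let $n\ge 1$. Then the poset $(\mathcal{W}(B_n),\leqslant)$ is graded, with rank function $\ell_{\mathcal{W}}$, and its rank is $n^2-\lfloor n/2\rfloor^2$.
   Context: For $k\ge1$, $B_k$ is the group of bijections $w$ of $[\pm k]=\{ -k,\dots,-1,1,\dots,k\}$ with $w(-a)=-w(a)$, written in window notation $[w(1),\dots,w(k)]$. It is a Coxeter group with generators $(1,-1)$ and $(a,a+1)(-a,-a-1)$, $a\in[k-1]$, acting on the right; its length is $\ell_B(w)=\mathrm{inv}(w)+\mathrm{neg}(w)+\mathrm{nsp}(w)$ where $\mathrm{inv}(w)=|\{(a,b):1\le a<b\le k,\ w(a)>w(b)\}|$, $\mathrm{neg}(w)=|\{a\in[k]:w(a)<0\}|$, $\mathrm{nsp}(w)=|\{(a,b):1\le a<b\le k,\ w(a)+w(b)<0\}|$; $\leqslant$ is Bruhat order. For $a\in[n]$ let $a^*=a-1$ if $a$ is even, $a^*=a+1$ if $a$ is odd and $a+1\le n$, $a^*=n$ otherwise. The signed Wachs permutations are $\mathcal{W}(B_n)=\{v\in B_n: |v^{ -1}(a)-v^{ -1}(a^*)|\le1\ \forall a\in[n-1]\}$ (here $v^{ -1}(a)\in[\pm n]$), with the induced Bruhat order. Let $\chi(P)=1$ if $P$ holds and $0$ otherwise. For $n=2m$: given $\sigma\in B_m$, $T\subseteq[m]$, define $v\in B_{2m}$ by $v(2i-1)=2\sigma(i)-\chi(\sigma(i)>0)$, $v(2i)=2\sigma(i)+\chi(\sigma(i)<0)$ if $i\notin T$, and $v(2i-1)=2\sigma(i)+\chi(\sigma(i)<0)$,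 $v(2i)=2\sigma(i)-\chi(\sigma(i)>0)$ if $i\in T$; this is a bijection $B_m\times\mathcal{P}([m])\to\mathcal{W}(B_{2m})$, and we write $v=(\sigma,T)$. For $n=2m+1$: for $v\in\mathcal{W}(B_{2m+1})$ let $p\in[\pm(2m+1)]$ with $v(p)=2m+1$ (so the entry $\mathrm{sgn}(p)(2m+1)$ occupies window position $|p|$), let $\bar v\in\mathcal{W}(B_{2m})$ be obtained by deleting this entry from the window of $v$, write $\bar v=(\sigma,S)$ and $v=(i,\sigma,S)$ with $i=(p+\mathrm{sgn}(p))/2\in[\pm(m+1)]$ (a bijection $\mathcal{W}(B_{2m+1})\to[\pm(m+1)]\times B_m\times\mathcal{P}([m])$). In both cases $\ell_{\mathcal{W}}(v)=\ell_B(v)-\ell_B(\sigma)$. -}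

module Defs where

open import Data.Nat as N using (ℕ; zero; suc; _∸_; _≤_; _<_; _≡ᵇ_; _≤ᵇ_; _%_; _/_)
open import Data.Integer using (ℤ; +_; -[1+_]; ∣_∣; _-_; -_; _+_; _<?_)
open import Data.List using (List; []; _∷_; length; filter; map; upTo)
open import Data.List.Relation.Unary.All using (All)
open import Data.List.Relation.Unary.AllPairs using (AllPairs)
open import Data.Bool using (if_then_else_)
open import Data.Product using (Σ; ∃; _×_)
open import Relation.Binary.PropositionalEquality using (_≡_; _≢_)
open import Relation.Binary.Construct.Closure.ReflexiveTransitive using (Star)
open import Relation.Nullary using (¬_; ¬?)
import Data.Bool
open import Relation.Nullary.Decidable using (⌊_⌋)

-- Signed permutations, represented by their window [w(1),…,w(k)]
-- as a list of integers.

IsB : ℕ → List ℤ → Set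
IsB k w = length w ≡ k
        × All (λ x → 1 ≤ ∣ x ∣ × ∣ x ∣ ≤ k) w
        × AllPairs (λ x y → ∣ x ∣ ≢ ∣ y ∣) w

nth : List ℤ → ℕ → ℤ
nth []       _       = + 0
nth (x ∷ xs) zero    = x
nth (x ∷ xs) (suc i) = nth xs i

-- w applied to an element of [±k], using w(-a) = -w(a)  (w(0) := 0)
app : List ℤ → ℤ → ℤ
app w (+ zero)  = + 0
app w (+ suc i) = nth w i
app w -[1+ i ]  = - nth w i

compose : List ℤ → List ℤ → List ℤ
compose w u = map (app w) u

-- Coxeter generators of B_k:  gen k 0 = (1,-1),  gen k a = (a,a+1)(-a,-a-1) for a ∈ [k-1]
gen : ℕ → ℕ → List ℤ
gen k zero    = map (λ j → if j ≡ᵇ 0 then -[1+ 0 ] else + suc j) (upTo k)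
gen k (suc a) = map (λ j → if j ≡ᵇ a then + (suc (suc a))
                            else if j ≡ᵇ suc a then + suc a else + suc j) (upTo k)

countPairs : (ℤ → ℤ → ℕ) → List ℤ → ℕ
countPairs R []       = 0
countPairs R (x ∷ xs) = go xs N.+ countPairs R xs
  where
  go : List ℤ → ℕ
  go []       = 0
  go (y ∷ ys) = R x y N.+ go ys

b2n : Data.Bool.Bool → ℕ
b2n Data.Bool.true  = 1
b2n Data.Bool.false = 0

inv neg nsp ℓB : List ℤ → ℕ
inv = countPairs (λ x y → b2n ⌊ y <? x ⌋)
neg = λ w → length (filter (λ x → x <? + 0) w)
nsp = countPairs (λ x y → b2n ⌊ x + y <? + 0 ⌋)
-- Coxeter length of B_k: ℓ_B = inv + neg + nsp
ℓB w = inv w N.+ neg w N.+ nsp w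

-- reflections: conjugates u s u⁻¹ of generators s, i.e. t u = u s
IsReflection : ℕ → List ℤ → Set
IsReflection k t = ∃ λ u → IsB k u × ∃ λ a → a < k × compose t u ≡ compose u (gen k a)

BruhatStep : ℕ → List ℤ → List ℤ → Set
BruhatStep k u w = IsB k u × IsB k w
                 × ∃ λ t → IsReflection k t × w ≡ compose u t × ℓB u < ℓB w

Bruhat : ℕ → List ℤ → List ℤ → Set
Bruhat k = Star (BruhatStep k)

star : ℕ → ℕ → ℕ
star n a = if a % 2 ≡ᵇ 0 then a ∸ 1 else (if suc a ≤ᵇ n then suc a else n)

IsWachs : ℕ → List ℤ → Set
IsWachs n v = IsB n v
  × (∀ a → 1 ≤ a → a < n → ∀ p q →
       1 ≤ ∣ p ∣ → ∣ p ∣ ≤ n → 1 ≤ ∣ q ∣ → ∣ q ∣ ≤ n →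
       app v p ≡ + a → app v q ≡ + star n a → ∣ p - q ∣ ≤ 1)

-- σ from v = (σ,T) (resp. v = (i,σ,S)): for n odd first delete the entry
-- ±n from the window; then σ(i) = sgn(u(2i-1)) ⌈|u(2i-1)|/2⌉.
odds : List ℤ → List ℤ
odds []           = []
odds (x ∷ [])     = x ∷ []
odds (x ∷ y ∷ xs) = x ∷ odds xs

decEntry : ℤ → ℤ
decEntry (+ k)    = + (suc k / 2)
decEntry -[1+ k ] = - (+ (suc (suc k) / 2))

sigmaOf : ℕ → List ℤ → List ℤ
sigmaOf n v = map decEntry (odds u)
  where
  u : List ℤ
  u = if n % 2 ≡ᵇ 0 then v else filter (λ x → ¬? (∣ x ∣ N.≟ n)) v

ℓW : ℕ → List ℤ → ℕ
ℓW n v = ℓB v ∸ ℓB (sigmaOf n v)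

_<W[_]_ : List ℤ → ℕ → List ℤ → Set
x <W[ n ] y = Bruhat n x y × x ≢ y

Covers : ℕ → List ℤ → List ℤ → Set
Covers n x y = IsWachs n x × IsWachs n y × x <W[ n ] y
  × (∀ z → IsWachs n z → x <W[ n ] z → z <W[ n ] y → Data.Empty.⊥)
  where import Data.Empty

Minimal : ℕ → List ℤ → Set
Minimal n x = IsWachs n x × (∀ z → IsWachs n z → Bruhat n z x → z ≡ x)

Maximal : ℕ → List ℤ → Set
Maximal n x = IsWachs n x × (∀ z → IsWachs n z → Bruhat n x z → z ≡ x)

data Chain (n : ℕ) : List ℤ → List ℤ → ℕ → Set where
  done : ∀ {x} → IsWachs n x → Chain n x x 0
  step : ∀ {x y z k} → Covers n x y → Chain n y z k → Chain n x z (suc k)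

GradedWithRank : ℕ → (List ℤ → ℕ) → ℕ → Set
GradedWithRank n ρ R =
    (∀ x → Minimal n x → ρ x ≡ 0)
  × (∀ x y → Covers n x y → ρ y ≡ suc (ρ x))
  × (∀ x z k → Minimal n x → Maximal n z → Chain n x z k → k ≡ R)
  × (∃ λ x → ∃ λ z → Minimal n x × Maximal n z × Chain n x z R)

{-# OPTIONS --safe #-}
-- In tableau form, u ≤ v in the Bruhat order of B_n iff for every suffix of the windows and every
-- threshold l, u has at least as many entries ≥ l as v.  For (σ , S) in W(B_2m) these counts reduce,
-- away from the middles of blocks, to those of σ, and a middle adds a condition only where σ(i) = τ(i),
-- i ∈ S ∖ T: hence (σ , S) ≤ (τ , T) iff σ ≤ τ and at each such i the counts of σ and τ differ.
-- Let (σ , S) < (τ , T).  If σ = τ, add an element to S.  Otherwise take a cover σ′ ≤ τ of σ that moves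
-- the last position where σ and τ differ.  If a position moved lies outside S, add it to S: it cannot
-- be obstructed, since an obstruction at i forces σ(i) = τ(i) with equal counts, contrary to σ′ ≤ τ.
-- If all moved positions lie in S, pass to σ′ and remove them from S.  In all cases ℓ_W grows by one.
-- For n = 2m+1 the entry ±n also moves past one block, which leaves S, or changes sign in position 1.
-- So any x < y has z with x < z ≤ y and ℓ_W(z) = ℓ_W(x) + 1, which is gradedness.
module Submission where

open import Defs
open import Data.Bool using (Bool; true; false; not; if_then_else_)
open import Data.Bool.Properties using (if-float) renaming (_≟_ to _≟ᵇ_)
open import Data.Empty using (⊥; ⊥-elim)
open import Data.Integer as ℤ using (ℤ; +_; -[1+_]; -_; ∣_∣; 0ℤ)
import Data.Integer.Properties as ℤₚ
open import Data.List using (List; []; _∷_; _++_; length; map; filter; drop; applyUpTo)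
open import Data.List.Properties using (map-++; map-∘; map-id; map-cong; map-applyUpTo; length-map; length-++; length-applyUpTo; applyUpTo-∷ʳ; ++-assoc; ++-identityʳ; ∷-injective; ≡-dec; filter-++; filter-all; filter-reject)
open import Data.List.Membership.Propositional using (_∈_)
open import Data.List.Membership.Propositional.Properties using (∈-∃++; ∈-++⁻; ∈-++⁺ˡ; ∈-++⁺ʳ; ∈-applyUpTo⁺; ∈-map⁻; ∈-filter⁻)
open import Data.List.Relation.Binary.Permutation.Propositional as Perm using (_↭_; ↭-refl; ↭-sym; ↭-trans; ↭-reflexive; prep; ↭⇒↭ₛ)
import Data.List.Relation.Binary.Permutation.Propositional.Properties as Permₚ
import Data.List.Relation.Binary.Permutation.Setoid.Properties as PermSₚ
open import Data.List.Relation.Unary.All as All using (All; []; _∷_)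
import Data.List.Relation.Unary.All.Properties as Allₚ
open import Data.List.Relation.Unary.AllPairs using (AllPairs; []; _∷_)
import Data.List.Relation.Unary.AllPairs.Properties as AllPairsₚ
open import Data.List.Relation.Unary.Any using (here; there)
open import Data.List.Relation.Unary.Unique.Propositional using (Unique)
import Data.List.Relation.Unary.Unique.Propositional.Properties as Uniqueₚ
open import Data.Nat as ℕ using (ℕ; zero; suc; _+_; _*_; _∸_; _/_; _%_; _≤_; _<_; _≡ᵇ_; _≤ᵇ_; z≤n; s≤s)
open import Data.Nat.DivMod using (m*n/n≡m; m*n%n≡0; [m+kn]%n≡m%n; +-distrib-/-∣ʳ)
open import Data.Nat.Divisibility using (divides)
open import Data.Nat.Properties hiding (_≟_)
open import Data.Nat.Tactic.RingSolver using (solve-∀)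
open import Data.Product using (∃; _×_; _,_; proj₁; proj₂)
open import Data.Product.Properties using () renaming (≡-dec to ×-≡-dec)
open import Data.Sum as Sum using (_⊎_; inj₁; inj₂; [_,_]′)
open import Function using (_∘_; id)
open import Relation.Binary.Construct.Closure.ReflexiveTransitive using (_◅_) renaming (ε to nil)
open import Relation.Binary.Definitions using (DecidableEquality; tri<; tri≈; tri>)
open import Relation.Binary.PropositionalEquality
open import Relation.Nullary using (¬_; ¬?; Dec; yes; no; contradiction)
open import Relation.Nullary.Decidable using (⌊_⌋; _×-dec_)

-- Bruhat order is given by chains of length-increasing reflections, which say little about elements
-- between two given ones; with suffix counts, staying below `v` can be checked after one or two
-- entries change. The construction `cover` therefore serves twice: iterated, it turns counts back
-- into Bruhat chains, and applied to σ it drives the rank argument. The bookkeeping rests on ℓ_W =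
-- 3 (inv + nsp) + 2 neg + |S|, with all statistics taken on σ: two blocks form four pairs of
-- entries, a block of negative value has two negative entries and one further negative sum, a set
-- bit is one inversion, and ℓ_B(σ) is subtracted. A cover of σ raises either inv + nsp by one with
-- neg fixed, or neg by one with inv + nsp fixed. This costs 3 or 2, and clearing the two bits or
-- the single bit of the moved positions brings it down to 1. For n = 2m+1 the passage of the
-- extreme entry past a block costs 2, and clearing the bit of that block returns 1.

infixr 5 _⊕_

Distinct : List ℤ → Set
Distinct = AllPairs (λ x y → ∣ x ∣ ≢ ∣ y ∣)

-- Linear inequalities are proved by adding up the hypotheses and comparing with the goal by a ring identity.
≤-balance : ∀ {a b c d} → a ≤ b → c + b ≡ d + a → c ≤ d
≤-balance {a} {b} {c} {d} a≤b e =
  +-cancelʳ-≤ b c d (≤-trans (≤-reflexive e) (+-monoʳ-≤ d a≤b))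

_⊕_ : ∀ {a b c d} → a ≤ b → c ≤ d → a + c ≤ b + d
_⊕_ = +-mono-≤

≡⇒≤ : {a b : ℕ} → a ≡ b → a ≤ b
≡⇒≤ = ≤-reflexive

≡⇒≥ : {a b : ℕ} → a ≡ b → b ≤ a
≡⇒≥ e = ≤-reflexive (sym e)

-- Indicators of order relations

𝟙 : {P : Set} → Dec P → ℕ
𝟙 d = b2n ⌊ d ⌋

𝟙-true : {P : Set} (d : Dec P) → P → 𝟙 d ≡ 1
𝟙-true (yes _) _ = refl
𝟙-true (no ¬p) p = contradiction p ¬p

𝟙-false : {P : Set} (d : Dec P) → ¬ P → 𝟙 d ≡ 0
𝟙-false (yes p) ¬p = contradiction p ¬p
𝟙-false (no _) _ = refl

𝟙≤1 : {P : Set} (d : Dec P) → 𝟙 d ≤ 1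
𝟙≤1 (yes _) = s≤s z≤n
𝟙≤1 (no _) = z≤n

𝟙-positive : {P : Set} (d : Dec P) → 1 ≤ 𝟙 d → P
𝟙-positive (yes p) _ = p

𝟙-mono : {P Q : Set} (d : Dec P) (e : Dec Q) → (P → Q) → 𝟙 d ≤ 𝟙 e
𝟙-mono (no _) _ _ = z≤n
𝟙-mono (yes p) e f = ≡⇒≥ (𝟙-true e (f p))

𝟙-cong : {P Q : Set} (d : Dec P) (e : Dec Q) → (P → Q) → (Q → P) → 𝟙 d ≡ 𝟙 e
𝟙-cong (yes p) e f g = sym (𝟙-true e (f p))
𝟙-cong (no ¬p) e f g = sym (𝟙-false e (¬p ∘ g))

lt le : ℤ → ℤ → ℕ
lt x y = 𝟙 (x ℤ.<? y)
le x y = 𝟙 (x ℤ.≤? y)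

lt-true : ∀ {x y} → x ℤ.< y → lt x y ≡ 1
lt-true {x} {y} = 𝟙-true (x ℤ.<? y)

lt-false : ∀ {x y} → ¬ x ℤ.< y → lt x y ≡ 0
lt-false {x} {y} = 𝟙-false (x ℤ.<? y)

le-true : ∀ {x y} → x ℤ.≤ y → le x y ≡ 1
le-true {x} {y} = 𝟙-true (x ℤ.≤? y)

le-false : ∀ {x y} → ¬ x ℤ.≤ y → le x y ≡ 0
le-false {x} {y} = 𝟙-false (x ℤ.≤? y)

lt-mono : ∀ {x y x′ y′} → (x ℤ.< y → x′ ℤ.< y′) → lt x y ≤ lt x′ y′
lt-mono {x} {y} {x′} {y′} = 𝟙-mono (x ℤ.<? y) (x′ ℤ.<? y′)

le-mono : ∀ {x y x′ y′} → (x ℤ.≤ y → x′ ℤ.≤ y′) → le x y ≤ le x′ y′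
le-mono {x} {y} {x′} {y′} = 𝟙-mono (x ℤ.≤? y) (x′ ℤ.≤? y′)

lt-cong : ∀ {x y x′ y′} → (x ℤ.< y → x′ ℤ.< y′) → (x′ ℤ.< y′ → x ℤ.< y) → lt x y ≡ lt x′ y′
lt-cong {x} {y} {x′} {y′} = 𝟙-cong (x ℤ.<? y) (x′ ℤ.<? y′)

le-cong : ∀ {x y x′ y′} → (x ℤ.≤ y → x′ ℤ.≤ y′) → (x′ ℤ.≤ y′ → x ℤ.≤ y) → le x y ≡ le x′ y′
le-cong {x} {y} {x′} {y′} = 𝟙-cong (x ℤ.≤? y) (x′ ℤ.≤? y′)

<-neg-swap : ∀ {x y} → x ℤ.< - y → y ℤ.< - x
<-neg-swap {x} {y} p = subst (ℤ._< - x) (ℤₚ.neg-involutive y) (ℤₚ.neg-mono-< p)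

neg-<-swap : ∀ {x y} → - x ℤ.< y → - y ℤ.< x
neg-<-swap {x} {y} p = subst (- y ℤ.<_) (ℤₚ.neg-involutive x) (ℤₚ.neg-mono-< p)


≤-neg-swap : ∀ {x y} → x ℤ.≤ - y → y ℤ.≤ - x
≤-neg-swap {x} {y} p = subst (ℤ._≤ - x) (ℤₚ.neg-involutive y) (ℤₚ.neg-mono-≤ p)

lt-neg-swap : ∀ x y → lt x (- y) ≡ lt y (- x)
lt-neg-swap x y = lt-cong (<-neg-swap {x} {y}) (<-neg-swap {y} {x})

lt-neg : ∀ x y → lt (- x) (- y) ≡ lt y x
lt-neg x y = lt-cong ℤₚ.neg-cancel-< ℤₚ.neg-mono-<

lt-+-0 : ∀ x y → lt (x ℤ.+ y) 0ℤ ≡ lt y (- x)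
lt-+-0 x y = lt-cong f g
  where
  eq : - x ℤ.+ (x ℤ.+ y) ≡ y
  eq = trans (sym (ℤₚ.+-assoc (- x) x y))
             (trans (cong (ℤ._+ y) (ℤₚ.+-inverseˡ x)) (ℤₚ.+-identityˡ y))
  f : x ℤ.+ y ℤ.< 0ℤ → y ℤ.< - x
  f p = subst₂ ℤ._<_ eq (ℤₚ.+-identityʳ (- x)) (ℤₚ.+-monoʳ-< (- x) p)
  g : y ℤ.< - x → x ℤ.+ y ℤ.< 0ℤ
  g p = subst (x ℤ.+ y ℤ.<_) (ℤₚ.+-inverseʳ x) (ℤₚ.+-monoʳ-< x p)

-- Sums over lists and over ordered pairs

module _ {A : Set} where

  sumOf : (A → ℕ) → List A → ℕ
  sumOf f [] = 0
  sumOf f (x ∷ xs) = f x + sumOf f xs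

  sumOf-++ : ∀ f xs ys → sumOf f (xs ++ ys) ≡ sumOf f xs + sumOf f ys
  sumOf-++ f [] ys = refl
  sumOf-++ f (x ∷ xs) ys = trans (cong (f x ℕ.+_) (sumOf-++ f xs ys)) (sym (+-assoc (f x) _ _))

  sumOf-mono : ∀ {f g xs} → All (λ x → f x ≤ g x) xs → sumOf f xs ≤ sumOf g xs
  sumOf-mono [] = z≤n
  sumOf-mono (p ∷ ps) = p ⊕ sumOf-mono ps

  sumOf-+ : ∀ f g xs → sumOf (λ x → f x + g x) xs ≡ sumOf f xs + sumOf g xs
  sumOf-+ f g [] = refl
  sumOf-+ f g (x ∷ xs) = trans (cong (f x + g x ℕ.+_) (sumOf-+ f g xs)) (arith (f x) (g x) _ _)
    where
    arith : ∀ a b c d → a + b + (c + d) ≡ a + c + (b + d)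
    arith = solve-∀

  sumOf-const : ∀ c {f xs} → All (λ x → f x ≡ c) xs → sumOf f xs ≡ length xs * c
  sumOf-const c [] = refl
  sumOf-const c (p ∷ ps) = cong₂ _+_ p (sumOf-const c ps)

  sumOf-replace₁ : ∀ f P x x′ Q →
    sumOf f (P ++ x ∷ Q) + f x′ ≡ sumOf f (P ++ x′ ∷ Q) + f x
  sumOf-replace₁ f [] x x′ Q = arith (f x) (f x′) _
    where
    arith : ∀ a b c → a + c + b ≡ b + c + a
    arith = solve-∀
  sumOf-replace₁ f (p ∷ P) x x′ Q = begin
    f p + sumOf f (P ++ x ∷ Q) + f x′     ≡⟨ +-assoc (f p) _ _ ⟩
    f p + (sumOf f (P ++ x ∷ Q) + f x′)   ≡⟨ cong (f p ℕ.+_) (sumOf-replace₁ f P x x′ Q) ⟩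
    f p + (sumOf f (P ++ x′ ∷ Q) + f x)   ≡⟨ +-assoc (f p) _ _ ⟨
    f p + sumOf f (P ++ x′ ∷ Q) + f x     ∎
    where open ≡-Reasoning

  sumOf-replace₂ : ∀ f P z z′ M x x′ Q →
    sumOf f (P ++ z ∷ M ++ x ∷ Q) + (f z′ + f x′) ≡ sumOf f (P ++ z′ ∷ M ++ x′ ∷ Q) + (f z + f x)
  sumOf-replace₂ f [] z z′ M x x′ Q = begin
    f z + sumOf f (M ++ x ∷ Q) + (f z′ + f x′)  ≡⟨ arith (f z) (f z′) (f x′) _ ⟩
    sumOf f (M ++ x ∷ Q) + f x′ + (f z + f z′)  ≡⟨ cong (_+ (f z + f z′)) (sumOf-replace₁ f M x x′ Q) ⟩
    sumOf f (M ++ x′ ∷ Q) + f x + (f z + f z′)  ≡⟨ arith′ (f z) (f z′) (f x) _ ⟩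
    f z′ + sumOf f (M ++ x′ ∷ Q) + (f z + f x)  ∎
    where
    open ≡-Reasoning
    arith : ∀ a b c s → a + s + (b + c) ≡ s + c + (a + b)
    arith = solve-∀
    arith′ : ∀ a b c s → s + c + (a + b) ≡ b + s + (a + c)
    arith′ = solve-∀
  sumOf-replace₂ f (p ∷ P) z z′ M x x′ Q = begin
    f p + sumOf f (P ++ z ∷ M ++ x ∷ Q) + (f z′ + f x′)     ≡⟨ +-assoc (f p) _ _ ⟩
    f p + (sumOf f (P ++ z ∷ M ++ x ∷ Q) + (f z′ + f x′))   ≡⟨ cong (f p ℕ.+_)
      (sumOf-replace₂ f P z z′ M x x′ Q) ⟩
    f p + (sumOf f (P ++ z′ ∷ M ++ x′ ∷ Q) + (f z + f x))   ≡⟨ +-assoc (f p) _ _ ⟨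
    f p + sumOf f (P ++ z′ ∷ M ++ x′ ∷ Q) + (f z + f x)     ∎
    where open ≡-Reasoning

pairSum : (ℤ → ℤ → ℕ) → List ℤ → ℕ
pairSum R [] = 0
pairSum R (x ∷ xs) = sumOf (R x) xs + pairSum R xs

-- The local function in the definition of countPairs has no name; its type is inferred
-- from the goal, where abstracting y ∷ ys separates its parameter from its argument.
mutual
  countPairs-row : ∀ (R : ℤ → ℤ → ℕ) (x : ℤ) (w ys : List ℤ) → _ ≡ sumOf (R x) ys

  countPairs-∷ : ∀ R x xs → countPairs R (x ∷ xs) ≡ sumOf (R x) xs + countPairs R xs
  countPairs-∷ R x [] = refl
  countPairs-∷ R x (y ∷ ys) with y ∷ ys
  ... | w = cong (λ t → R x y + t + countPairs R (y ∷ ys)) (countPairs-row R x w ys)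

  countPairs-row R x w [] = refl
  countPairs-row R x w (y ∷ ys) = cong (R x y ℕ.+_) (countPairs-row R x w ys)

countPairs≡pairSum : ∀ R xs → countPairs R xs ≡ pairSum R xs
countPairs≡pairSum R [] = refl
countPairs≡pairSum R (x ∷ xs) =
  trans (countPairs-∷ R x xs) (cong (sumOf (R x) xs ℕ.+_) (countPairs≡pairSum R xs))

-- invs x y counts what an entry x followed by y contributes to inv and nsp.
invs : ℤ → ℤ → ℕ
invs x y = lt y x + lt y (- x)

invPairs : List ℤ → ℕ
invPairs = pairSum invs

negs : List ℤ → ℕ
negs = sumOf (λ x → lt x 0ℤ)

neg≡negs : ∀ w → neg w ≡ negs w
neg≡negs [] = refl
neg≡negs (x ∷ w) with x ℤ.<? 0ℤ
... | yes _ = cong suc (neg≡negs w)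
... | no _ = neg≡negs w

-- Since `x + y < 0` means `y < - x`, inv and nsp merge into one sum over the same ordered pairs.
ℓB≡ : ∀ w → ℓB w ≡ invPairs w + negs w
ℓB≡ w = begin
  inv w + neg w + nsp w
    ≡⟨ cong₂ _+_ (cong₂ _+_ (countPairs≡pairSum I w) (neg≡negs w)) (countPairs≡pairSum N w) ⟩
  pairSum I w + negs w + pairSum N w
    ≡⟨ arith (pairSum I w) (negs w) (pairSum N w) ⟩
  pairSum I w + pairSum N w + negs w
    ≡⟨ cong (_+ negs w) (split w) ⟩
  invPairs w + negs w ∎
  where
  open ≡-Reasoning
  I N : ℤ → ℤ → ℕ
  I x y = lt y x
  N x y = lt (x ℤ.+ y) 0ℤ
  arith : ∀ a b c → a + b + c ≡ a + c + b
  arith = solve-∀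
  row : ∀ x ys → sumOf (I x) ys + sumOf (N x) ys ≡ sumOf (invs x) ys
  row x [] = refl
  row x (y ∷ ys) rewrite lt-+-0 x y = trans (arith′ (lt y x) (lt y (- x)) _ _) (cong (invs x y ℕ.+_) (row x ys))
    where
    arith′ : ∀ a b c d → a + c + (b + d) ≡ a + b + (c + d)
    arith′ = solve-∀
  split : ∀ ys → pairSum I ys + pairSum N ys ≡ invPairs ys
  split [] = refl
  split (x ∷ ys) = trans (arith′ (sumOf (I x) ys) (sumOf (N x) ys) _ _) (cong₂ _+_ (row x ys) (split ys))
    where
    arith′ : ∀ a b c d → a + c + (b + d) ≡ a + b + (c + d)
    arith′ = solve-∀

-- Pair sums after one or two entries change

module _ (R : ℤ → ℤ → ℕ) where

  pairSum-replace₁ : ∀ P x x′ Q → All (λ p → R p x ≤ R p x′) P → All (λ q → R x q ≤ R x′ q) Q →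
    pairSum R (P ++ x ∷ Q) ≤ pairSum R (P ++ x′ ∷ Q)
  pairSum-replace₁ [] x x′ Q [] qs = sumOf-mono qs ⊕ ≤-refl
  pairSum-replace₁ (p ∷ P) x x′ Q (h ∷ hs) qs =
    ≤-balance (h ⊕ ≡⇒≤ (sumOf-replace₁ (R p) P x x′ Q))
      (arith (R p x) (R p x′) (sumOf (R p) (P ++ x ∷ Q)) (sumOf (R p) (P ++ x′ ∷ Q)))
    ⊕ pairSum-replace₁ P x x′ Q hs qs
    where
    arith : ∀ a b s t → s + (b + (t + a)) ≡ t + (a + (s + b))
    arith = solve-∀

  -- Every other entry meets both changed positions, so its two terms are compared together, even
  -- where neither comparison holds alone. The pair of changed positions itself is left to the
  -- caller, as the extra term on each side.
  pairSum-replace₂ : ∀ P z z′ M x x′ Q →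
    All (λ p → R p z + R p x ≤ R p z′ + R p x′) P →
    All (λ m → R z m + R m x ≤ R z′ m + R m x′) M →
    All (λ q → R z q + R x q ≤ R z′ q + R x′ q) Q →
    pairSum R (P ++ z ∷ M ++ x ∷ Q) + R z′ x′ ≤ pairSum R (P ++ z′ ∷ M ++ x′ ∷ Q) + R z x
  pairSum-replace₂ (p ∷ P) z z′ M x x′ Q (h ∷ hs) ms qs =
    ≤-balance (h ⊕ ≡⇒≤ (sumOf-replace₂ (R p) P z z′ M x x′ Q) ⊕ pairSum-replace₂ P z z′ M x x′ Q hs ms qs)
      (arith (R p z + R p x) (R p z′ + R p x′) (R z′ x′) (R z x)
        (sumOf (R p) (P ++ z ∷ M ++ x ∷ Q)) (sumOf (R p) (P ++ z′ ∷ M ++ x′ ∷ Q))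
        (pairSum R (P ++ z ∷ M ++ x ∷ Q)) (pairSum R (P ++ z′ ∷ M ++ x′ ∷ Q)))
    where
    arith : ∀ a b c d s t u v → s + u + c + (b + (t + a + (v + d))) ≡ t + v + d + (a + (s + b + (u + c)))
    arith = solve-∀
  pairSum-replace₂ [] z z′ [] x x′ Q [] [] qs =
    ≤-balance (≡⇒≤ (sym (sumOf-+ (R z) (R x) Q)) ⊕ sumOf-mono qs ⊕ ≡⇒≤ (sumOf-+ (R z′) (R x′) Q))
      (arith (R z x) (R z′ x′) (sumOf (R z) Q) (sumOf (R x) Q) (sumOf (R z′) Q) (sumOf (R x′) Q) (pairSum R Q)
        (sumOf (λ q → R z q + R x q) Q) (sumOf (λ q → R z′ q + R x′ q) Q))
    where
    arith : ∀ a b s t u v w k l →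
      a + s + (t + w) + b + (k + (l + (u + v))) ≡ b + u + (v + w) + a + (s + t + (k + l))
    arith = solve-∀
  pairSum-replace₂ [] z z′ (m ∷ M) x x′ Q [] (h ∷ hs) qs =
    ≤-balance (h ⊕ ≡⇒≤ (sumOf-replace₁ (R m) M x x′ Q) ⊕ pairSum-replace₂ [] z z′ M x x′ Q [] hs qs)
      (arith (R z m) (R m x) (R z′ m) (R m x′) (R z′ x′) (R z x)
        (sumOf (R z) (M ++ x ∷ Q)) (sumOf (R m) (M ++ x ∷ Q)) (pairSum R (M ++ x ∷ Q))
        (sumOf (R m) (M ++ x′ ∷ Q)) (sumOf (R z′) (M ++ x′ ∷ Q)) (pairSum R (M ++ x′ ∷ Q)))
    where
    arith : ∀ a b c d e f s t u v w k →
      a + s + (t + u) + e + (c + d + (v + b + (w + k + f))) ≡ c + w + (v + k) + f +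
        (a + b + (t + d + (s + u + e)))
    arith = solve-∀

module _ {z x : ℤ} where

  invs-swap : z ℤ.< x → invs x z ≡ 1 + invs z x
  invs-swap z<x = cong₂ _+_ (lt-true z<x)
    (trans (lt-neg-swap z x) (sym (cong (_+ lt x (- z)) (lt-false (ℤₚ.<-asym z<x)))))

  invs-flip₂ : - z ℤ.< x → invs (- x) (- z) ≡ 1 + invs z x
  invs-flip₂ -z<x rewrite ℤₚ.neg-involutive x | lt-neg z x | lt-true -z<x | lt-false (ℤₚ.<-asym -z<x) =
    arith (lt x z)
    where
    arith : ∀ a → a + 1 ≡ 1 + (a + 0)
    arith = solve-∀

-- Length under transpositions and sign changes

-- Entries before or after both positions meet the same two values and contribute equally; entries
-- in between lose nothing, and the pair itself gains one.
pairs-swap-≥ : ∀ P {z} M {x} Q → z ℤ.< x →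
  1 + invPairs (P ++ z ∷ M ++ x ∷ Q) ≤ invPairs (P ++ x ∷ M ++ z ∷ Q)
pairs-swap-≥ P {z} M {x} Q z<x =
  ≤-balance (pairSum-replace₂ invs P z x M x z Q
      (All.universal (λ p → ≡⇒≤ (+-comm (invs p z) (invs p x))) P)
      (All.universal middle M)
      (All.universal (λ q → ≡⇒≤ (+-comm (invs z q) (invs x q))) Q)
    ⊕ ≡⇒≥ (invs-swap z<x))
    (arith (invPairs (P ++ z ∷ M ++ x ∷ Q)) (invPairs (P ++ x ∷ M ++ z ∷ Q)) (invs x z) (invs z x))
  where
  arith : ∀ a b c d → 1 + a + (b + d + c) ≡ b + (a + c + (1 + d))
  arith = solve-∀
  middle : ∀ m → invs z m + invs m x ≤ invs x m + invs m z
  middle m rewrite lt-neg-swap m z | lt-neg-swap x m =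
    ≤-balance (lt-mono {m} {z} {m} {x} (λ p → ℤₚ.<-trans p z<x) ⊕ lt-mono {x} {m} {z} {m} (ℤₚ.<-trans z<x))
      (shuffle (lt m z) (lt z (- m)) (lt x m) (lt m (- x)) (lt m x) (lt z m))
    where
    shuffle : ∀ a b c d e f → a + b + (c + d) + (e + f) ≡ e + d + (f + b) + (a + c)
    shuffle = solve-∀

pairs-flip₂-≥ : ∀ P {z} M {x} Q → - z ℤ.< x →
  1 + invPairs (P ++ z ∷ M ++ x ∷ Q) ≤ invPairs (P ++ - x ∷ M ++ - z ∷ Q)
pairs-flip₂-≥ P {z} M {x} Q -z<x =
  ≤-balance (pairSum-replace₂ invs P z (- x) M x (- z) Q
      (All.universal left P) (All.universal middle M) (All.universal right Q)
    ⊕ ≡⇒≥ (invs-flip₂ {z} {x} -z<x))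
    (arith (invPairs (P ++ z ∷ M ++ x ∷ Q)) (invPairs (P ++ - x ∷ M ++ - z ∷ Q))
      (invs (- x) (- z)) (invs z x))
  where
  -x<z : - x ℤ.< z
  -x<z = neg-<-swap {z} {x} -z<x
  arith : ∀ a b c d → 1 + a + (b + d + c) ≡ b + (a + c + (1 + d))
  arith = solve-∀
  left : ∀ p → invs p z + invs p x ≤ invs p (- x) + invs p (- z)
  left p = (lt-mono {z} {p} { - x} {p} (ℤₚ.<-trans -x<z) ⊕ lt-mono {z} { - p} { - x} { - p} (ℤₚ.<-trans -x<z))
         ⊕ (lt-mono {x} {p} { - z} {p} (ℤₚ.<-trans -z<x) ⊕ lt-mono {x} { - p} { - z} { - p} (ℤₚ.<-trans -z<x))
  middle : ∀ m → invs z m + invs m x ≤ invs (- x) m + invs m (- z)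
  middle m rewrite lt-neg-swap x m | ℤₚ.neg-involutive x | lt-neg z m =
    ≤-balance (lt-mono {m} { - z} {m} {x} (λ p → ℤₚ.<-trans p -z<x) ⊕ lt-mono {x} {m} { - z} {m}
      (ℤₚ.<-trans -z<x))
      (shuffle (lt m z) (lt m (- z)) (lt x m) (lt m (- x)) (lt m x) (lt (- z) m))
    where
    shuffle : ∀ a b c d e f → a + b + (c + d) + (e + f) ≡ d + e + (f + a) + (b + c)
    shuffle = solve-∀
  right : ∀ q → invs z q + invs x q ≤ invs (- x) q + invs (- z) q
  right q rewrite ℤₚ.neg-involutive x | ℤₚ.neg-involutive z =
    ≡⇒≤ (shuffle (lt q z) (lt q (- z)) (lt q x) (lt q (- x)))
    where
    shuffle : ∀ a b c d → a + b + (c + d) ≡ d + c + (b + a)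
    shuffle = solve-∀

pairs-flip₁-≥ : ∀ P {x} Q → - x ℤ.< x → invPairs (P ++ x ∷ Q) ≤ invPairs (P ++ - x ∷ Q)
pairs-flip₁-≥ P {x} Q -x<x = pairSum-replace₁ invs P x (- x) Q (All.universal left P) (All.universal right Q)
  where
  left : ∀ p → invs p x ≤ invs p (- x)
  left p = lt-mono {x} {p} { - x} {p} (ℤₚ.<-trans -x<x) ⊕ lt-mono {x} { - p} { - x} { - p} (ℤₚ.<-trans -x<x)
  right : ∀ q → invs x q ≤ invs (- x) q
  right q rewrite ℤₚ.neg-involutive x = ≡⇒≤ (+-comm (lt q x) _)

-- The three kinds of reflections of B_k acting on positions, each in the direction that increases
-- the length. In the full window on [±k], `flip₂` exchanges the entry `- z` at a negative position
-- with `x` at a positive one, so `- z < x` is again the condition of a swap.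
data Raise : List ℤ → List ℤ → Set where
  swap  : ∀ P {z} M {x} Q → z ℤ.< x → Raise (P ++ z ∷ M ++ x ∷ Q) (P ++ x ∷ M ++ z ∷ Q)
  flip₂ : ∀ P {z} M {x} Q → - z ℤ.< x → Raise (P ++ z ∷ M ++ x ∷ Q) (P ++ - x ∷ M ++ - z ∷ Q)
  flip₁ : ∀ P {x} Q → - x ℤ.< x → Raise (P ++ x ∷ Q) (P ++ - x ∷ Q)

-x<x⇒0<x : ∀ {x} → - x ℤ.< x → 0ℤ ℤ.< x
-x<x⇒0<x {+ suc _} _ = ℤ.+<+ (s≤s z≤n)
-x<x⇒0<x {+ zero} (ℤ.+<+ ())

-x<x⇒-x<0 : ∀ {x} → - x ℤ.< x → - x ℤ.< 0ℤ
-x<x⇒-x<0 {+ suc _} _ = ℤ.-<+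
-x<x⇒-x<0 {+ zero} (ℤ.+<+ ())

negs-swap : ∀ P z M x Q → negs (P ++ x ∷ M ++ z ∷ Q) ≡ negs (P ++ z ∷ M ++ x ∷ Q)
negs-swap P z M x Q =
  +-cancelʳ-≡ (lt z 0ℤ + lt x 0ℤ) _ _
    (trans (sumOf-replace₂ (λ x → lt x 0ℤ) P x z M z x Q)
      (cong (negs (P ++ z ∷ M ++ x ∷ Q) ℕ.+_) (+-comm (lt x 0ℤ) _)))

negs-flip₁ : ∀ P x Q → - x ℤ.< x → negs (P ++ - x ∷ Q) ≡ 1 + negs (P ++ x ∷ Q)
negs-flip₁ P x Q -x<x = begin
  negs (P ++ - x ∷ Q)               ≡⟨ +-identityʳ _ ⟨
  negs (P ++ - x ∷ Q) + 0           ≡⟨ cong (negs (P ++ - x ∷ Q) ℕ.+_) (lt-false (ℤₚ.<-asym (-x<x⇒0<x -x<x))) ⟨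
  negs (P ++ - x ∷ Q) + lt x 0ℤ     ≡⟨ sumOf-replace₁ (λ x → lt x 0ℤ) P (- x) x Q ⟩
  negs (P ++ x ∷ Q) + lt (- x) 0ℤ   ≡⟨ cong (negs (P ++ x ∷ Q) ℕ.+_) (lt-true (-x<x⇒-x<0 -x<x)) ⟩
  negs (P ++ x ∷ Q) + 1             ≡⟨ +-comm _ 1 ⟩
  1 + negs (P ++ x ∷ Q)             ∎
  where open ≡-Reasoning

raise⇒ℓB : ∀ {u w} → Raise u w → ℓB u < ℓB w
raise⇒ℓB {u} {w} r = subst₂ _<_ (sym (ℓB≡ u)) (sym (ℓB≡ w)) (go r)
  where
  go : ∀ {u w} → Raise u w → invPairs u + negs u < invPairs w + negs w
  go (swap P {z} M {x} Q z<x) = pairs-swap-≥ P M Q z<x ⊕ ≡⇒≥ (negs-swap P z M x Q)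
  go (flip₂ P {z} M {x} Q -z<x) = pairs-flip₂-≥ P M Q -z<x ⊕
    ≤-balance (≡⇒≤ (sumOf-replace₂ (λ x → lt x 0ℤ) P z (- x) M x (- z) Q)
        ⊕ lt-mono {z} { 0ℤ} { - x} (ℤₚ.<-trans (neg-<-swap {z} {x} -z<x))
        ⊕ lt-mono {x} { 0ℤ} { - z} (ℤₚ.<-trans -z<x))
      (arith (negs (P ++ z ∷ M ++ x ∷ Q)) (negs (P ++ - x ∷ M ++ - z ∷ Q)) (lt z 0ℤ) (lt x 0ℤ) (lt (- x) 0ℤ)
        (lt (- z) 0ℤ))
    where
    arith : ∀ s t a b c d → s + (t + (a + b) + (c + d)) ≡ t + (s + (c + d) + (a + b))
    arith = solve-∀
  go (flip₁ P {x} Q -x<x) =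
    ≤-balance (pairs-flip₁-≥ P Q -x<x ⊕ ≡⇒≥ (negs-flip₁ P x Q -x<x))
      (arith (invPairs (P ++ x ∷ Q)) (invPairs (P ++ - x ∷ Q)) (negs (P ++ x ∷ Q)) (negs (P ++ - x ∷ Q)))
    where
    arith : ∀ s t a b → suc (s + a) + (t + b) ≡ t + b + (s + (1 + a))
    arith = solve-∀

cnt : ℤ → List ℤ → ℕ
cnt l = sumOf (le l)

-- Domination of suffix counts

-- The lower element comes first: counts fall as one goes up in Bruhat order. A record, so that `u`
-- and `v` can be inferred from a proof; the bare function type would show them only under `cnt`.
record Cn (u v : List ℤ) : Set where
  constructor cn
  field at : ∀ l → cnt l v ≤ cnt l u

open Cn public

-- By the symmetry w(-a) = -w(a), suffixes starting at negative positions give no further conditions.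
data Dom : List ℤ → List ℤ → Set where
  []  : Dom [] []
  _∷_ : ∀ {x y u v} → Cn (x ∷ u) (y ∷ v) → Dom u v → Dom (x ∷ u) (y ∷ v)

Cn-refl : ∀ {u} → Cn u u
Cn-refl = cn λ l → ≤-refl

Cn-trans : ∀ {u v w} → Cn u v → Cn v w → Cn u w
Cn-trans p q = cn λ l → ≤-trans (at q l) (at p l)

Cn-++ : ∀ P {u v} → Cn u v → Cn (P ++ u) (P ++ v)
Cn-++ P {u} {v} c = cn λ l →
  subst₂ _≤_ (sym (sumOf-++ (le l) P v)) (sym (sumOf-++ (le l) P u)) (+-monoʳ-≤ (cnt l P) (at c l))

le-mono-≤ : ∀ {x y} l → y ℤ.≤ x → le l y ≤ le l x
le-mono-≤ {x} {y} l y≤x = le-mono {l} {y} {l} {x} (λ p → ℤₚ.≤-trans p y≤x)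

Cn-∷ : ∀ {x y u v} → y ℤ.≤ x → Cn u v → Cn (x ∷ u) (y ∷ v)
Cn-∷ y≤x c = cn λ l → le-mono-≤ l y≤x ⊕ at c l

Dom-refl : ∀ {u} → Dom u u
Dom-refl {[]} = []
Dom-refl {x ∷ u} = Cn-refl ∷ Dom-refl

Dom-trans : ∀ {u v w} → Dom u v → Dom v w → Dom u w
Dom-trans [] [] = []
Dom-trans (c ∷ d) (c′ ∷ d′) = Cn-trans c c′ ∷ Dom-trans d d′

Dom⇒Cn : ∀ {u v} → Dom u v → Cn u v
Dom⇒Cn [] = Cn-refl
Dom⇒Cn (c ∷ _) = c

Dom⇒length : ∀ {u v} → Dom u v → length u ≡ length v
Dom⇒length [] = refl
Dom⇒length (_ ∷ d) = cong suc (Dom⇒length d)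

Dom-++ : ∀ P {u v} → Dom u v → Dom (P ++ u) (P ++ v)
Dom-++ [] d = d
Dom-++ (p ∷ P) d = Cn-++ (p ∷ P) (Dom⇒Cn d) ∷ Dom-++ P d

Dom-suffix : ∀ P P′ {u v} → length P ≡ length P′ → Dom (P ++ u) (P′ ++ v) → Dom u v
Dom-suffix [] [] _ d = d
Dom-suffix (_ ∷ P) (_ ∷ P′) e (_ ∷ d) = Dom-suffix P P′ (suc-injective e) d

Dom-∷ : ∀ {x y u v} → y ℤ.≤ x → Dom u v → Dom (x ∷ u) (y ∷ v)
Dom-∷ y≤x d = Cn-∷ y≤x (Dom⇒Cn d) ∷ d

cnt-swap : ∀ l P z M x Q → cnt l (P ++ x ∷ M ++ z ∷ Q) ≡ cnt l (P ++ z ∷ M ++ x ∷ Q)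
cnt-swap l P z M x Q =
  +-cancelʳ-≡ (le l z + le l x) _ _
    (trans (sumOf-replace₂ (le l) P x z M z x Q) (cong (cnt l (P ++ z ∷ M ++ x ∷ Q) ℕ.+_) (+-comm (le l x) _)))

raise⇒Dom : ∀ {u w} → Raise u w → Dom u w
raise⇒Dom (swap P {z} M {x} Q z<x) =
  Dom-++ P (cn (λ l → ≡⇒≤ (cnt-swap l [] z M x Q)) ∷ Dom-++ M (Dom-∷ (ℤₚ.<⇒≤ z<x) Dom-refl))
raise⇒Dom (flip₂ P {z} M {x} Q -z<x) =
  Dom-++ P (Dom-∷ (ℤₚ.<⇒≤ (neg-<-swap {z} {x} -z<x)) (Dom-++ M (Dom-∷ (ℤₚ.<⇒≤ -z<x) Dom-refl)))
raise⇒Dom (flip₁ P Q -x<x) = Dom-++ P (Dom-∷ (ℤₚ.<⇒≤ -x<x) Dom-refl)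

≡-balance : ∀ {a b c d} → a ≡ b → c + b ≡ d + a → c ≡ d
≡-balance {a} {b} {c} {d} a≡b e = +-cancelʳ-≡ b c d (trans e (cong (d ℕ.+_) a≡b))

-- Windows as signed rearrangements of 1, ..., k

module _ {A : Set} where

  unique-⊆-remove : ∀ {x : A} {xs ys zs} → All (x ≢_) xs → (∀ {a} → a ∈ x ∷ xs → a ∈ ys ++ x ∷ zs) →
    ∀ {a} → a ∈ xs → a ∈ ys ++ zs
  unique-⊆-remove {ys = ys} x∉ sub {a} a∈ with ∈-++⁻ ys (sub (there a∈))
  ... | inj₁ i = ∈-++⁺ˡ i
  ... | inj₂ (here a≡x) = contradiction (sym a≡x) (All.lookup x∉ a∈)
  ... | inj₂ (there i) = ∈-++⁺ʳ ys i

  length-insert : ∀ (ys : List A) x zs → length (ys ++ x ∷ zs) ≡ suc (length (ys ++ zs))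
  length-insert [] x zs = refl
  length-insert (y ∷ ys) x zs = cong suc (length-insert ys x zs)

  unique-⊆-length : ∀ {xs ys : List A} → Unique xs → (∀ {a} → a ∈ xs → a ∈ ys) → length xs ≤ length ys
  unique-⊆-length {[]} _ _ = z≤n
  unique-⊆-length {x ∷ xs} (x∉ ∷ un) sub with ∈-∃++ (sub (here refl))
  ... | ys , zs , refl = subst (suc (length xs) ≤_) (sym (length-insert ys x zs))
                           (s≤s (unique-⊆-length un (unique-⊆-remove {ys = ys} x∉ sub)))

  unique-⊆-↭ : ∀ {xs ys : List A} → Unique xs → (∀ {a} → a ∈ xs → a ∈ ys) → length ys ≤ length xs → xs ↭ ys
  unique-⊆-↭ {[]} {[]} _ _ _ = ↭-refl
  unique-⊆-↭ {x ∷ xs} (x∉ ∷ un) sub len with ∈-∃++ (sub (here refl))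
  ... | ys , zs , refl =
    ↭-trans (prep x (unique-⊆-↭ un (unique-⊆-remove {ys = ys} x∉ sub)
                      (≤-pred (subst (_≤ suc (length xs)) (length-insert ys x zs) len))))
            (↭-sym (Permₚ.shift x ys zs))

  sumOf-↭ : ∀ (f : A → ℕ) {xs ys} → xs ↭ ys → sumOf f xs ≡ sumOf f ys
  sumOf-↭ f Perm.refl = refl
  sumOf-↭ f (prep x p) = cong (f x ℕ.+_) (sumOf-↭ f p)
  sumOf-↭ f (Perm.swap x y p) = trans (cong (λ t → f x + (f y + t)) (sumOf-↭ f p)) (arith (f x) (f y) _)
    where
    arith : ∀ a b c → a + (b + c) ≡ b + (a + c)
    arith = solve-∀
  sumOf-↭ f (Perm.trans p q) = trans (sumOf-↭ f p) (sumOf-↭ f q)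

-- Pigeonhole: `k` distinct sizes between 1 and `k` exhaust that range.
IsB⇒↭ : ∀ {k w} → IsB k w → map ∣_∣ w ↭ applyUpTo suc k
IsB⇒↭ {k} {w} (len , bounds , distinct) =
  unique-⊆-↭ (AllPairsₚ.map⁺ distinct) sub
    (≡⇒≤ (trans (length-applyUpTo suc k) (sym (trans (length-map ∣_∣ w) len))))
  where
  sub : ∀ {a} → a ∈ map ∣_∣ w → a ∈ applyUpTo suc k
  sub a∈ with ∈-map⁻ ∣_∣ a∈
  ... | x , x∈ , refl with ∣ x ∣ | All.lookup bounds x∈
  ... | suc i | _ , i<k = ∈-applyUpTo⁺ suc i<k

↭⇒IsB : ∀ {k w} → map ∣_∣ w ↭ applyUpTo suc k → IsB k w
↭⇒IsB {k} {w} p =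
  trans (sym (length-map ∣_∣ w)) (trans (Permₚ.↭-length p) (length-applyUpTo suc k)) ,
  Allₚ.map⁻ (Permₚ.All-resp-↭ (↭-sym p) bounds) ,
  AllPairsₚ.map⁻ (PermSₚ.Unique-resp-↭ (setoid ℕ) (↭⇒↭ₛ (↭-sym p))
                   (Uniqueₚ.applyUpTo⁺₁ suc k (λ i<j _ e → <⇒≢ i<j (suc-injective e))))
  where
  bounds : All (λ j → 1 ≤ j × j ≤ k) (applyUpTo suc k)
  bounds = Allₚ.applyUpTo⁺₁ suc k (λ i<k → s≤s z≤n , i<k)

IsB-∋ : ∀ {k w} → IsB k w → ∀ {y} → 1 ≤ ∣ y ∣ → ∣ y ∣ ≤ k → ∃ λ x → x ∈ w × ∣ y ∣ ≡ ∣ x ∣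
IsB-∋ b {y} 1≤y y≤k = ∈-map⁻ ∣_∣ (Permₚ.∈-resp-↭ (↭-sym (IsB⇒↭ b)) (mem ∣ y ∣ 1≤y y≤k))
  where
  mem : ∀ {k} j → 1 ≤ j → j ≤ k → j ∈ applyUpTo suc k
  mem (suc j) _ j<k = ∈-applyUpTo⁺ suc j<k

IsB-cong : ∀ {k u w} → map ∣_∣ u ↭ map ∣_∣ w → IsB k u → IsB k w
IsB-cong p b = ↭⇒IsB (↭-trans (↭-sym p) (IsB⇒↭ b))

∣x∣≡∣y∣ : ∀ x y → ∣ x ∣ ≡ ∣ y ∣ → x ≡ y ⊎ x ≡ - y
∣x∣≡∣y∣ (+ m) (+ .m) refl = inj₁ refl
∣x∣≡∣y∣ (+ suc m) -[1+ .m ] refl = inj₂ refl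
∣x∣≡∣y∣ -[1+ m ] (+ .(suc m)) refl = inj₂ refl
∣x∣≡∣y∣ -[1+ m ] -[1+ .m ] refl = inj₁ refl

map-replace₂-↭ : ∀ (P : List ℤ) z z′ M x x′ Q → ∣ z ∣ ≡ ∣ x′ ∣ → ∣ x ∣ ≡ ∣ z′ ∣ →
  map ∣_∣ (P ++ z ∷ M ++ x ∷ Q) ↭ map ∣_∣ (P ++ z′ ∷ M ++ x′ ∷ Q)
map-replace₂-↭ (p ∷ P) z z′ M x x′ Q e f = prep ∣ p ∣ (map-replace₂-↭ P z z′ M x x′ Q e f)
map-replace₂-↭ [] z z′ M x x′ Q e f
  rewrite map-++ ∣_∣ M (x ∷ Q) | map-++ ∣_∣ M (x′ ∷ Q) | e | f =
  ↭-trans (prep ∣ x′ ∣ (Permₚ.shift ∣ z′ ∣ (map ∣_∣ M) (map ∣_∣ Q)))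
    (↭-trans (Perm.swap _ _ ↭-refl) (prep ∣ z′ ∣ (↭-sym (Permₚ.shift ∣ x′ ∣ (map ∣_∣ M) (map ∣_∣ Q)))))

raise-IsB : ∀ {k u w} → Raise u w → IsB k u → IsB k w
raise-IsB (swap P {z} M {x} Q _) = IsB-cong (map-replace₂-↭ P z x M x z Q refl refl)
raise-IsB (flip₂ P {z} M {x} Q _) =
  IsB-cong (map-replace₂-↭ P z (- x) M x (- z) Q (sym (ℤₚ.∣-i∣≡∣i∣ z)) (sym (ℤₚ.∣-i∣≡∣i∣ x)))
raise-IsB (flip₁ P {x} Q _) = IsB-cong (↭-reflexive (eq P))
  where
  eq : ∀ P → map ∣_∣ (P ++ x ∷ Q) ≡ map ∣_∣ (P ++ - x ∷ Q)
  eq [] = cong (_∷ map ∣_∣ Q) (sym (ℤₚ.∣-i∣≡∣i∣ x))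
  eq (p ∷ P) = cong (∣ p ∣ ∷_) (eq P)

-- Counts under negation

suc-neg-involutive : ∀ l → ℤ.suc (- ℤ.suc (- l)) ≡ l
suc-neg-involutive l = begin
  ℤ.1ℤ ℤ.+ - (ℤ.1ℤ ℤ.+ - l)          ≡⟨ cong (λ t → ℤ.1ℤ ℤ.+ t) (ℤₚ.neg-distrib-+ ℤ.1ℤ (- l)) ⟩
  ℤ.1ℤ ℤ.+ (ℤ.-1ℤ ℤ.+ - - l)         ≡⟨ ℤₚ.+-assoc ℤ.1ℤ ℤ.-1ℤ (- - l) ⟨
  0ℤ ℤ.+ - - l                       ≡⟨ ℤₚ.+-identityˡ (- - l) ⟩
  - - l                              ≡⟨ ℤₚ.neg-involutive l ⟩
  l                                  ∎
  where open ≡-Reasoning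

-- `- x ≥ l` fails exactly when `x ≥ 1 - l`. The involution `l ↦ 1 - l` is how thresholds are
-- mirrored from here on.
cnt-neg : ∀ l w → cnt l (map -_ w) + cnt (ℤ.suc (- l)) w ≡ length w
cnt-neg l [] = refl
cnt-neg l (x ∷ w) = trans (arith (le l (- x)) _ (le (ℤ.suc (- l)) x) _) (cong₂ _+_ one (cnt-neg l w))
  where
  arith : ∀ a b c d → a + b + (c + d) ≡ (a + c) + (b + d)
  arith = solve-∀
  one : le l (- x) + le (ℤ.suc (- l)) x ≡ 1
  one with l ℤ.≤? - x
  ... | yes p = cong suc (le-false (λ q → ℤₚ.<⇒≱ (ℤₚ.suc[i]≤j⇒i<j q) (≤-neg-swap {l} {x} p)))
  ... | no ¬p = le-true (ℤₚ.i<j⇒suc[i]≤j (neg-<-swap {x} {l} (ℤₚ.≰⇒> ¬p)))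

Cn-neg : ∀ {u v} → length u ≡ length v → Cn u v → Cn (map -_ v) (map -_ u)
Cn-neg {u} {v} e c = cn λ l →
  ≤-balance (≡⇒≤ (cnt-neg l u) ⊕ ≡⇒≤ e ⊕ ≡⇒≥ (cnt-neg l v) ⊕ at c (ℤ.suc (- l)))
    (arith (cnt l (map -_ u)) (cnt l (map -_ v)) (cnt (ℤ.suc (- l)) u) (cnt (ℤ.suc (- l)) v) (length u)
      (length v))
  where
  arith : ∀ a b c d m n → a + (m + (n + (b + d + c))) ≡ b + (a + c + (m + (n + d)))
  arith = solve-∀

Dom-neg : ∀ {u v} → Dom u v → Dom (map -_ v) (map -_ u)
Dom-neg [] = []
Dom-neg (c ∷ d) = Cn-neg (cong suc (Dom⇒length d)) c ∷ Dom-neg d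

-- Both sides count the elements of [±k] that are at least `l`.
cnt-± : ∀ {k u v} → IsB k u → IsB k v → ∀ l → cnt l u + cnt l (map -_ u) ≡ cnt l v + cnt l (map -_ v)
cnt-± {u = u} {v} bu bv l = trans (byAbs u) (trans (sumOf-↭ f (↭-trans (IsB⇒↭ bu) (↭-sym (IsB⇒↭ bv))))
    (sym (byAbs v)))
  where
  f : ℕ → ℕ
  f j = le l (+ j) + le l (- + j)
  entry : ∀ x → le l x + le l (- x) ≡ f ∣ x ∣
  entry (+ j) = refl
  entry -[1+ j ] = +-comm (le l -[1+ j ]) _
  byAbs : ∀ w → cnt l w + cnt l (map -_ w) ≡ sumOf f (map ∣_∣ w)
  byAbs [] = refl
  byAbs (x ∷ w) = trans (arith (le l x) _ (le l (- x)) _) (cong₂ _+_ (entry x) (byAbs w))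
    where
    arith : ∀ a b c d → a + b + (c + d) ≡ (a + c) + (b + d)
    arith = solve-∀

-- Counts over a suffix that starts at a negative position, i.e. over -P followed by the
-- whole window, against counts over the mirrored suffix.
cnt-mirror : ∀ {k} P P′ {S S′} → length P ≡ length P′ → IsB k (P ++ S) → IsB k (P′ ++ S′) → ∀ l →
  cnt l (map -_ P ++ (P ++ S)) + cnt (ℤ.suc (- l)) S′ ≡ cnt l (map -_ P′ ++ (P′ ++ S′)) + cnt (ℤ.suc (- l)) S
cnt-mirror {k} P P′ {S} {S′} e bu bv l
  rewrite sumOf-++ (le l) (map -_ P) (P ++ S) | sumOf-++ (le l) (map -_ P′) (P′ ++ S′) =
  ≡-balance {a = lhs} {b = rhs} eqs
    (arith (cnt l (map -_ P)) (cnt l (map -_ P′)) (cnt l u) (cnt l v) (cnt l′ S) (cnt l′ S′) (cnt l′ P)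
      (cnt l′ P′)
           (cnt l (map -_ u)) (cnt l (map -_ v)) (cnt l′ u) (cnt l′ v) (length P) (length P′) (length u)
             (length v))
  where
  u = P ++ S
  v = P′ ++ S′
  l′ = ℤ.suc (- l)
  lhs = cnt l (map -_ P) + cnt l′ P + (length P + (length P′ + (cnt l u + cnt l (map -_ u) +
          (length u + (cnt l (map -_ v) + cnt l′ v + (length v + (cnt l′ u + (cnt l′ P′ + cnt l′ S′))))))))
  rhs = length P + (length P′ + (cnt l (map -_ P′) + cnt l′ P′ + (cnt l v + cnt l (map -_ v) +
          (cnt l (map -_ u) + cnt l′ u + (length v + (length u + (cnt l′ P + cnt l′ S + cnt l′ v)))))))
  eqs : lhs ≡ rhs
  eqs = cong₂ _+_ (cnt-neg l P) (cong₂ _+_ e (cong₂ _+_ (sym (cnt-neg l P′)) (cong₂ _+_ (cnt-± bu bv l)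
          (cong₂ _+_ (sym (cnt-neg l u))
            (cong₂ _+_ (cnt-neg l v) (cong₂ _+_ (trans (proj₁ bv) (sym (proj₁ bu)))
              (cong₂ _+_ (sumOf-++ (le l′) P S) (sym (sumOf-++ (le l′) P′ S′)))))))))
  arith : ∀ a a′ b b′ c c′ d d′ e e′ f f′ g g′ h h′ →
    a + b + c′ + (g + (g′ + (a′ + d′ + (b′ + e′ + (e + f + (h′ + (h + (d + c + f′)))))))) ≡
    a′ + b′ + c + (a + d + (g + (g′ + (b + e + (h + (e′ + f′ + (h′ + (f + (d′ + c′)))))))))
  arith = solve-∀

module _ {A : Set} {P : A → Set} (P? : ∀ a → Dec (P a)) where

  findLast : ∀ xs → (∃ λ as → ∃ λ a → ∃ λ bs → xs ≡ as ++ a ∷ bs × P a × All (¬_ ∘ P) bs) ⊎ All (¬_ ∘ P) xs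
  findLast [] = inj₂ []
  findLast (x ∷ xs) with findLast xs
  ... | inj₁ (as , a , bs , refl , pa , none) = inj₁ (x ∷ as , a , bs , refl , pa , none)
  ... | inj₂ none with P? x
  ... | yes px = inj₁ ([] , x , xs , refl , px , none)
  ... | no ¬px = inj₂ (¬px ∷ none)

  findFirst : ∀ xs → (∃ λ as → ∃ λ a → ∃ λ bs → xs ≡ as ++ a ∷ bs × P a × All (¬_ ∘ P) as) ⊎ All (¬_ ∘ P) xs
  findFirst [] = inj₂ []
  findFirst (x ∷ xs) with P? x
  ... | yes px = inj₁ ([] , x , xs , refl , px , [])
  ... | no ¬px with findFirst xs
  ... | inj₁ (as , a , bs , refl , pa , none) = inj₁ (x ∷ as , a , bs , refl , pa , ¬px ∷ none)
  ... | inj₂ none = inj₂ (¬px ∷ none)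

AllPairs-before : ∀ {A : Set} {R : A → A → Set} P {x Q} → AllPairs R (P ++ x ∷ Q) → All (λ p → R p x) P
AllPairs-before [] _ = []
AllPairs-before (p ∷ P) (h ∷ hs) = All.lookup h (∈-++⁺ʳ P (here refl)) ∷ AllPairs-before P hs

AllPairs-after : ∀ {A : Set} {R : A → A → Set} P {x Q} → AllPairs R (P ++ x ∷ Q) → All (R x) Q
AllPairs-after [] (h ∷ _) = h
AllPairs-after (p ∷ P) (_ ∷ hs) = AllPairs-after P hs

-- Covers below a given element

-- `m` lies outside `[ y , x )`, the range of values to which an entry `x` may be lowered when the
-- larger window has `y` in its place.
Gap : ℤ → ℤ → ℤ → Set
Gap y x m = ¬ (y ℤ.≤ m × m ℤ.< x)

module _ {y x m : ℤ} (gap : Gap y x m) where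

  gap-< : m ℤ.< x → m ℤ.< y
  gap-< m<x = ℤₚ.≰⇒> (λ y≤m → gap (y≤m , m<x))

  gap-≤ : y ℤ.≤ m → x ℤ.≤ m
  gap-≤ y≤m = ℤₚ.≮⇒≥ (λ m<x → gap (y≤m , m<x))

  gap-> : m ≢ x → y ℤ.≤ m → x ℤ.< m
  gap-> m≢x y≤m = ℤₚ.≤∧≢⇒< (gap-≤ y≤m) (m≢x ∘ sym)

∣∣≢⇒≢ : ∀ {x y : ℤ} → ∣ x ∣ ≢ ∣ y ∣ → x ≢ y
∣∣≢⇒≢ ne refl = ne refl

∣∣≢⇒-≢ : ∀ {x y : ℤ} → ∣ x ∣ ≢ ∣ y ∣ → - x ≢ y
∣∣≢⇒-≢ {x} ne refl = ne (sym (ℤₚ.∣-i∣≡∣i∣ x))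

module _ {x y z : ℤ} (y≤z : y ℤ.≤ z) (z<x : z ℤ.< x) (Q : List ℤ) where

  -- If l lies in (z , x], the entries of N that are ≥ l are those ≥ y, and at threshold y the
  -- hypothesis counts x on the left and y on the right.
  Cn-lower : ∀ N N′ → All (Gap y x) N → Cn (N ++ x ∷ Q) (N′ ++ y ∷ Q) → Cn (N ++ z ∷ Q) (N′ ++ y ∷ Q)
  Cn-lower N N′ gaps c = cn go
    where
    same : ∀ {l} → le l x ≡ le l z → cnt l (N′ ++ y ∷ Q) ≤ cnt l (N ++ z ∷ Q)
    same {l} e = ≤-balance (at c l ⊕ ≡⇒≤ (sumOf-replace₁ (le l) N x z Q) ⊕ ≡⇒≤ e)
      (arith (cnt l (N′ ++ y ∷ Q)) (cnt l (N ++ z ∷ Q)) (cnt l (N ++ x ∷ Q)) (le l x) (le l z))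
      where
      arith : ∀ a b c d e → a + (c + (b + d + e)) ≡ b + (a + (c + e + d))
      arith = solve-∀
    go : ∀ l → cnt l (N′ ++ y ∷ Q) ≤ cnt l (N ++ z ∷ Q)
    go l with l ℤ.≤? z | l ℤ.≤? x
    ... | yes l≤z | _ = same (trans (le-true (ℤₚ.≤-trans l≤z (ℤₚ.<⇒≤ z<x))) (sym (le-true l≤z)))
    ... | no l≰z | no l≰x = same (trans (le-false l≰x) (sym (le-false l≰z)))
    ... | no l≰z | yes l≤x =
      ≤-balance
        (at c y ⊕ ≡⇒≤ (sumOf-++ (le y) N (x ∷ Q)) ⊕ ≡⇒≥ (sumOf-++ (le y) N′ (y ∷ Q))
          ⊕ ≡⇒≤ (sumOf-++ (le l) N′ (y ∷ Q)) ⊕ ≡⇒≥ (sumOf-++ (le l) N (z ∷ Q))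
          ⊕ 𝟙≤1 (y ℤ.≤? x) ⊕ ≡⇒≥ (le-true (ℤₚ.≤-refl {y}))
          ⊕ sumOf-mono {f = le y} {le l} (All.map upward gaps)
          ⊕ sumOf-mono {f = le l} {le y} (All.universal downward N′)
          ⊕ ≡⇒≤ (le-false {l} {y} (λ l≤y → l≰z (ℤₚ.≤-trans l≤y y≤z))) ⊕ z≤n {le l z})
        (arith (cnt l (N′ ++ y ∷ Q)) (cnt l (N ++ z ∷ Q)) (cnt y (N′ ++ y ∷ Q)) (cnt y (N ++ x ∷ Q))
          (cnt y N) (le y x) (cnt y Q) (cnt y N′) (le y y) (cnt l N′) (le l y) (cnt l Q) (cnt l N) (le l z))
      where
      upward : ∀ {m} → Gap y x m → le y m ≤ le l m
      upward {m} g = le-mono {y} {m} {l} {m} (λ y≤m → ℤₚ.≤-trans l≤x (gap-≤ g y≤m))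
      downward : ∀ m → le l m ≤ le y m
      downward m = le-mono {l} {m} {y} {m} (ℤₚ.≤-trans (ℤₚ.≤-trans y≤z (ℤₚ.<⇒≤ (ℤₚ.≰⇒> l≰z))))
      arith : ∀ A B C D a b c d e f g h i j →
        A + (D + ((a + (b + c)) + (C + ((f + (g + h)) + (B + (1 + (e + (i + (d + (0 + j))))))))))
        ≡ B + (C + (D + ((d + (e + c)) + (A + ((i + (j + h)) + (b + (1 + (a + (f + (g + 0))))))))))
      arith = solve-∀

  Dom-lower : ∀ N N′ → length N ≡ length N′ → All (Gap y x) N →
    Dom (N ++ x ∷ Q) (N′ ++ y ∷ Q) → Dom (N ++ z ∷ Q) (N′ ++ y ∷ Q)
  Dom-lower [] [] _ gs (c ∷ d) = Cn-lower [] [] gs c ∷ d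
  Dom-lower (m ∷ N) (m′ ∷ N′) e (g ∷ gs) (c ∷ d) =
    Cn-lower (m ∷ N) (m′ ∷ N′) (g ∷ gs) c ∷ Dom-lower N N′ (suc-injective e) gs d

  -- Suffixes that contain both positions keep their entries up to order; those that begin later see
  -- only `x` lowered to `z`, which is `Dom-lower`.
  Dom-swap : ∀ P M N′ → length (P ++ z ∷ M) ≡ length N′ → All (Gap y x) M →
    Dom ((P ++ z ∷ M) ++ x ∷ Q) (N′ ++ y ∷ Q) → Dom (P ++ x ∷ M ++ z ∷ Q) (N′ ++ y ∷ Q)
  Dom-swap [] M (m′ ∷ N′) e gs (c ∷ d) =
    Cn-trans (cn λ l → ≡⇒≥ (cnt-swap l [] z M x Q)) c ∷ Dom-lower M N′ (suc-injective e) gs d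
  Dom-swap (p ∷ P) M (m′ ∷ N′) e gs (c ∷ d) =
    Cn-trans (cn λ l → ≤-trans (≡⇒≤ (cong (cnt l) (++-assoc (p ∷ P) (z ∷ M) (x ∷ Q))))
                                  (≡⇒≥ (cnt-swap l (p ∷ P) z M x Q))) c
    ∷ Dom-swap P M N′ (suc-injective e) gs d

-- For opposite signs a double sign change preserves the number of negative entries, and the
-- thresholds `( - x , z ]` and `( - z , x ]` at which the two positions lose a count do not
-- overlap.
Opposite : ℤ → ℤ → Set
Opposite z x = (z ℤ.< 0ℤ × 0ℤ ℤ.< x) ⊎ (0ℤ ℤ.< z × x ℤ.< 0ℤ)

module _ {k : ℕ} {x y z : ℤ} (y≤-z : y ℤ.≤ - z) (-z<x : - z ℤ.< x) (opp : Opposite z x) (M Q : List ℤ) where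

  private
    -- The counts lost at thresholds in (-x , z] are mirror images of those lost in (-z , x].
    Cn-flip₂ : ∀ P₀ P₀′ P N′ → length P₀ ≡ length P₀′ →
      IsB k (P₀ ++ ((P ++ z ∷ M) ++ x ∷ Q)) → IsB k (P₀′ ++ (N′ ++ y ∷ Q)) →
      All (Gap y x) P₀ → All (λ p → Gap y x (- p)) P₀ → All (Gap y x) (P ++ z ∷ M) →
      Cn ((P ++ z ∷ M) ++ x ∷ Q) (N′ ++ y ∷ Q) → Cn (P ++ - x ∷ M ++ - z ∷ Q) (N′ ++ y ∷ Q)
    Cn-flip₂ P₀ P₀′ P N′ e bu bv g₀ g₀′ gs c = cn go
      where
      S  = (P ++ z ∷ M) ++ x ∷ Q
      S′ = N′ ++ y ∷ Q
      assoc : ∀ w → (P ++ z ∷ M) ++ w ≡ P ++ z ∷ M ++ w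
      assoc w = ++-assoc P (z ∷ M) w
      unaffected : ∀ l → le l z ≤ le l (- x) → cnt l S′ ≤ cnt l (P ++ - x ∷ M ++ - z ∷ Q)
      unaffected l h = ≤-balance
        (at (Cn-lower y≤-z -z<x Q (P ++ z ∷ M) N′ gs c) l ⊕ ≡⇒≤ (cong (cnt l) (assoc (- z ∷ Q)))
          ⊕ ≡⇒≤ (sumOf-replace₁ (le l) P z (- x) (M ++ - z ∷ Q)) ⊕ h)
        (arith (cnt l S′) (cnt l (P ++ - x ∷ M ++ - z ∷ Q)) (cnt l ((P ++ z ∷ M) ++ - z ∷ Q))
          (cnt l (P ++ z ∷ M ++ - z ∷ Q)) (le l z) (le l (- x)))
        where
        arith : ∀ a b c d e f → a + (c + (d + (b + e + f))) ≡ b + (a + (c + (d + f + e)))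
        arith = solve-∀
      go : ∀ l → cnt l S′ ≤ cnt l (P ++ - x ∷ M ++ - z ∷ Q)
      go l with l ℤ.≤? z | l ℤ.≤? - x
      -- Here `z` counts at `l` and `- x` does not, so one unit of slack is needed. The mirrored
      -- threshold `L = 1 - l` lies in `( - z , x ]`, where lowering `x` to `- z` in the mirrored
      -- suffix costs one and still leaves domination; the mirror identity carries that unit back to
      -- `l`.
      ... | yes l≤z | no l≰-x =
        ≤-balance (≡⇒≤ mirror ⊕ at lowered L ⊕ ≡⇒≥ (sumOf-replace₁ (le L) N x (- z) Q)
                    ⊕ ≡⇒≥ (le-true L≤x) ⊕ ≡⇒≤ (le-false L≰-z)
                    ⊕ ≡⇒≤ (cong (cnt l) (assoc (x ∷ Q))) ⊕ ≡⇒≤ (sumOf-replace₂ (le l) P z (- x) M x (- z) Q)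
                    ⊕ 𝟙≤1 (l ℤ.≤? z) ⊕ z≤n {le l (- x)} ⊕ le-mono {l} {x} {l} { - z} (disjoint opp))
          (arith (cnt l S′) (cnt l (P ++ - x ∷ M ++ - z ∷ Q)) (cnt L (N ++ x ∷ Q)) (cnt L (N″ ++ y ∷ Q))
            (cnt l S)
            (cnt L (N ++ - z ∷ Q)) (le L x) (le L (- z)) (cnt l (P ++ z ∷ M ++ x ∷ Q)) (le l z) (le l x)
            (le l (- x)) (le l (- z)))
        where
        L = ℤ.suc (- l)
        N = map -_ P₀ ++ (P₀ ++ (P ++ z ∷ M))
        N″ = map -_ P₀′ ++ (P₀′ ++ N′)
        reassoc : ∀ {A : Set} (a b c d : List A) → (a ++ (b ++ c)) ++ d ≡ a ++ (b ++ (c ++ d))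
        reassoc a b c d = trans (++-assoc a (b ++ c) d) (cong (a ++_) (++-assoc b c d))
        mirror : cnt L (N ++ x ∷ Q) + cnt l S′ ≡ cnt L (N″ ++ y ∷ Q) + cnt l S
        mirror rewrite reassoc (map -_ P₀) P₀ (P ++ z ∷ M) (x ∷ Q) | reassoc (map -_ P₀′) P₀′ N′ (y ∷ Q) =
          subst (λ t → cnt L (map -_ P₀ ++ (P₀ ++ S)) + cnt t S′ ≡ cnt L (map -_ P₀′ ++ (P₀′ ++ S′)) + cnt t S)
            (suc-neg-involutive l) (cnt-mirror P₀ P₀′ e bu bv L)
        mirrored : Cn (N ++ x ∷ Q) (N″ ++ y ∷ Q)
        mirrored rewrite reassoc (map -_ P₀) P₀ (P ++ z ∷ M) (x ∷ Q) | reassoc (map -_ P₀′) P₀′ N′ (y ∷ Q) =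
            cn λ j →
          ≤-balance (≡⇒≥ (cnt-mirror P₀ P₀′ e bu bv j) ⊕ at c (ℤ.suc (- j)))
            (arith₁ (cnt j (map -_ P₀′ ++ (P₀′ ++ S′))) (cnt j (map -_ P₀ ++ (P₀ ++ S)))
              (cnt (ℤ.suc (- j)) S) (cnt (ℤ.suc (- j)) S′))
          where
          arith₁ : ∀ a b c d → a + (b + d + c) ≡ b + (a + c + d)
          arith₁ = solve-∀
        lowered : Cn (N ++ - z ∷ Q) (N″ ++ y ∷ Q)
        lowered = Cn-lower y≤-z -z<x Q N N″ (Allₚ.++⁺ (Allₚ.map⁺ g₀′) (Allₚ.++⁺ g₀ gs)) mirrored
        L≤x : L ℤ.≤ x
        L≤x = ℤₚ.i<j⇒suc[i]≤j (neg-<-swap {x} {l} (ℤₚ.≰⇒> l≰-x))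
        L≰-z : ¬ L ℤ.≤ - z
        L≰-z p = ℤₚ.<⇒≱ (ℤₚ.suc[i]≤j⇒i<j p) (ℤₚ.neg-mono-≤ l≤z)
        disjoint : Opposite z x → l ℤ.≤ x → l ℤ.≤ - z
        disjoint (inj₁ (z<0 , _)) l≤x = ℤₚ.≤-trans l≤z (ℤₚ.<⇒≤ (ℤₚ.<-trans z<0 (ℤₚ.neg-mono-< z<0)))
        disjoint (inj₂ (_ , x<0)) l≤x = contradiction
            (ℤₚ.≤-trans l≤x (ℤₚ.<⇒≤ (ℤₚ.<-trans x<0 (ℤₚ.neg-mono-< x<0)))) l≰-x
        arith : ∀ a b c d e f g h i j k m n →
          a + (d + e + (f + (c + h + (g + (0 + (i + (b + (j + k) + (1 + (m + n)))))))))
          ≡ b + (c + a + (d + (f + g + (1 + (h + (e + (i + (m + n) + (j + (0 + k)))))))))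
        arith = solve-∀
      ... | yes _ | yes l≤-x = unaffected l (≤-trans (𝟙≤1 (l ℤ.≤? z)) (≡⇒≥ (le-true l≤-x)))
      ... | no l≰z | _ = unaffected l (subst (_≤ le l (- x)) (sym (le-false l≰z)) z≤n)

    -- `P₀` accumulates the entries already passed, from which the mirrored suffix, `P₀` negated
    -- followed by the whole window, is formed at each position up to that of `z`. Beyond it only
    -- the lowering of `x` is visible.
    Dom-flip₂-at : ∀ P₀ P₀′ P N′ → length P₀ ≡ length P₀′ → length (P ++ z ∷ M) ≡ length N′ →
      IsB k (P₀ ++ ((P ++ z ∷ M) ++ x ∷ Q)) → IsB k (P₀′ ++ (N′ ++ y ∷ Q)) →
      All (Gap y x) P₀ → All (λ p → Gap y x (- p)) P₀ → All (Gap y x) (P ++ z ∷ M) → All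
        (λ p → Gap y x (- p)) P →
      Dom ((P ++ z ∷ M) ++ x ∷ Q) (N′ ++ y ∷ Q) → Dom (P ++ - x ∷ M ++ - z ∷ Q) (N′ ++ y ∷ Q)
    Dom-flip₂-at P₀ P₀′ [] (m′ ∷ N′) e e′ bu bv g₀ g₀′ gs@(_ ∷ gM) [] (c ∷ d) =
      Cn-flip₂ P₀ P₀′ [] (m′ ∷ N′) e bu bv g₀ g₀′ gs c ∷ Dom-lower y≤-z -z<x Q M N′ (suc-injective e′) gM d
    Dom-flip₂-at P₀ P₀′ (p ∷ P) (m′ ∷ N′) e e′ bu bv g₀ g₀′ (g ∷ gs) (h ∷ hs) (c ∷ d) =
      Cn-flip₂ P₀ P₀′ (p ∷ P) (m′ ∷ N′) e bu bv g₀ g₀′ (g ∷ gs) c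
      ∷ Dom-flip₂-at (P₀ ++ p ∷ []) (P₀′ ++ m′ ∷ []) P N′
          (trans (length-++ P₀) (trans (cong (_+ 1) e) (sym (length-++ P₀′)))) (suc-injective e′)
          (subst (IsB k) (sym (++-assoc P₀ (p ∷ []) _)) bu) (subst (IsB k) (sym (++-assoc P₀′ (m′ ∷ []) _)) bv)
          (Allₚ.++⁺ g₀ (g ∷ [])) (Allₚ.++⁺ g₀′ (h ∷ [])) gs hs d

  Dom-flip₂ : ∀ P N′ → length (P ++ z ∷ M) ≡ length N′ →
    IsB k ((P ++ z ∷ M) ++ x ∷ Q) → IsB k (N′ ++ y ∷ Q) →
    All (Gap y x) (P ++ z ∷ M) → All (λ p → Gap y x (- p)) P →
    Dom ((P ++ z ∷ M) ++ x ∷ Q) (N′ ++ y ∷ Q) → Dom (P ++ - x ∷ M ++ - z ∷ Q) (N′ ++ y ∷ Q)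
  Dom-flip₂ P N′ e bu bv = Dom-flip₂-at [] [] P N′ refl e bu bv [] []

-- The gap keeps the entries between the two positions out of the values between `z` and `x`, so
-- none of them gains an inversion and only the swapped pair does.
pairs-swap-≤ : ∀ {y} P {z} M {x} Q → y ℤ.≤ z → z ℤ.< x → All (Gap y x) M → All (_≢ x) M →
  invPairs (P ++ x ∷ M ++ z ∷ Q) ≤ 1 + invPairs (P ++ z ∷ M ++ x ∷ Q)
pairs-swap-≤ P {z} M {x} Q y≤z z<x gs ne =
  ≤-balance (pairSum-replace₂ invs P x z M z x Q
      (All.universal (λ p → ≡⇒≤ (+-comm (invs p x) (invs p z))) P)
      (All.zipWith (λ {m} → middle m) (gs , ne))
      (All.universal (λ q → ≡⇒≤ (+-comm (invs x q) (invs z q))) Q)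
    ⊕ ≡⇒≤ (invs-swap z<x))
    (arith (invPairs (P ++ x ∷ M ++ z ∷ Q)) (invPairs (P ++ z ∷ M ++ x ∷ Q)) (invs x z) (invs z x))
  where
  arith : ∀ a b c d → a + (b + c + (1 + d)) ≡ 1 + b + (a + d + c)
  arith = solve-∀
  middle : ∀ m → Gap _ x m × m ≢ x → invs x m + invs m z ≤ invs z m + invs m x
  middle m (g , m≢x) rewrite lt-neg-swap m z | lt-neg-swap x m =
    ≤-balance (lt-mono {m} {x} {m} {z} (λ p → ℤₚ.<-≤-trans (gap-< g p) y≤z)
               ⊕ lt-mono {z} {m} {x} {m} (λ p → gap-> g m≢x (ℤₚ.≤-trans y≤z (ℤₚ.<⇒≤ p))))
      (shuffle (lt m z) (lt z (- m)) (lt x m) (lt m (- x)) (lt m x) (lt z m))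
    where
    shuffle : ∀ a b c d e f → e + d + (f + b) + (a + c) ≡ a + b + (c + d) + (e + f)
    shuffle = solve-∀

-- In the full window `- z` stands at a negative position and `x` at a positive one; between them
-- lie `P` negated, `P`, `z` and `M`. The gap on `P`, on its negatives and on `M` again leaves a
-- single new pair.
pairs-flip₂-≤ : ∀ {y} P {z} M {x} Q → y ℤ.≤ - z → - z ℤ.< x →
  All (Gap y x) P → All (λ p → Gap y x (- p)) P → All (λ p → ∣ p ∣ ≢ ∣ x ∣) P →
  All (Gap y x) M → All (_≢ x) M →
  invPairs (P ++ - x ∷ M ++ - z ∷ Q) ≤ 1 + invPairs (P ++ z ∷ M ++ x ∷ Q)
pairs-flip₂-≤ {y} P {z} M {x} Q y≤-z -z<x gP gP′ nP gM nM =
  ≤-balance (pairSum-replace₂ invs P (- x) z M (- z) x Q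
      (All.zipWith (λ {p} → left p) (gP , All.zip (gP′ , nP))) (All.zipWith (λ {m} → middle m) (gM , nM))
      (All.universal right Q)
    ⊕ ≡⇒≤ (invs-flip₂ {z} {x} -z<x))
    (arith (invPairs (P ++ - x ∷ M ++ - z ∷ Q)) (invPairs (P ++ z ∷ M ++ x ∷ Q))
      (invs (- x) (- z)) (invs z x))
  where
  arith : ∀ a b c d → a + (b + c + (1 + d)) ≡ 1 + b + (a + d + c)
  arith = solve-∀
  left : ∀ p → Gap y x p × Gap y x (- p) × ∣ p ∣ ≢ ∣ x ∣ →
    invs p (- x) + invs p (- z) ≤ invs p z + invs p x
  left p (g , g′ , ne) =
    (lt-mono { - x} {p} {z} {p} (λ h → ℤₚ.neg-cancel-< (ℤₚ.<-≤-trans (gap-< g′ (neg-<-swap {x} {p} h)) y≤-z))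
     ⊕ lt-mono { - x} { - p} {z} { - p} (λ h → <-neg-swap {p} {z}
       (ℤₚ.<-≤-trans (gap-< g (ℤₚ.neg-cancel-< h)) y≤-z)))
    ⊕ (lt-mono { - z} {p} {x} {p} (λ h → gap-> g (∣∣≢⇒≢ ne) (ℤₚ.≤-trans y≤-z (ℤₚ.<⇒≤ h)))
     ⊕ lt-mono { - z} { - p} {x} { - p} (λ h → gap-> g′ (∣∣≢⇒-≢ ne) (ℤₚ.≤-trans y≤-z (ℤₚ.<⇒≤ h))))
  middle : ∀ m → Gap y x m × m ≢ x → invs (- x) m + invs m (- z) ≤ invs z m + invs m x
  middle m (g , m≢x) rewrite lt-neg-swap x m | ℤₚ.neg-involutive x | lt-neg z m =
    ≤-balance (lt-mono {m} {x} {m} { - z} (λ p → ℤₚ.<-≤-trans (gap-< g p) y≤-z)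
               ⊕ lt-mono { - z} {m} {x} {m} (λ p → gap-> g m≢x (ℤₚ.≤-trans y≤-z (ℤₚ.<⇒≤ p))))
      (shuffle (lt m z) (lt m (- z)) (lt x m) (lt m (- x)) (lt m x) (lt (- z) m))
    where
    shuffle : ∀ a b c d e f → d + e + (f + a) + (b + c) ≡ a + b + (c + d) + (e + f)
    shuffle = solve-∀
  right : ∀ q → invs (- x) q + invs (- z) q ≤ invs z q + invs x q
  right q rewrite ℤₚ.neg-involutive x | ℤₚ.neg-involutive z =
    ≡⇒≤ (shuffle (lt q z) (lt q (- z)) (lt q x) (lt q (- x)))
    where
    shuffle : ∀ a b c d → d + c + (b + a) ≡ a + b + (c + d)
    shuffle = solve-∀

pairs-flip₁-≤ : ∀ {y} P {x} Q → y ℤ.≤ - x → - x ℤ.< x → All (Gap y x) P → All (_≢ x) P →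
  invPairs (P ++ - x ∷ Q) ≤ invPairs (P ++ x ∷ Q)
pairs-flip₁-≤ {y} P {x} Q y≤-x -x<x gs ne =
  pairSum-replace₁ invs P (- x) x Q (All.zipWith (λ {p} → left p) (gs , ne)) (All.universal right Q)
  where
  left : ∀ p → Gap y x p × p ≢ x → invs p (- x) ≤ invs p x
  left p (g , p≢x) =
    lt-mono { - x} {p} {x} {p} (λ h → gap-> g p≢x (ℤₚ.≤-trans y≤-x (ℤₚ.<⇒≤ h)))
    ⊕ lt-mono { - x} { - p} {x} { - p} (λ h → <-neg-swap {p} {x}
      (ℤₚ.<-≤-trans (gap-< g (ℤₚ.neg-cancel-< h)) y≤-x))
  right : ∀ q → invs (- x) q ≤ invs x q
  right q rewrite ℤₚ.neg-involutive x = ≡⇒≤ (+-comm (lt q (- x)) _)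

-- The gap conditions are recorded for two later purposes: they make the length grow by exactly one,
-- and they keep the counts seen by the untouched blocks of a code unchanged.
data CoverStep (P : List ℤ) (x : ℤ) (Q : List ℤ) (y : ℤ) (v : List ℤ) : Set where
  swap  : ∀ P₁ z M → P ≡ P₁ ++ z ∷ M → y ℤ.≤ z → z ℤ.< x → All (Gap y x) M →
          Dom (P₁ ++ x ∷ M ++ z ∷ Q) v → CoverStep P x Q y v
  flip₁ : y ℤ.≤ - x → - x ℤ.< x → All (Gap y x) P → Dom (P ++ - x ∷ Q) v → CoverStep P x Q y v
  flip₂ : ∀ P₁ z M → P ≡ P₁ ++ z ∷ M → y ℤ.≤ - z → - z ℤ.< x → Opposite z x →
          All (Gap y x) P → All (λ p → Gap y x (- p)) P₁ →
          Dom (P₁ ++ - x ∷ M ++ - z ∷ Q) v → CoverStep P x Q y v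

nonzero-sign : ∀ z → 1 ≤ ∣ z ∣ → z ℤ.< 0ℤ ⊎ 0ℤ ℤ.< z
nonzero-sign (+ suc _) _ = inj₂ (ℤ.+<+ (s≤s z≤n))
nonzero-sign -[1+ _ ] _ = inj₁ ℤ.-<+

0<x⇒-x<x : ∀ {x} → 0ℤ ℤ.< x → - x ℤ.< x
0<x⇒-x<x 0<x = ℤₚ.<-trans (ℤₚ.neg-mono-< 0<x) 0<x

-- With the tail `Q` shared, the threshold `y` counts the head on the larger side, hence also `x`.
last-difference-< : ∀ P P′ {x y} Q → length P ≡ length P′ → x ≢ y → Dom (P ++ x ∷ Q) (P′ ++ y ∷ Q) → y ℤ.< x
last-difference-< P P′ {x} {y} Q e x≢y d = ℤₚ.≤∧≢⇒< (𝟙-positive (y ℤ.≤? x) counted) (x≢y ∘ sym)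
  where
  counted : 1 ≤ le y x
  counted = subst (_≤ le y x) (le-true (ℤₚ.≤-refl {y}))
    (+-cancelʳ-≤ (cnt y Q) (le y y) (le y x) (at (Dom⇒Cn (Dom-suffix P P′ e d)) y))

-- One of `y` and `- y` stands in `P` or is `x`, because `Q` is shared with the larger window; so
-- one of the three searches succeeds. A swap takes the nearest candidate to the left of `x`;
-- `flip₂` takes the first one in `P`, the nearest on the negative side of the full window. The sign
-- change of `x` is tried before `flip₂`: its failure is what forces opposite signs there.
cover : ∀ {k} P P′ {x y} Q → length P ≡ length P′ → IsB k (P ++ x ∷ Q) → IsB k (P′ ++ y ∷ Q) →
  x ≢ y → Dom (P ++ x ∷ Q) (P′ ++ y ∷ Q) → CoverStep P x Q y (P′ ++ y ∷ Q)
cover {k} P P′ {x} {y} Q e bu bv x≢y d = findSwap (findLast inRange? P)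
  where
  y<x : y ℤ.< x
  y<x = last-difference-< P P′ Q e x≢y d
  inRange? : ∀ m → Dec (y ℤ.≤ m × m ℤ.< x)
  inRange? m = (y ℤ.≤? m) ×-dec (m ℤ.<? x)
  bounds : ∀ {w a} → IsB k w → a ∈ w → 1 ≤ ∣ a ∣ × ∣ a ∣ ≤ k
  bounds b = All.lookup (proj₁ (proj₂ b))

  none-absurd : All (Gap y x) P → ¬ (y ℤ.≤ - x × - x ℤ.< x) → ¬ All (λ p → Gap y x (- p)) P
  none-absurd gs ¬flip₁ gs′ with bounds bv (∈-++⁺ʳ P′ (here refl))
  ... | 1≤y , y≤k with IsB-∋ bu {y} 1≤y y≤k
  ... | a , a∈ , ∣y∣≡∣a∣ with ∈-++⁻ P a∈ | ∣x∣≡∣y∣ y a ∣y∣≡∣a∣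
  ... | inj₁ a∈P | inj₁ refl = All.lookup gs a∈P (ℤₚ.≤-refl , y<x)
  ... | inj₁ a∈P | inj₂ refl = All.lookup gs′ a∈P (ℤₚ.≤-refl , y<x)
  ... | inj₂ (here refl) | inj₁ refl = x≢y refl
  ... | inj₂ (here refl) | inj₂ refl = ¬flip₁ (ℤₚ.≤-refl , y<x)
  ... | inj₂ (there a∈Q) | _ = All.lookup (AllPairs-after P′ (proj₂ (proj₂ bv))) a∈Q ∣y∣≡∣a∣

  -- If `z` and `x` were both positive, failure of the sign change would give `- x < y ≤ - z`, hence
  -- `y ≤ z < x`, which the gap excludes. If both were negative, `- z < x` would fail.
  opposite : ∀ z → z ∈ P → Gap y x z → y ℤ.≤ - z → - z ℤ.< x → ¬ (y ℤ.≤ - x × - x ℤ.< x) → Opposite z x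
  opposite z z∈ g y≤-z -z<x ¬flip₁
    with nonzero-sign x (proj₁ (bounds bu (∈-++⁺ʳ P (here refl)))) | nonzero-sign z
      (proj₁ (bounds bu (∈-++⁺ˡ z∈)))
  ... | inj₂ 0<x | inj₁ z<0 = inj₁ (z<0 , 0<x)
  ... | inj₁ x<0 | inj₂ 0<z = inj₂ (0<z , x<0)
  ... | inj₁ x<0 | inj₁ z<0 = contradiction (ℤₚ.<-trans (ℤₚ.neg-mono-< z<0) -z<x) (ℤₚ.<-asym x<0)
  ... | inj₂ 0<x | inj₂ 0<z = contradiction (y≤z , z<x) g
    where
    y≤z : y ℤ.≤ z
    y≤z = ℤₚ.≤-trans y≤-z (ℤₚ.<⇒≤ (0<x⇒-x<x 0<z))
    -x<y : - x ℤ.< y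
    -x<y = ℤₚ.≰⇒> (λ y≤-x → ¬flip₁ (y≤-x , 0<x⇒-x<x 0<x))
    z<x : z ℤ.< x
    z<x = ℤₚ.neg-cancel-< (ℤₚ.<-≤-trans -x<y y≤-z)

  findFlip₂ : All (Gap y x) P → ¬ (y ℤ.≤ - x × - x ℤ.< x) →
    (∃ λ P₁ → ∃ λ z → ∃ λ M → P ≡ P₁ ++ z ∷ M × (y ℤ.≤ - z × - z ℤ.< x) × All (λ p → Gap y x (- p)) P₁)
      ⊎ All (λ p → Gap y x (- p)) P →
    CoverStep P x Q y (P′ ++ y ∷ Q)
  findFlip₂ gs ¬flip₁ (inj₂ none) = contradiction none (none-absurd gs ¬flip₁)
  findFlip₂ gs ¬flip₁ (inj₁ (P₁ , z , M , refl , (y≤-z , -z<x) , gs′)) =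
    flip₂ P₁ z M refl y≤-z -z<x opp gs gs′ (Dom-flip₂ y≤-z -z<x opp M Q P₁ P′ e bu bv gs gs′ d)
    where
    z∈ = ∈-++⁺ʳ P₁ (here refl)
    opp = opposite z z∈ (All.lookup gs z∈) y≤-z -z<x ¬flip₁

  findFlip : All (Gap y x) P → CoverStep P x Q y (P′ ++ y ∷ Q)
  findFlip gs with inRange? (- x)
  ... | yes (y≤-x , -x<x) = flip₁ y≤-x -x<x gs (Dom-lower y≤-x -x<x Q P P′ e gs d)
  ... | no ¬flip₁ = findFlip₂ gs ¬flip₁ (findFirst (λ p → inRange? (- p)) P)

  findSwap : (∃ λ P₁ → ∃ λ z → ∃ λ M → P ≡ P₁ ++ z ∷ M × (y ℤ.≤ z × z ℤ.< x) × All (Gap y x) M) ⊎ All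
      (Gap y x) P →
    CoverStep P x Q y (P′ ++ y ∷ Q)
  findSwap (inj₁ (P₁ , z , M , refl , (y≤z , z<x) , gs)) =
    swap P₁ z M refl y≤z z<x gs (Dom-swap y≤z z<x Q P₁ M P′ e gs d)
  findSwap (inj₂ gs) = findFlip gs

lastDifference : ∀ {A : Set} → DecidableEquality A → ∀ (xs ys : List A) → length xs ≡ length ys → xs ≢ ys →
  ∃ λ P → ∃ λ x → ∃ λ P′ → ∃ λ y → ∃ λ Q → xs ≡ P ++ x ∷ Q × ys ≡ P′ ++ y ∷ Q × length P ≡ length P′ × x ≢ y
lastDifference _≟_ [] [] _ ne = contradiction refl ne
lastDifference _≟_ (x ∷ xs) (y ∷ ys) e ne with ≡-dec _≟_ xs ys
... | yes refl = [] , x , [] , y , xs , refl , refl , refl , λ { refl → ne refl }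
... | no xs≢ys with lastDifference _≟_ xs ys (suc-injective e) xs≢ys
... | P , a , P′ , b , Q , refl , refl , f , a≢b = x ∷ P , a , y ∷ P′ , b , Q , refl , refl , cong suc f , a≢b

Dom-raise : ∀ {k u v} → IsB k u → IsB k v → Dom u v → u ≢ v → ∃ λ w → Raise u w × Dom w v
Dom-raise bu bv d u≢v with lastDifference ℤ._≟_ _ _ (Dom⇒length d) u≢v
... | P , x , P′ , y , Q , refl , refl , e , x≢y with cover P P′ Q e bu bv x≢y d
... | swap P₁ z M refl _ z<x _ d′ =
  _ , subst (λ t → Raise t (P₁ ++ x ∷ M ++ z ∷ Q)) (sym (++-assoc P₁ (z ∷ M) (x ∷ Q))) (swap P₁ M Q z<x) , d′
... | flip₁ _ -x<x _ d′ = _ , flip₁ P Q -x<x , d′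
... | flip₂ P₁ z M refl _ -z<x _ _ _ d′ =
  _ , subst (λ t → Raise t (P₁ ++ - x ∷ M ++ - z ∷ Q)) (sym (++-assoc P₁ (z ∷ M) (x ∷ Q)))
    (flip₂ P₁ M Q -z<x) , d′

sumOf-bounded : ∀ {A : Set} c {f : A → ℕ} → (∀ a → f a ≤ c) → ∀ xs → sumOf f xs ≤ length xs * c
sumOf-bounded c h [] = z≤n
sumOf-bounded c h (x ∷ xs) = h x ⊕ sumOf-bounded c h xs

-- A crude bound suffices, as it only limits the number of raises.
ℓB-bounded : ∀ w → ℓB w ≤ length w * (length w * 2) + length w * 1
ℓB-bounded w = subst (_≤ length w * (length w * 2) + length w * 1) (sym (ℓB≡ w))
  (pairs (length w) w ≤-refl ⊕ sumOf-bounded 1 (λ x → 𝟙≤1 (x ℤ.<? 0ℤ)) w)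
  where
  pairs : ∀ b w → length w ≤ b → invPairs w ≤ length w * (b * 2)
  pairs b [] _ = z≤n
  pairs b (x ∷ w) h =
    ≤-trans (sumOf-bounded 2 (λ y → 𝟙≤1 (y ℤ.<? x) ⊕ 𝟙≤1 (y ℤ.<? - x)) w)
               (*-monoˡ-≤ 2 (<⇒≤ h))
    ⊕ pairs b w (<⇒≤ h)

-- Reflections and Bruhat order

map-++-inv : ∀ {A B : Set} (f : A → B) xs P {z R} → map f xs ≡ P ++ z ∷ R →
  ∃ λ P̂ → ∃ λ p → ∃ λ R̂ → xs ≡ P̂ ++ p ∷ R̂ × map f P̂ ≡ P × f p ≡ z × map f R̂ ≡ R
map-++-inv f (x ∷ xs) [] refl = [] , x , xs , refl , refl , refl , refl
map-++-inv f (x ∷ xs) (p ∷ P) e with ∷-injective e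
... | refl , e′ with map-++-inv f xs P e′
... | P̂ , q , R̂ , refl , refl , eq , eq′ = x ∷ P̂ , q , R̂ , refl , refl , eq , eq′

++-split : ∀ {A : Set} (P P′ : List A) {x x′ Q Q′} → length P ≡ length P′ → P ++ x ∷ Q ≡ P′ ++ x′ ∷ Q′ →
  P ≡ P′ × x ≡ x′ × Q ≡ Q′
++-split [] [] _ refl = refl , refl , refl
++-split (p ∷ P) (p′ ∷ P′) e eq with ∷-injective eq
... | refl , eq′ with ++-split P P′ (suc-injective e) eq′
... | refl , a , b = refl , a , b

ι : ℕ → List ℤ
ι = applyUpTo (λ i → + suc i)

applyUpTo-nth : ∀ w → applyUpTo (nth w) (length w) ≡ w
applyUpTo-nth [] = refl
applyUpTo-nth (x ∷ w) = cong (x ∷_) (applyUpTo-nth w)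

map-app-ι : ∀ {k} w → length w ≡ k → map (app w) (ι k) ≡ w
map-app-ι w refl = trans (map-applyUpTo (λ i → + suc i) (app w) (length w)) (applyUpTo-nth w)

app-neg : ∀ w a → app w (- a) ≡ - app w a
app-neg w (+ zero) = refl
app-neg w (+ suc i) = refl
app-neg w -[1+ i ] = sym (ℤₚ.neg-involutive (nth w i))

abs-ι : ∀ k → map ∣_∣ (ι k) ≡ applyUpTo suc k
abs-ι k = map-applyUpTo (λ i → + suc i) ∣_∣ k

length-ι : ∀ k → length (ι k) ≡ k
length-ι k = length-applyUpTo _ k

-- Every reflection is conjugate to gen k 0 or gen k 1: put the moved positions first.
flip₁-reflection : ∀ {k} P p Q → ι k ≡ P ++ p ∷ Q → IsReflection k (P ++ - p ∷ Q)
flip₁-reflection {k} P p Q eq = p ∷ P ++ Q , isB , 0 , 0<k , conj k len′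
  where
  t = P ++ - p ∷ Q
  len : length t ≡ k
  len = trans (trans (length-++ P) (sym (length-++ P {p ∷ Q}))) (trans (cong length (sym eq)) (length-ι k))
  len′ : suc (length (P ++ Q)) ≡ k
  len′ = trans (sym (length-insert P (- p) Q)) len
  0<k : 0 < k
  0<k = subst (0 <_) len′ (s≤s z≤n)
  isB : IsB k (p ∷ P ++ Q)
  isB = ↭⇒IsB (↭-trans (Permₚ.map⁺ ∣_∣ (↭-sym (Permₚ.shift p P Q)))
                (↭-reflexive (trans (cong (map ∣_∣) (sym eq)) (abs-ι k))))
  fixed : map (app t) P ≡ P × app t p ≡ - p × map (app t) Q ≡ Q
  fixed = ++-split _ P (length-map (app t) P)
    (trans (sym (map-++ (app t) P (p ∷ Q))) (trans (cong (map (app t)) (sym eq)) (map-app-ι t len)))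
  conj : ∀ k → suc (length (P ++ Q)) ≡ k → compose t (p ∷ P ++ Q) ≡ compose (p ∷ P ++ Q) (gen k 0)
  conj (suc k) e = cong₂ _∷_ (proj₁ (proj₂ fixed))
    (trans (trans (map-++ (app t) P Q) (cong₂ _++_ (proj₁ fixed) (proj₂ (proj₂ fixed))))
      (sym (trans (cong (map (app (p ∷ P ++ Q))) (map-applyUpTo suc _ k))
             (trans (map-applyUpTo _ (app (p ∷ P ++ Q)) k)
               (subst (λ j → applyUpTo (nth (P ++ Q)) j ≡ P ++ Q) (suc-injective e)
                 (applyUpTo-nth (P ++ Q)))))))

-- With `q′` instead of `q` in second place, `t` exchanges the first two entries of the conjugating
-- element without a sign, so both sign patterns reduce to `gen k 1`.
swap-reflection : ∀ {k} P p M q Q p′ q′ → ι k ≡ P ++ p ∷ M ++ q ∷ Q →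
  (p′ ≡ p × q′ ≡ q) ⊎ (p′ ≡ - p × q′ ≡ - q) → IsReflection k (P ++ q′ ∷ M ++ p′ ∷ Q)
swap-reflection {k} P p M q Q p′ q′ eq signs = p ∷ q′ ∷ R , isB , 1 , 1<k , conj k len′
  where
  R = (P ++ M) ++ Q
  t = P ++ q′ ∷ M ++ p′ ∷ Q
  len₂ : ∀ a b → length (P ++ a ∷ M ++ b ∷ Q) ≡ suc (suc (length R))
  len₂ a b = trans (length-insert P a (M ++ b ∷ Q))
    (cong suc (trans (cong length (sym (++-assoc P M (b ∷ Q)))) (length-insert (P ++ M) b Q)))
  len′ : suc (suc (length R)) ≡ k
  len′ = trans (sym (len₂ p q)) (trans (cong length (sym eq)) (length-ι k))
  len : length t ≡ k
  len = trans (len₂ q′ p′) len′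
  1<k : 1 < k
  1<k = subst (1 <_) len′ (s≤s (s≤s z≤n))
  ∣q′∣ : ∣ q′ ∣ ≡ ∣ q ∣
  ∣q′∣ = [ cong ∣_∣ ∘ proj₂ , (λ e → trans (cong ∣_∣ (proj₂ e)) (ℤₚ.∣-i∣≡∣i∣ q)) ]′ signs
  perm : P ++ p ∷ M ++ q ∷ Q ↭ p ∷ q ∷ R
  perm = ↭-trans (Permₚ.shift p P (M ++ q ∷ Q))
    (prep p (↭-trans (↭-reflexive (sym (++-assoc P M (q ∷ Q)))) (Permₚ.shift q (P ++ M) Q)))
  isB : IsB k (p ∷ q′ ∷ R)
  isB = ↭⇒IsB (↭-trans (↭-reflexive (cong (λ a → ∣ p ∣ ∷ a ∷ map ∣_∣ R) ∣q′∣))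
                (↭-trans (Permₚ.map⁺ ∣_∣ (↭-sym perm)) (↭-reflexive
                  (trans (cong (map ∣_∣) (sym eq)) (abs-ι k)))))
  values : map (app t) P ≡ P × app t p ≡ q′ × map (app t) (M ++ q ∷ Q) ≡ M ++ p′ ∷ Q
  values = ++-split _ P (length-map (app t) P)
    (trans (sym (map-++ (app t) P _)) (trans (cong (map (app t)) (sym eq)) (map-app-ι t len)))
  values₂ : map (app t) M ≡ M × app t q ≡ p′ × map (app t) Q ≡ Q
  values₂ = ++-split _ M (length-map (app t) M) (trans (sym (map-++ (app t) M _)) (proj₂ (proj₂ values)))
  back : app t q′ ≡ p
  back = [ (λ e → trans (cong (app t) (proj₂ e)) (trans tq (proj₁ e)))
         , (λ e → trans (cong (app t) (proj₂ e)) (trans (app-neg t q)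
             (trans (cong -_ (trans tq (proj₁ e))) (ℤₚ.neg-involutive p)))) ]′ signs
    where
    tq : app t q ≡ p′
    tq = proj₁ (proj₂ values₂)
  rest : map (app t) R ≡ R
  rest = trans (map-++ (app t) (P ++ M) Q)
    (cong₂ _++_ (trans (map-++ (app t) P M) (cong₂ _++_ (proj₁ values) (proj₁ values₂)))
      (proj₂ (proj₂ values₂)))
  conj : ∀ k → suc (suc (length R)) ≡ k → compose t (p ∷ q′ ∷ R) ≡ compose (p ∷ q′ ∷ R) (gen k 1)
  conj (suc (suc k)) e = cong₂ _∷_ (proj₁ (proj₂ values)) (cong₂ _∷_ back
    (trans rest (sym (trans (cong (map (app (p ∷ q′ ∷ R))) (map-applyUpTo (suc ∘ suc) _ k))
      (trans (map-applyUpTo _ (app (p ∷ q′ ∷ R)) k)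
        (subst (λ j → applyUpTo (nth R) j ≡ R) (suc-injective (suc-injective e)) (applyUpTo-nth R)))))))

raise⇒BruhatStep : ∀ {k u w} → IsB k u → Raise u w → BruhatStep k u w
raise⇒BruhatStep {k} {u} {w} bu r = bu , raise-IsB r bu , reflection r (map-app-ι u (proj₁ bu))
  where
  reflection : ∀ {u w} → Raise u w → map (app u) (ι k) ≡ u →
    ∃ λ t → IsReflection k t × w ≡ compose u t × ℓB u < ℓB w
  reflection {u} r@(flip₁ P {x} Q _) eq with map-++-inv (app u) (ι k) P eq
  ... | P̂ , p , Q̂ , eqι , eP , ep , eQ =
    _ , flip₁-reflection P̂ p Q̂ eqι ,
    sym (trans (map-++ (app u) P̂ (- p ∷ Q̂)) (cong₂ _++_ eP
      (cong₂ _∷_ (trans (app-neg u p) (cong -_ ep)) eQ))) ,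
    raise⇒ℓB r
  reflection {u} r@(swap P {z} M {x} Q _) eq with map-++-inv (app u) (ι k) P eq
  ... | P̂ , p , R̂ , eqι , eP , ep , eR with map-++-inv (app u) R̂ M eR
  ... | M̂ , q , Q̂ , refl , eM , eq′ , eQ =
    _ , swap-reflection P̂ p M̂ q Q̂ p q eqι (inj₁ (refl , refl)) ,
    sym (trans (map-++ (app u) P̂ _) (cong₂ _++_ eP (cong₂ _∷_ eq′
      (trans (map-++ (app u) M̂ _) (cong₂ _++_ eM (cong₂ _∷_ ep eQ)))))) ,
    raise⇒ℓB r
  reflection {u} r@(flip₂ P {z} M {x} Q _) eq with map-++-inv (app u) (ι k) P eq
  ... | P̂ , p , R̂ , eqι , eP , ep , eR with map-++-inv (app u) R̂ M eR
  ... | M̂ , q , Q̂ , refl , eM , eq′ , eQ =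
    _ , swap-reflection P̂ p M̂ q Q̂ (- p) (- q) eqι (inj₂ (refl , refl)) ,
    sym (trans (map-++ (app u) P̂ _) (cong₂ _++_ eP (cong₂ _∷_ (trans (app-neg u q) (cong -_ eq′))
      (trans (map-++ (app u) M̂ _) (cong₂ _++_ eM (cong₂ _∷_ (trans (app-neg u p) (cong -_ ep)) eQ)))))) ,
    raise⇒ℓB r

-- Raises below `v` continue until `v` is reached; each one increases ℓ_B, which is bounded on B_k,
-- so they stop.
Dom⇒Bruhat : ∀ {k u v} → IsB k u → IsB k v → Dom u v → Bruhat k u v
Dom⇒Bruhat {k} {u} {v} bu bv d = go bound bu d (m≤n+m bound (ℓB u))
  where
  bound = k * (k * 2) + k * 1
  go : ∀ fuel {u} → IsB k u → Dom u v → bound ≤ ℓB u + fuel → Bruhat k u v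
  go fuel {u} bu d h with ≡-dec ℤ._≟_ u v
  ... | yes refl = nil
  ... | no u≢v with Dom-raise bu bv d u≢v
  go zero {u} bu d h | no _ | w , r , d′ = contradiction (raise⇒ℓB r) (≤⇒≯ (begin
    ℓB w                                       ≤⟨ ℓB-bounded w ⟩
    length w * (length w * 2) + length w * 1   ≡⟨ cong (λ j → j * (j * 2) + j * 1) (proj₁ (raise-IsB r bu)) ⟩
    bound                                      ≤⟨ h ⟩
    ℓB u + 0                                   ≡⟨ +-identityʳ _ ⟩
    ℓB u                                       ∎))
    where open ≤-Reasoning
  go (suc fuel) {u} bu d h | no _ | w , r , d′ =
    raise⇒BruhatStep bu r ◅ go fuel (raise-IsB r bu) d′ (begin
      bound            ≤⟨ h ⟩
      ℓB u + suc fuel  ≡⟨ +-suc (ℓB u) fuel ⟩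
      suc (ℓB u) + fuel ≤⟨ +-monoˡ-≤ fuel (raise⇒ℓB r) ⟩
      ℓB w + fuel      ∎)
    where open ≤-Reasoning

-- Bruhat steps are raises

IsB-ι : ∀ k → IsB k (ι k)
IsB-ι k = ↭⇒IsB (↭-reflexive (abs-ι k))

∈-ι : ∀ {k} e → 1 ≤ ∣ e ∣ → ∣ e ∣ ≤ k → + ∣ e ∣ ∈ ι k
∈-ι {k} e 1≤e e≤k = go ∣ e ∣ 1≤e e≤k
  where
  go : ∀ j → 1 ≤ j → j ≤ k → + j ∈ ι k
  go (suc j) _ j<k = ∈-applyUpTo⁺ (λ i → + suc i) j<k

map-fixed : ∀ {A : Set} {f : A → A} xs → map f xs ≡ xs → All (λ x → f x ≡ x) xs
map-fixed [] _ = []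
map-fixed (x ∷ xs) e = proj₁ (∷-injective e) ∷ map-fixed xs (proj₂ (∷-injective e))

fixed-map : ∀ {A : Set} {f : A → A} {xs} → All (λ x → f x ≡ x) xs → map f xs ≡ xs
fixed-map [] = refl
fixed-map (e ∷ es) = cong₂ _∷_ e (fixed-map es)

-- Which alternative holds is decided only at the end, by the length condition of a Bruhat step.
Comparable : List ℤ → List ℤ → Set
Comparable u w = Raise u w ⊎ Raise w u ⊎ u ≡ w

comparable-swap : ∀ P z M x Q → Comparable (P ++ z ∷ M ++ x ∷ Q) (P ++ x ∷ M ++ z ∷ Q)
comparable-swap P z M x Q with ℤₚ.<-cmp z x
... | tri< z<x _ _ = inj₁ (swap P M Q z<x)
... | tri≈ _ refl _ = inj₂ (inj₂ refl)
... | tri> _ _ x<z = inj₂ (inj₁ (swap P M Q x<z))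

comparable-flip₂ : ∀ P z M x Q → Comparable (P ++ z ∷ M ++ x ∷ Q) (P ++ - x ∷ M ++ - z ∷ Q)
comparable-flip₂ P z M x Q with ℤₚ.<-cmp (- z) x
... | tri< -z<x _ _ = inj₁ (flip₂ P M Q -z<x)
... | tri≈ _ refl _ rewrite ℤₚ.neg-involutive z = inj₂ (inj₂ refl)
... | tri> _ _ x<-z = inj₂ (inj₁ (subst₂ (λ a b → Raise (P ++ - x ∷ M ++ - z ∷ Q) (P ++ a ∷ M ++ b ∷ Q))
  (ℤₚ.neg-involutive z) (ℤₚ.neg-involutive x)
  (flip₂ P M Q (subst (ℤ._< - z) (sym (ℤₚ.neg-involutive x)) x<-z))))

comparable-flip₁ : ∀ P x Q → Comparable (P ++ x ∷ Q) (P ++ - x ∷ Q)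
comparable-flip₁ P x Q with ℤₚ.<-cmp (- x) x
... | tri< -x<x _ _ = inj₁ (flip₁ P Q -x<x)
... | tri≈ _ e _ = inj₂ (inj₂ (cong (λ a → P ++ a ∷ Q) (sym e)))
... | tri> _ _ x<-x = inj₂ (inj₁ (subst (λ a → Raise (P ++ - x ∷ Q) (P ++ a ∷ Q)) (ℤₚ.neg-involutive x)
  (flip₁ P Q (subst (ℤ._< - x) (sym (ℤₚ.neg-involutive x)) x<-x))))

module _ {k : ℕ} {u t : List ℤ} (bu : IsB k u) (len : length t ≡ k) where

  private
    distinct : Distinct (ι k)
    distinct = proj₂ (proj₂ (IsB-ι k))

    u≡ : ∀ {L} → ι k ≡ L → map (app u) L ≡ u
    u≡ refl = map-app-ι u (proj₁ bu)

    t≡ : ∀ {L} → ι k ≡ L → map (app t) L ≡ t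
    t≡ refl = map-app-ι t len

  comparable-flip₁-at : ∀ P p Q → ι k ≡ P ++ p ∷ Q → app t p ≡ - p →
    (∀ {i} → i ∈ ι k → ∣ i ∣ ≢ ∣ p ∣ → app t i ≡ i) → Comparable u (compose u t)
  comparable-flip₁-at P p Q eq tp fix = subst₂ Comparable
    (trans (sym (map-++ (app u) P (p ∷ Q))) (u≡ eq))
    (trans (cong (λ a → map (app u) P ++ a ∷ map (app u) Q) (sym (app-neg u p)))
      (trans (sym (map-++ (app u) P (- p ∷ Q))) (cong (map (app u)) (sym t-form))))
    (comparable-flip₁ (map (app u) P) (app u p) (map (app u) Q))
    where
    dist : Distinct (P ++ p ∷ Q)
    dist = subst (AllPairs _) eq distinct
    fixed : ∀ {L} → All (λ i → ∣ i ∣ ≢ ∣ p ∣) L → (∀ {i} → i ∈ L → i ∈ P ++ p ∷ Q) → map (app t) L ≡ L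
    fixed ne sub = fixed-map (All.tabulate λ i∈ → fix (subst (_ ∈_) (sym eq) (sub i∈)) (All.lookup ne i∈))
    t-form : t ≡ P ++ - p ∷ Q
    t-form = trans (sym (t≡ eq)) (trans (map-++ (app t) P (p ∷ Q))
      (cong₂ _++_ (fixed (AllPairs-before P dist) ∈-++⁺ˡ)
        (cong₂ _∷_ tp (fixed (All.map (λ ne e → ne (sym e)) (AllPairs-after P dist))
          (λ i∈ → ∈-++⁺ʳ P (there i∈))))))

  comparable-swap-at : ∀ P a M b Q {a′ b′} → ι k ≡ P ++ a ∷ M ++ b ∷ Q →
    app t a ≡ b′ → app t b ≡ a′ → (a′ ≡ a × b′ ≡ b) ⊎ (a′ ≡ - a × b′ ≡ - b) →
    (∀ {i} → i ∈ ι k → ∣ i ∣ ≢ ∣ a ∣ → ∣ i ∣ ≢ ∣ b ∣ → app t i ≡ i) → Comparable u (compose u t)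
  comparable-swap-at P a M b Q {a′} {b′} eq ta tb signs fix = subst (λ v → Comparable v (compose u t)) (u-form)
    (subst (Comparable _) (cong (map (app u)) (sym t-form)) (subst (Comparable _) (sym expand) (result signs)))
    where
    dist : Distinct (P ++ a ∷ M ++ b ∷ Q)
    dist = subst (AllPairs _) eq distinct
    dist′ : Distinct ((P ++ a ∷ M) ++ b ∷ Q)
    dist′ = subst (AllPairs _) (sym (++-assoc P (a ∷ M) (b ∷ Q))) dist
    flipped : ∀ {c L} → All (λ i → ∣ c ∣ ≢ ∣ i ∣) L → All (λ i → ∣ i ∣ ≢ ∣ c ∣) L
    flipped = All.map (λ ne e → ne (sym e))
    fixed : ∀ {L} → All (λ i → ∣ i ∣ ≢ ∣ a ∣) L → All (λ i → ∣ i ∣ ≢ ∣ b ∣) L →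
      (∀ {i} → i ∈ L → i ∈ P ++ a ∷ M ++ b ∷ Q) → map (app t) L ≡ L
    fixed na nb sub = fixed-map (All.tabulate λ i∈ →
      fix (subst (_ ∈_) (sym eq) (sub i∈)) (All.lookup na i∈) (All.lookup nb i∈))
    afterA = flipped {a} (AllPairs-after P dist)
    beforeB = AllPairs-before (P ++ a ∷ M) dist′
    mapP : map (app t) P ≡ P
    mapP = fixed (AllPairs-before P dist) (Allₚ.++⁻ˡ P beforeB) ∈-++⁺ˡ
    mapM : map (app t) M ≡ M
    mapM = fixed (Allₚ.++⁻ˡ M afterA) (All.tail (Allₚ.++⁻ʳ P beforeB)) (λ i∈ → ∈-++⁺ʳ P (there (∈-++⁺ˡ i∈)))
    mapQ : map (app t) Q ≡ Q
    mapQ = fixed (All.tail (Allₚ.++⁻ʳ M afterA)) (flipped {b} (AllPairs-after (P ++ a ∷ M) dist′))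
      (λ i∈ → ∈-++⁺ʳ P (there (∈-++⁺ʳ M (there i∈))))
    map₂ : ∀ f c d → map f (P ++ c ∷ M ++ d ∷ Q) ≡ map f P ++ f c ∷ map f M ++ f d ∷ map f Q
    map₂ f c d = trans (map-++ f P _) (cong (λ l → map f P ++ f c ∷ l) (map-++ f M _))
    t-form : t ≡ P ++ b′ ∷ M ++ a′ ∷ Q
    t-form = trans (sym (t≡ eq)) (trans (map₂ (app t) a b)
      (cong₂ _++_ mapP (cong₂ _∷_ ta (cong₂ _++_ mapM (cong₂ _∷_ tb mapQ)))))
    u-form : map (app u) P ++ app u a ∷ map (app u) M ++ app u b ∷ map (app u) Q ≡ u
    u-form = trans (sym (map₂ (app u) a b)) (u≡ eq)
    expand = map₂ (app u) b′ a′
    result : (a′ ≡ a × b′ ≡ b) ⊎ (a′ ≡ - a × b′ ≡ - b) →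
      Comparable (map (app u) P ++ app u a ∷ map (app u) M ++ app u b ∷ map (app u) Q)
                 (map (app u) P ++ app u b′ ∷ map (app u) M ++ app u a′ ∷ map (app u) Q)
    result (inj₁ (ea , eb)) = subst₂ (λ c d → Comparable _
        (map (app u) P ++ c ∷ map (app u) M ++ d ∷ map (app u) Q))
      (cong (app u) (sym eb)) (cong (app u) (sym ea)) (comparable-swap _ (app u a) _ (app u b) _)
    result (inj₂ (ea , eb)) = subst₂ (λ c d → Comparable _
        (map (app u) P ++ c ∷ map (app u) M ++ d ∷ map (app u) Q))
      (sym (trans (cong (app u) eb) (app-neg u b))) (sym (trans (cong (app u) ea) (app-neg u a)))
      (comparable-flip₂ _ (app u a) _ (app u b) _)

  module _ {r : List ℤ} (br : IsB k r) where

    private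
      bound : ∀ {e} → e ∈ r → 1 ≤ ∣ e ∣ × ∣ e ∣ ≤ k
      bound = All.lookup (proj₁ (proj₂ br))

      transport : ∀ {i e} → ∣ i ∣ ≡ ∣ e ∣ → app t e ≡ e → app t i ≡ i
      transport {i} {e} h te with ∣x∣≡∣y∣ i e h
      ... | inj₁ refl = te
      ... | inj₂ refl = trans (app-neg t e) (cong -_ te)

      preimage : ∀ {i} → i ∈ ι k → ∃ λ e → e ∈ r × ∣ i ∣ ≡ ∣ e ∣
      preimage {i} i∈ = IsB-∋ br {i} (proj₁ b) (proj₂ b)
        where b = All.lookup (proj₁ (proj₂ (IsB-ι k))) i∈

    -- `t` negates the first entry of `r` and fixes the others. Every position is up to sign an
    -- entry of `r`, so `t` is the sign change at position `∣ e ∣`.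
    comparable-gen-0 : ∀ {e R} → r ≡ e ∷ R → map (app t) (e ∷ R) ≡ - e ∷ R → Comparable u (compose u t)
    comparable-gen-0 {e} {R} refl eq with ∈-∃++ (∈-ι e (proj₁ (bound (here refl))) (proj₂ (bound (here refl))))
    ... | P , Q , eqι = comparable-flip₁-at P (+ ∣ e ∣) Q eqι tp fix
      where
      te : app t e ≡ - e
      te = proj₁ (∷-injective eq)
      tp : app t (+ ∣ e ∣) ≡ - + ∣ e ∣
      tp with ∣x∣≡∣y∣ (+ ∣ e ∣) e refl
      ... | inj₁ p = subst (λ a → app t a ≡ - a) (sym p) te
      ... | inj₂ p = subst (λ a → app t a ≡ - a) (sym p) (trans (app-neg t e) (cong -_ te))
      fix : ∀ {i} → i ∈ ι k → ∣ i ∣ ≢ ∣ e ∣ → app t i ≡ i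
      fix i∈ ne with preimage i∈
      ... | _ , here refl , h = contradiction h ne
      ... | _ , there a∈ , h = transport h (All.lookup (map-fixed R (proj₂ (∷-injective eq))) a∈)

    -- `t` exchanges `e` and `f`. On the positive positions `∣ e ∣` and `∣ f ∣` this is a plain
    -- exchange when `e` and `f` have equal signs, and an exchange with both signs changed
    -- otherwise: a `swap` or a `flip₂`.
    comparable-gen-suc : ∀ {A e f B} → r ≡ A ++ e ∷ f ∷ B → map (app t) r ≡ A ++ f ∷ e ∷ B → Comparable u
        (compose u t)
    comparable-gen-suc {A} {e} {f} {B} refl eq = locate (∈-∃++ (∈-ι e (proj₁ (bound e∈)) (proj₂ (bound e∈))))
      where
      e∈ = ∈-++⁺ʳ A (here refl)
      f∈ = ∈-++⁺ʳ A (there (here refl))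
      a = + ∣ e ∣
      b = + ∣ f ∣
      split : map (app t) A ≡ A × app t e ≡ f × map (app t) (f ∷ B) ≡ e ∷ B
      split = ++-split _ A (length-map (app t) A) (trans (sym (map-++ (app t) A _)) eq)
      te : app t e ≡ f
      te = proj₁ (proj₂ split)
      tf : app t f ≡ e
      tf = proj₁ (∷-injective (proj₂ (proj₂ split)))
      fix : ∀ {i} → i ∈ ι k → ∣ i ∣ ≢ ∣ e ∣ → ∣ i ∣ ≢ ∣ f ∣ → app t i ≡ i
      fix i∈ ne nf with preimage i∈
      ... | c , c∈ , h with ∈-++⁻ A c∈
      ... | inj₁ c∈A = transport h (All.lookup (map-fixed A (proj₁ split)) c∈A)
      ... | inj₂ (here refl) = contradiction h ne
      ... | inj₂ (there (here refl)) = contradiction h nf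
      ... | inj₂ (there (there c∈B)) =
        transport h (All.lookup (map-fixed B (proj₂ (∷-injective (proj₂ (proj₂ split))))) c∈B)
      images : ∃ λ a′ → ∃ λ b′ → app t a ≡ b′ × app t b ≡ a′ × ((a′ ≡ a × b′ ≡ b) ⊎ (a′ ≡ - a × b′ ≡ - b))
      images with ∣x∣≡∣y∣ a e refl | ∣x∣≡∣y∣ b f refl
      ... | inj₁ p | inj₁ q =
        a , b , trans (cong (app t) p) (trans te (sym q)) , trans (cong (app t) q) (trans tf (sym p)) , inj₁
          (refl , refl)
      ... | inj₁ p | inj₂ q =
        - a , - b , trans (cong (app t) p) (trans te (trans (sym (ℤₚ.neg-involutive f)) (cong -_ (sym q)))) ,
        trans (cong (app t) q) (trans (app-neg t f) (cong -_ (trans tf (sym p)))) , inj₂ (refl , refl)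
      ... | inj₂ p | inj₁ q =
        - a , - b , trans (cong (app t) p) (trans (app-neg t e) (cong -_ (trans te (sym q)))) ,
        trans (cong (app t) q) (trans tf (trans (sym (ℤₚ.neg-involutive e)) (cong -_ (sym p)))) , inj₂
          (refl , refl)
      ... | inj₂ p | inj₂ q =
        a , b , trans (cong (app t) p) (trans (app-neg t e) (trans (cong -_ te) (sym q))) ,
        trans (cong (app t) q) (trans (app-neg t f) (trans (cong -_ tf) (sym p))) , inj₁ (refl , refl)
      a≢b : ∣ e ∣ ≢ ∣ f ∣
      a≢b = All.head (AllPairs-after A (proj₂ (proj₂ br)))
      locate : (∃ λ X → ∃ λ Y → ι k ≡ X ++ a ∷ Y) → Comparable u (compose u t)
      locate (X , Y , eqι) with ∈-++⁻ X (subst (b ∈_) eqι (∈-ι f (proj₁ (bound f∈)) (proj₂ (bound f∈)))) |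
        images
      ... | inj₂ (here b≡a) | _ = contradiction (sym (ℤₚ.+-injective b≡a)) a≢b
      ... | inj₁ b∈X | a′ , b′ , ta , tb , signs with ∈-∃++ b∈X
      ... | X₁ , X₂ , refl =
        comparable-swap-at X₁ b X₂ a Y (trans eqι (++-assoc X₁ (b ∷ X₂) (a ∷ Y))) tb ta
          ([ (λ s → inj₁ (proj₂ s , proj₁ s)) , (λ s → inj₂ (proj₂ s , proj₁ s)) ]′ signs)
            (λ i∈ nb na → fix i∈ na nb)
      locate (X , Y , eqι) | inj₂ (there b∈Y) | a′ , b′ , ta , tb , signs with ∈-∃++ b∈Y
      ... | Y₁ , Y₂ , refl = comparable-swap-at X a Y₁ b Y₂ eqι ta tb signs fix

swapAt : ℕ → List ℤ → ℕ → ℤ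
swapAt a w j = if j ≡ᵇ a then nth w (suc a) else if j ≡ᵇ suc a then nth w a else nth w j

applyUpTo-swapAt : ∀ a w → suc a < length w →
  ∃ λ A → ∃ λ e → ∃ λ f → ∃ λ B → w ≡ A ++ e ∷ f ∷ B × applyUpTo (swapAt a w) (length w) ≡ A ++ f ∷ e ∷ B
applyUpTo-swapAt zero (e ∷ f ∷ B) _ = [] , e , f , B , refl , cong (λ l → f ∷ e ∷ l) (applyUpTo-nth B)
applyUpTo-swapAt zero (e ∷ []) (s≤s ())
applyUpTo-swapAt (suc a) (x ∷ w) (s≤s h) with applyUpTo-swapAt a w h
... | A , e , f , B , refl , eq = x ∷ A , e , f , B , refl , cong (x ∷_) eq

applyUpTo-cong : ∀ {A : Set} {f g : ℕ → A} → (∀ j → f j ≡ g j) → ∀ k → applyUpTo f k ≡ applyUpTo g k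
applyUpTo-cong h zero = refl
applyUpTo-cong h (suc k) = cong₂ _∷_ (h 0) (applyUpTo-cong (h ∘ suc) k)

BruhatStep⇒Raise : ∀ {k u w} → BruhatStep k u w → Raise u w
BruhatStep⇒Raise {k} {u} (bu , bw , t , (r , br , a , a<k , eq) , refl , ℓ<) with compared a a<k eq
  where
  len : length t ≡ k
  len = trans (sym (length-map (app u) t)) (proj₁ bw)
  compared : ∀ a → a < k → compose t r ≡ compose r (gen k a) → Comparable u (compose u t)
  compared zero a<k eq = go r k (proj₁ br) a<k refl refl eq
    where
    go : ∀ s j → length s ≡ j → 0 < j → s ≡ r → j ≡ k → compose t s ≡ compose s (gen j 0) → Comparable u
        (compose u t)
    go (e ∷ R) (suc j) h _ refl refl eq = comparable-gen-0 bu len br refl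
      (trans eq (cong (- e ∷_) (trans (cong (map (app (e ∷ R))) (map-applyUpTo suc _ j))
        (trans (map-applyUpTo _ (app (e ∷ R)) j)
          (subst (λ i → applyUpTo (nth R) i ≡ R) (suc-injective h) (applyUpTo-nth R))))))
  compared (suc a) a<k eq with applyUpTo-swapAt a r (subst (suc a <_) (sym (proj₁ br)) a<k)
  ... | A , e , f , B , er , eq′ = comparable-gen-suc bu len br er (trans eq
    (trans (trans (cong (map (app r)) (map-applyUpTo id _ k)) (map-applyUpTo _ (app r) k))
      (trans (applyUpTo-cong pointwise k) (trans (cong (applyUpTo (swapAt a r)) (sym (proj₁ br))) eq′))))
    where
    pointwise : ∀ j → app r (if j ≡ᵇ a then + (suc (suc a)) else if j ≡ᵇ suc a then + suc a else + suc j) ≡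
        swapAt a r j
    pointwise j = trans (if-float (app r) (j ≡ᵇ a))
        (cong (if_then_else_ (j ≡ᵇ a) _) (if-float (app r) (j ≡ᵇ suc a)))
... | inj₁ raise = raise
... | inj₂ (inj₁ lower) = contradiction ℓ< (<-asym (raise⇒ℓB lower))
... | inj₂ (inj₂ same) = contradiction (cong ℓB same) (<⇒≢ ℓ<)

Bruhat⇒Dom : ∀ {k u v} → Bruhat k u v → Dom u v
Bruhat⇒Dom nil = Dom-refl
Bruhat⇒Dom (s ◅ ss) = Dom-trans (raise⇒Dom (BruhatStep⇒Raise s)) (Bruhat⇒Dom ss)

-- Codes of signed Wachs permutations

-- The smaller and the larger entry of a block, `2s - 1` and `2s` for positive `s`, `2s` and
-- `2s + 1` for negative `s`. The value 0 at 0 makes every integer, taken as a threshold, a `lo` or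
-- a `hi`.
lo hi : ℤ → ℤ
lo (+ zero) = 0ℤ
lo (+ suc k) = + suc (k + k)
lo -[1+ k ] = -[1+ suc (k + k) ]
hi (+ zero) = 0ℤ
hi (+ suc k) = + suc (suc (k + k))
hi -[1+ k ] = -[1+ k + k ]

double-mono-< : ∀ {m n} → m < n → suc (m + m) < n + n
double-mono-< {m} {n} m<n = ≤-trans (s≤s (≡⇒≥ (+-suc m m))) (m<n ⊕ m<n)

hi<lo : ∀ {s t} → s ℤ.< t → hi s ℤ.< lo t
hi<lo {+ zero} {+ zero} (ℤ.+<+ ())
hi<lo {+ zero} {+ suc n} _ = ℤ.+<+ (s≤s z≤n)
hi<lo {+ suc m} {+ suc n} (ℤ.+<+ (s≤s m<n)) = ℤ.+<+ (s≤s (double-mono-< m<n))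
hi<lo { -[1+ m ]} {+ zero} _ = ℤ.-<+
hi<lo { -[1+ m ]} {+ suc n} _ = ℤ.-<+
hi<lo { -[1+ m ]} { -[1+ n ]} (ℤ.-<- n<m) = ℤ.-<- (double-mono-< n<m)

lo<hi : ∀ {s} → s ≢ 0ℤ → lo s ℤ.< hi s
lo<hi {+ zero} ne = contradiction refl ne
lo<hi {+ suc k} _ = ℤ.+<+ (n<1+n _)
lo<hi { -[1+ k ]} _ = ℤ.-<- (n<1+n _)

lo≤hi : ∀ s → lo s ℤ.≤ hi s
lo≤hi (+ zero) = ℤₚ.≤-refl
lo≤hi s@(+ suc _) = ℤₚ.<⇒≤ (lo<hi {s} (λ ()))
lo≤hi s@(-[1+ _ ]) = ℤₚ.<⇒≤ (lo<hi {s} (λ ()))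

lo-mono : ∀ {s t} → s ℤ.≤ t → lo s ℤ.≤ lo t
lo-mono {s} {t} s≤t with s ℤ.≟ t
... | yes refl = ℤₚ.≤-refl
... | no s≢t = ℤₚ.≤-trans (lo≤hi s) (ℤₚ.<⇒≤ (hi<lo (ℤₚ.≤∧≢⇒< s≤t s≢t)))

hi-mono : ∀ {s t} → s ℤ.≤ t → hi s ℤ.≤ hi t
hi-mono {s} {t} s≤t with s ℤ.≟ t
... | yes refl = ℤₚ.≤-refl
... | no s≢t = ℤₚ.≤-trans (ℤₚ.<⇒≤ (hi<lo (ℤₚ.≤∧≢⇒< s≤t s≢t))) (lo≤hi t)

lo≤hi⇒≤ : ∀ {s t} → lo s ℤ.≤ hi t → s ℤ.≤ t
lo≤hi⇒≤ h = ℤₚ.≮⇒≥ (λ t<s → ℤₚ.<⇒≱ (hi<lo t<s) h)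

neg-lo : ∀ s → - lo s ≡ hi (- s)
neg-lo (+ zero) = refl
neg-lo (+ suc _) = refl
neg-lo -[1+ _ ] = refl

neg-hi : ∀ s → - hi s ≡ lo (- s)
neg-hi (+ zero) = refl
neg-hi (+ suc _) = refl
neg-hi -[1+ _ ] = refl

half : ∀ n → ∃ λ k → n ≡ k + k ⊎ n ≡ suc (k + k)
half zero = 0 , inj₁ refl
half (suc n) with half n
... | k , inj₁ refl = k , inj₂ refl
... | k , inj₂ refl = suc k , inj₁ (cong suc (sym (+-suc k k)))

lo-or-hi : ∀ l → (∃ λ j → l ≡ lo j) ⊎ (∃ λ j → j ≢ 0ℤ × l ≡ hi j)
lo-or-hi (+ zero) = inj₁ (0ℤ , refl)
lo-or-hi (+ suc n) with half n
... | k , inj₁ refl = inj₁ (+ suc k , refl)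
... | k , inj₂ refl = inj₂ (+ suc k , (λ ()) , refl)
lo-or-hi -[1+ n ] with half n
... | k , inj₁ refl = inj₂ (-[1+ k ] , (λ ()) , refl)
... | k , inj₂ refl = inj₁ (-[1+ k ] , refl)

le-lo-lo : ∀ j s → le (lo j) (lo s) ≡ le j s
le-lo-lo j s = le-cong (λ h → lo≤hi⇒≤ (ℤₚ.≤-trans h (lo≤hi s))) lo-mono

le-lo-hi : ∀ j s → le (lo j) (hi s) ≡ le j s
le-lo-hi j s = le-cong lo≤hi⇒≤ (λ h → ℤₚ.≤-trans (lo-mono h) (lo≤hi s))

le-hi-hi : ∀ j s → le (hi j) (hi s) ≡ le j s
le-hi-hi j s = le-cong (λ h → lo≤hi⇒≤ (ℤₚ.≤-trans (lo≤hi j) h)) hi-mono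

le-hi-lo : ∀ {j} s → j ≢ 0ℤ → le (hi j) (lo s) ≡ le (ℤ.suc j) s
le-hi-lo {j} s j≢0 = le-cong
  (λ h → ℤₚ.i<j⇒suc[i]≤j (ℤₚ.≰⇒> (λ s≤j → ℤₚ.<⇒≱ (ℤₚ.≤-<-trans (lo-mono s≤j) (lo<hi j≢0)) h)))
  (λ h → ℤₚ.<⇒≤ (hi<lo (ℤₚ.suc[i]≤j⇒i<j h)))

-- A signed Wachs permutation (σ , T) is coded by the list of pairs (σ(i) , i ∈ T).
Code : Set
Code = ℤ × Bool

e₁ e₂ : Code → ℤ
e₁ (s , false) = lo s
e₁ (s , true) = hi s
e₂ (s , false) = hi s
e₂ (s , true) = lo s

enc : List Code → List ℤ
enc [] = []
enc (a ∷ A) = e₁ a ∷ e₂ a ∷ enc A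

σ : List Code → List ℤ
σ = map proj₁

enc-++ : ∀ A B → enc (A ++ B) ≡ enc A ++ enc B
enc-++ [] B = refl
enc-++ (a ∷ A) B = cong (λ l → e₁ a ∷ e₂ a ∷ l) (enc-++ A B)

length-enc : ∀ A → length (enc A) ≡ length A + length A
length-enc [] = refl
length-enc (a ∷ A) = cong suc (trans (cong suc (length-enc A)) (sym (+-suc (length A) (length A))))

length-enc-≡ : ∀ {A B} → length A ≡ length B → length (enc A) ≡ length (enc B)
length-enc-≡ {A} {B} e = trans (length-enc A) (trans (cong (λ k → k + k) e) (sym (length-enc B)))

Nonzero : List Code → Set
Nonzero = All (λ a → proj₁ a ≢ 0ℤ)

cnt-lo : ∀ j A → cnt (lo j) (enc A) ≡ cnt j (σ A) + cnt j (σ A)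
cnt-lo j [] = refl
cnt-lo j ((s , b) ∷ A) = trans (cong₂ (λ p q → p + (q + cnt (lo j) (enc A))) (first b) (second b))
  (trans (cong (λ t → le j s + (le j s + t)) (cnt-lo j A)) (arith (le j s) (cnt j (σ A))))
  where
  first : ∀ b → le (lo j) (e₁ (s , b)) ≡ le j s
  first false = le-lo-lo j s
  first true = le-lo-hi j s
  second : ∀ b → le (lo j) (e₂ (s , b)) ≡ le j s
  second false = le-lo-hi j s
  second true = le-lo-lo j s
  arith : ∀ a c → a + (a + (c + c)) ≡ a + c + (a + c)
  arith = solve-∀

-- A block of value `j` counts once and one of larger value twice, whatever the bits. So the counts
-- of suffixes that begin at block boundaries depend on `σ` alone.
cnt-hi : ∀ {j} A → j ≢ 0ℤ → cnt (hi j) (enc A) ≡ cnt j (σ A) + cnt (ℤ.suc j) (σ A)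
cnt-hi [] _ = refl
cnt-hi {j} ((s , b) ∷ A) j≢0 = trans (sym (+-assoc (le (hi j) (e₁ (s , b))) _ _))
    (trans (cong₂ _+_ (block b) (cnt-hi A j≢0))
  (arith (le j s) (le (ℤ.suc j) s) (cnt j (σ A)) (cnt (ℤ.suc j) (σ A))))
  where
  block : ∀ b → le (hi j) (e₁ (s , b)) + le (hi j) (e₂ (s , b)) ≡ le j s + le (ℤ.suc j) s
  block false = trans (+-comm (le (hi j) (lo s)) _) (cong₂ _+_ (le-hi-hi j s) (le-hi-lo s j≢0))
  block true = cong₂ _+_ (le-hi-hi j s) (le-hi-lo s j≢0)
  arith : ∀ a b c d → a + b + (c + d) ≡ a + c + (b + d)
  arith = solve-∀

Cn-enc : ∀ {A B} → Cn (σ A) (σ B) → Cn (enc A) (enc B)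
Cn-enc {A} {B} c = cn go
  where
  go : ∀ l → cnt l (enc B) ≤ cnt l (enc A)
  go l with lo-or-hi l
  ... | inj₁ (j , refl) = subst₂ _≤_ (sym (cnt-lo j B)) (sym (cnt-lo j A)) (at c j ⊕ at c j)
  ... | inj₂ (j , j≢0 , refl) = subst₂ _≤_ (sym (cnt-hi B j≢0)) (sym (cnt-hi A j≢0)) (at c j ⊕ at c (ℤ.suc j))

half-mono : ∀ {a b} → b + b ≤ 1 + (a + a) → b ≤ a
half-mono {a} {b} h with b ℕ.≤? a
... | yes b≤a = b≤a
... | no b≰a = contradiction h (<⇒≱ (double-mono-< (≰⇒> b≰a)))

-- The slack of 1 is harmless since at block thresholds both counts are even.
Cn-dec : ∀ {A B} → (∀ l → cnt l (enc B) ≤ 1 + cnt l (enc A)) → Cn (σ A) (σ B)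
Cn-dec {A} {B} h = cn λ j → half-mono (subst₂ (λ p q → p ≤ 1 + q) (cnt-lo j B) (cnt-lo j A) (h (lo j)))

Dom-σ : ∀ {A B} → Dom (enc A) (enc B) → Dom (σ A) (σ B)
Dom-σ {[]} {[]} [] = []
Dom-σ {a ∷ A} {b ∷ B} (c ∷ (_ ∷ d)) = Cn-dec {a ∷ A} {b ∷ B} (λ l → m≤n⇒m≤1+n (at c l)) ∷ Dom-σ d

-- In the middle of a block with value s only the threshold hi s matters, and only if its bit is set.
Cn-mid : ∀ {s b t c A B} → Cn (σ ((s , b) ∷ A)) (σ ((t , c) ∷ B)) → Cn (σ A) (σ B) →
  (b ≡ true → cnt (hi s) (e₂ (t , c) ∷ enc B) ≤ cnt (hi s) (enc A)) →
  Cn (e₂ (s , b) ∷ enc A) (e₂ (t , c) ∷ enc B)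
Cn-mid {s} {b} {t} {c} {A} {B} c₁ c₂ h = cn go
  where
  second-lo : ∀ j s b → le (lo j) (e₂ (s , b)) ≡ le j s
  second-lo j s false = le-lo-hi j s
  second-lo j s true = le-lo-lo j s
  e₂≤hi : ∀ c → e₂ (t , c) ℤ.≤ hi t
  e₂≤hi false = ℤₚ.≤-refl
  e₂≤hi true = lo≤hi t
  upper : ∀ j → le (hi j) (e₂ (t , c)) ≤ le j t
  upper j = le-mono {hi j} {e₂ (t , c)} {j} {t}
    (λ p → lo≤hi⇒≤ (ℤₚ.≤-trans (lo≤hi j) (ℤₚ.≤-trans p (e₂≤hi c))))
  middle : ∀ {j} → j ≢ 0ℤ → le j s ≤ le (hi j) (e₂ (s , b)) →
    le (hi j) (e₂ (t , c)) + cnt (hi j) (enc B) ≤ le (hi j) (e₂ (s , b)) + cnt (hi j) (enc A)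
  middle {j} j≢0 lower rewrite cnt-hi A j≢0 | cnt-hi B j≢0 =
    ≤-balance (upper j ⊕ lower ⊕ at c₁ j ⊕ at c₂ (ℤ.suc j))
      (arith (le (hi j) (e₂ (t , c))) (le (hi j) (e₂ (s , b))) (le j t) (le j s) (cnt j (σ A)) (cnt j (σ B))
        (cnt (ℤ.suc j) (σ A)) (cnt (ℤ.suc j) (σ B)))
    where
    arith : ∀ x y p q a b a′ b′ → x + (b + b′) + (p + (y + (q + a + a′))) ≡ y + (a + a′) +
        (x + (q + (p + b + b′)))
    arith = solve-∀
  lower : ∀ b {j} → j ≢ 0ℤ → (b ≡ true → j ≢ s) → le j s ≤ le (hi j) (e₂ (s , b))
  lower false {j} _ _ = ≡⇒≥ (le-hi-hi j s)
  lower true {j} j≢0 ne = subst (le j s ≤_) (sym (le-hi-lo s j≢0))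
    (le-mono {j} {s} {ℤ.suc j} {s} (λ j≤s → ℤₚ.i<j⇒suc[i]≤j (ℤₚ.≤∧≢⇒< j≤s (ne refl))))
  at-hi : ∀ {j} → j ≢ 0ℤ → Dec (j ≡ s) →
    le (hi j) (e₂ (t , c)) + cnt (hi j) (enc B) ≤ le (hi j) (e₂ (s , b)) + cnt (hi j) (enc A)
  at-hi j≢0 (no j≢s) = middle j≢0 (lower b j≢0 (λ _ → j≢s))
  at-hi {j} j≢0 (yes j≡s) = bit b refl
    where
    bit : ∀ b′ → b ≡ b′ →
      le (hi j) (e₂ (t , c)) + cnt (hi j) (enc B) ≤ le (hi j) (e₂ (s , b)) + cnt (hi j) (enc A)
    bit true eq = ≤-trans
      (subst (λ i → cnt (hi i) (e₂ (t , c) ∷ enc B) ≤ cnt (hi i) (enc A)) (sym j≡s) (h eq))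
      (m≤n+m _ (le (hi j) (e₂ (s , b))))
    bit false eq = middle j≢0 (lower b j≢0 (λ b≡true → contradiction (trans (sym b≡true) eq) (λ ())))
  go : ∀ l → le l (e₂ (t , c)) + cnt l (enc B) ≤ le l (e₂ (s , b)) + cnt l (enc A)
  go l with lo-or-hi l
  ... | inj₁ (j , refl) rewrite second-lo j s b | second-lo j t c | cnt-lo j A | cnt-lo j B =
    ≤-balance (at c₁ j ⊕ at c₂ j) (arith (le j s) (le j t) (cnt j (σ A)) (cnt j (σ B)))
    where
    arith : ∀ s t a b → t + (b + b) + (s + a + a) ≡ s + (a + a) + (t + b + b)
    arith = solve-∀
  ... | inj₂ (j , j≢0 , refl) = at-hi j≢0 (j ℤ.≟ s)

-- Suffixes that begin in the prefix see `u` only through its counts.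
Dom-prefix-cong : ∀ P P′ {u u′ v} → length P ≡ length P′ → (∀ l → cnt l u ≡ cnt l u′) →
  Dom u′ v → Dom (P ++ u) (P′ ++ v) → Dom (P ++ u′) (P′ ++ v)
Dom-prefix-cong [] [] _ _ d _ = d
Dom-prefix-cong (p ∷ P) (p′ ∷ P′) {u} {u′} e h d (c ∷ d′) =
  Cn-trans (Cn-++ (p ∷ P) (cn λ l → ≡⇒≤ (h l))) c ∷ Dom-prefix-cong P P′ (suc-injective e) h d d′

Dom-enc-suffix : ∀ A₁ B₁ {A B} → length A₁ ≡ length B₁ → Dom (enc (A₁ ++ A)) (enc (B₁ ++ B)) → Dom (enc A)
    (enc B)
Dom-enc-suffix A₁ B₁ {A} {B} e d =
  Dom-suffix (enc A₁) (enc B₁) (length-enc-≡ {A₁} {B₁} e) (subst₂ Dom (enc-++ A₁ A) (enc-++ B₁ B) d)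

Dom-σ-suffix : ∀ A₁ B₁ {A B} → length A₁ ≡ length B₁ → Dom (σ (A₁ ++ A)) (σ (B₁ ++ B)) → Dom (σ A) (σ B)
Dom-σ-suffix [] [] _ d = d
Dom-σ-suffix (_ ∷ A₁) (_ ∷ B₁) e (_ ∷ d) = Dom-σ-suffix A₁ B₁ (suc-injective e) d

-- The rank of a code, and setting a bit

bits : List Code → ℕ
bits = sumOf (b2n ∘ proj₂)

-- ℓ_W of the permutation coded by A.
rk : List Code → ℕ
rk A = 3 * invPairs (σ A) + (2 * negs (σ A) + bits A)

-- Exchanging the two entries of a block changes the counts of one suffix only, the one that begins
-- between them; `mid` is the condition there.
setBit-Dom : ∀ A₁ B₁ {s A₂ β B₂} → length A₁ ≡ length B₁ → Cn (lo s ∷ enc A₂) (e₂ β ∷ enc B₂) →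
  Dom (enc (A₁ ++ (s , false) ∷ A₂)) (enc (B₁ ++ β ∷ B₂)) → Dom (enc (A₁ ++ (s , true) ∷ A₂))
    (enc (B₁ ++ β ∷ B₂))
setBit-Dom A₁ B₁ {s} {A₂} {β} {B₂} e mid d
  with Dom-enc-suffix A₁ B₁ e d | subst₂ Dom (enc-++ A₁ _) (enc-++ B₁ _) d
... | c ∷ (_ ∷ d₂) | d′ = subst₂ Dom (sym (enc-++ A₁ _)) (sym (enc-++ B₁ _))
  (Dom-prefix-cong (enc A₁) (enc B₁) (length-enc-≡ {A₁} {B₁} e) block
    (Cn-trans (cn λ l → ≡⇒≥ (sym (block l))) c ∷ (mid ∷ d₂)) d′)
  where
  block : ∀ l → cnt l (lo s ∷ hi s ∷ enc A₂) ≡ cnt l (hi s ∷ lo s ∷ enc A₂)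
  block l = cnt-swap l [] (hi s) [] (lo s) (enc A₂)

setBit-raise : ∀ A₁ {s} A₂ → s ≢ 0ℤ → Dom (enc (A₁ ++ (s , false) ∷ A₂)) (enc (A₁ ++ (s , true) ∷ A₂))
setBit-raise A₁ {s} A₂ s≢0 = subst₂ Dom (sym (enc-++ A₁ _)) (sym (enc-++ A₁ _))
  (raise⇒Dom (swap (enc A₁) [] (enc A₂) (lo<hi s≢0)))

σ-setBit : ∀ A₁ s A₂ b b′ → σ (A₁ ++ (s , b) ∷ A₂) ≡ σ (A₁ ++ (s , b′) ∷ A₂)
σ-setBit A₁ s A₂ b b′ = trans (map-++ proj₁ A₁ _) (sym (map-++ proj₁ A₁ _))

rk-setBit : ∀ A₁ s A₂ → rk (A₁ ++ (s , true) ∷ A₂) ≡ 1 + rk (A₁ ++ (s , false) ∷ A₂)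
rk-setBit A₁ s A₂ rewrite σ-setBit A₁ s A₂ true false =
  ≡-balance (sumOf-replace₁ (b2n ∘ proj₂) A₁ (s , true) (s , false) A₂)
    (arith (invPairs w) (negs w) (bits (A₁ ++ (s , true) ∷ A₂)) (bits (A₁ ++ (s , false) ∷ A₂)))
  where
  w = σ (A₁ ++ (s , false) ∷ A₂)
  arith : ∀ p n b b′ → 3 * p + (2 * n + b) + (b′ + 1) ≡ 1 + (3 * p + (2 * n + b′)) + (b + 0)
  arith = solve-∀

-- The counts at `s` and `suc s` are the two summands of the count at `hi s`.
Blocked : ℤ → List Code → ℤ → List Code → Set
Blocked s A t B = t ≡ s × cnt s (σ A) ≡ cnt s (σ B) × cnt (ℤ.suc s) (σ A) ≡ cnt (ℤ.suc s) (σ B)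

-- If the middle condition fails at `hi s`, then `1 + (a + a′) ≤ i + (b + b′)` while `b ≤ a`,
-- `b′ ≤ a′` and `i ≤ 1`, so all three are equalities. Now `i = 1` gives `s ≤ t`, and `s < t` would
-- break domination at `suc s` for the suffix that includes this block.
settable : ∀ {s A t c B} → s ≢ 0ℤ → Cn (s ∷ σ A) (t ∷ σ B) → Cn (σ A) (σ B) →
  Cn (lo s ∷ enc A) (e₂ (t , c) ∷ enc B) ⊎ Blocked s A t B
settable {s} {A} {t} {c} {B} s≢0 c₁ c₂ with cnt (hi s) (e₂ (t , c) ∷ enc B) ℕ.≤? cnt (hi s) (enc A)
... | yes h = inj₁ (Cn-mid {s} {true} {t} {c} {A} {B} c₁ c₂ (λ _ → h))
... | no ¬h = inj₂ (ℤₚ.≤-antisym t≤s s≤t , ≤-antisym eq₁ (at c₂ s) , ≤-antisym eq₂ (at c₂ (ℤ.suc s)))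
  where
  a = cnt s (σ A)
  a′ = cnt (ℤ.suc s) (σ A)
  b = cnt s (σ B)
  b′ = cnt (ℤ.suc s) (σ B)
  i = le (hi s) (e₂ (t , c))
  exceeds : 1 + (a + a′) ≤ i + (b + b′)
  exceeds = subst₂ (λ p q → 1 + p ≤ i + q) (cnt-hi A s≢0) (cnt-hi B s≢0) (≰⇒> ¬h)
  e₂≤hi : ∀ c → e₂ (t , c) ℤ.≤ hi t
  e₂≤hi false = ℤₚ.≤-refl
  e₂≤hi true = lo≤hi t
  i>0 : 1 ≤ i
  i>0 = ≤-balance (exceeds ⊕ at c₂ s ⊕ at c₂ (ℤ.suc s)) (arith a a′ b b′ i)
    where
    arith : ∀ a a′ b b′ i → 1 + (i + (b + b′) + (a + a′)) ≡ i + (1 + (a + a′) + (b + b′))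
    arith = solve-∀
  s≤t : s ℤ.≤ t
  s≤t = lo≤hi⇒≤ (ℤₚ.≤-trans (lo≤hi s) (ℤₚ.≤-trans (𝟙-positive (hi s ℤ.≤? e₂ (t , c)) i>0) (e₂≤hi c)))
  eq₁ : a ≤ b
  eq₁ = ≤-balance (exceeds ⊕ 𝟙≤1 (hi s ℤ.≤? e₂ (t , c)) ⊕ at c₂ (ℤ.suc s)) (arith a a′ b b′ i)
    where
    arith : ∀ a a′ b b′ i → a + (i + (b + b′) + (1 + a′)) ≡ b + (1 + (a + a′) + (i + b′))
    arith = solve-∀
  eq₂ : a′ ≤ b′
  eq₂ = ≤-balance (exceeds ⊕ 𝟙≤1 (hi s ℤ.≤? e₂ (t , c)) ⊕ at c₂ s) (arith a a′ b b′ i)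
    where
    arith : ∀ a a′ b b′ i → a′ + (i + (b + b′) + (1 + a)) ≡ b′ + (1 + (a + a′) + (i + b))
    arith = solve-∀
  suc-≰ : le (ℤ.suc s) s ≡ 0
  suc-≰ = le-false (λ h → ℤₚ.<-irrefl refl (ℤₚ.suc[i]≤j⇒i<j h))
  t≤s : t ℤ.≤ s
  t≤s = ℤₚ.≮⇒≥ (λ s<t → <⇒≱ (s≤s z≤n) (≤-balance {c = 1} {d = 0}
      (at c₁ (ℤ.suc s) ⊕ eq₂ ⊕ ≡⇒≤ suc-≰ ⊕ ≡⇒≥ (le-true (ℤₚ.i<j⇒suc[i]≤j s<t)))
      (arith (le (ℤ.suc s) s) (le (ℤ.suc s) t) a′ b′)))
    where
    arith : ∀ x y a b → 1 + (x + a + (b + (0 + y))) ≡ 0 + (y + b + (a + (x + 1)))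
    arith = solve-∀

-- Replacing a suffix of a code

SameCnt : List Code → List Code → Code → Set
SameCnt X X′ (s , _) = cnt s (σ X) ≡ cnt s (σ X′) × cnt (ℤ.suc s) (σ X) ≡ cnt (ℤ.suc s) (σ X′)

-- In the middle of a prefix block of value `s` only the count at `hi s` is at stake, and it reads
-- the rest of the code through the counts of `σ` at `s` and `suc s`. If `X` and `X′` agree on
-- these, the old middle condition carries over; the block boundaries follow from domination of `σ`.
Dom-enc-replace : ∀ A₁ B₁ X X′ Y → length A₁ ≡ length B₁ → Nonzero A₁ → All (SameCnt X X′) A₁ →
  Dom (σ (A₁ ++ X′)) (σ (B₁ ++ Y)) → Dom (enc (A₁ ++ X)) (enc (B₁ ++ Y)) → Dom (enc X′) (enc Y) →
  Dom (enc (A₁ ++ X′)) (enc (B₁ ++ Y))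
Dom-enc-replace [] [] X X′ Y _ _ _ _ _ d = d
Dom-enc-replace ((s , b) ∷ A₁) ((t , c) ∷ B₁) X X′ Y e (s≢0 ∷ nz) ((h₁ , h₂) ∷ hs) (c₁ ∷ dσ) (_ ∷ (mid ∷ d))
  dX =
  Cn-enc {(s , b) ∷ A₁ ++ X′} {(t , c) ∷ B₁ ++ Y} c₁
  ∷ (Cn-mid {s} {b} {t} {c} {A₁ ++ X′} {B₁ ++ Y} c₁ (Dom⇒Cn dσ) bit
  ∷ Dom-enc-replace A₁ B₁ X X′ Y (suc-injective e) nz hs dσ d dX)
  where
  replaced : ∀ {l} → cnt l (σ X) ≡ cnt l (σ X′) → cnt l (σ (A₁ ++ X)) ≡ cnt l (σ (A₁ ++ X′))
  replaced {l} h = trans (cong (cnt l) (map-++ proj₁ A₁ X)) (trans (sumOf-++ (le l) (σ A₁) (σ X))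
    (trans (cong (cnt l (σ A₁) ℕ.+_) h) (sym (trans (cong (cnt l) (map-++ proj₁ A₁ X′))
      (sumOf-++ (le l) (σ A₁) (σ X′))))))
  bit : b ≡ true → cnt (hi s) (e₂ (t , c) ∷ enc (B₁ ++ Y)) ≤ cnt (hi s) (enc (A₁ ++ X′))
  bit refl = ≤-trans (at mid (hi s)) (≡⇒≤ (begin
    le (hi s) (lo s) + cnt (hi s) (enc (A₁ ++ X))
      ≡⟨ cong (_+ cnt (hi s) (enc (A₁ ++ X))) (le-false (λ h → ℤₚ.<⇒≱ (lo<hi s≢0) h)) ⟩
    cnt (hi s) (enc (A₁ ++ X))
      ≡⟨ cnt-hi (A₁ ++ X) s≢0 ⟩
    cnt s (σ (A₁ ++ X)) + cnt (ℤ.suc s) (σ (A₁ ++ X))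
      ≡⟨ cong₂ _+_ (replaced h₁) (replaced h₂) ⟩
    cnt s (σ (A₁ ++ X′)) + cnt (ℤ.suc s) (σ (A₁ ++ X′))
      ≡⟨ cnt-hi (A₁ ++ X′) s≢0 ⟨
    cnt (hi s) (enc (A₁ ++ X′)) ∎))
    where open ≡-Reasoning

-- A clear bit imposes no condition in the middle of its block.
Dom-enc-∷ : ∀ {s β X Y} → Dom (s ∷ σ X) (σ (β ∷ Y)) → Dom (enc X) (enc Y) →
  Dom (enc ((s , false) ∷ X)) (enc (β ∷ Y))
Dom-enc-∷ {s} {t , c} {X} {Y} (c₁ ∷ dσ) d =
  Cn-enc {(s , false) ∷ X} {(t , c) ∷ Y} c₁ ∷ (Cn-mid {s} {false} {t} {c} {X} {Y} c₁ (Dom⇒Cn dσ) (λ ()) ∷ d)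

Same : ℤ → ℤ → ℤ → Set
Same x x′ m = le m x ≡ le m x′ × le (ℤ.suc m) x ≡ le (ℤ.suc m) x′

Dom-enc-replace₁ : ∀ A₁ B₁ {x x′ b} Q {β} → length A₁ ≡ length B₁ → Nonzero A₁ → All (Same x x′ ∘ proj₁) A₁ →
  Dom (σ (A₁ ++ (x′ , false) ∷ Q)) (σ (B₁ ++ β ∷ Q)) → Dom (enc (A₁ ++ (x , b) ∷ Q)) (enc (B₁ ++ β ∷ Q)) →
  Dom (enc (A₁ ++ (x′ , false) ∷ Q)) (enc (B₁ ++ β ∷ Q))
Dom-enc-replace₁ A₁ B₁ {x} {x′} {b} Q {β} e nz same dσ d =
  Dom-enc-replace A₁ B₁ ((x , b) ∷ Q) ((x′ , false) ∷ Q) (β ∷ Q) e nz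
    (All.map (λ {a} h → cong (_+ cnt (proj₁ a) (σ Q)) (proj₁ h) , cong (_+ cnt (ℤ.suc (proj₁ a)) (σ Q))
      (proj₂ h)) same) dσ d
    (Dom-enc-∷ {x′} {β} {Q} (Dom-σ-suffix A₁ B₁ e dσ) Dom-refl)

Same₂ : ℤ → ℤ → ℤ → ℤ → ℤ → Set
Same₂ z x z′ x′ m = le m z + le m x ≡ le m z′ + le m x′ × le (ℤ.suc m) z + le (ℤ.suc m) x ≡ le (ℤ.suc m) z′
    + le (ℤ.suc m) x′

-- The replacement is carried back in two stages, from the second position over `M` and from the
-- first over `A₁`; the two new blocks have clear bits and need no middle condition.
Dom-enc-replace₂ : ∀ A₁ B₁ {z z′ b} M M′ {x x′ b′} Q {β γ} → length A₁ ≡ length B₁ → length M ≡ length M′ →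
  Nonzero A₁ → Nonzero M → All (Same₂ z x z′ x′ ∘ proj₁) A₁ → All (Same x x′ ∘ proj₁) M →
  Dom (σ (A₁ ++ (z′ , false) ∷ M ++ (x′ , false) ∷ Q)) (σ (B₁ ++ β ∷ M′ ++ γ ∷ Q)) →
  Dom (enc (A₁ ++ (z , b) ∷ M ++ (x , b′) ∷ Q)) (enc (B₁ ++ β ∷ M′ ++ γ ∷ Q)) →
  Dom (enc (A₁ ++ (z′ , false) ∷ M ++ (x′ , false) ∷ Q)) (enc (B₁ ++ β ∷ M′ ++ γ ∷ Q))
Dom-enc-replace₂ A₁ B₁ {z} {z′} {b} M M′ {x} {x′} {b′} Q {β} {γ} e eM nzA nzM sameA sameM dσ d
  with Dom-enc-suffix A₁ B₁ e d | Dom-σ-suffix A₁ B₁ e dσ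
... | _ ∷ (_ ∷ d′) | dσ′@(_ ∷ dσ″) =
  Dom-enc-replace A₁ B₁ ((z , b) ∷ M ++ (x , b′) ∷ Q) ((z′ , false) ∷ M ++ (x′ , false) ∷ Q)
    (β ∷ M′ ++ γ ∷ Q) e nzA
    (All.map (λ h → counts (proj₁ h) , counts (proj₂ h)) sameA) dσ d
    (Dom-enc-∷ {z′} {β} {M ++ (x′ , false) ∷ Q} dσ′ (Dom-enc-replace₁ M M′ Q eM nzM sameM dσ″ d′))
  where
  counts : ∀ {l} → le l z + le l x ≡ le l z′ + le l x′ →
    cnt l (σ ((z , b) ∷ M ++ (x , b′) ∷ Q)) ≡ cnt l (σ ((z′ , false) ∷ M ++ (x′ , false) ∷ Q))
  counts {l} h = trans (cong (λ w → le l z + cnt l w) (map-++ proj₁ M _)) (trans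
    (≡-balance (cong₂ _+_ (sumOf-replace₂ (le l) [] z z′ (σ M) x x′ (σ Q)) h)
      (arith (cnt l (z ∷ σ M ++ x ∷ σ Q)) (cnt l (z′ ∷ σ M ++ x′ ∷ σ Q)) (le l z + le l x) (le l z′ + le l x′)))
    (cong (λ w → le l z′ + cnt l w) (sym (map-++ proj₁ M _))))
    where
    arith : ∀ a b c d → a + (b + c + d) ≡ b + (a + d + c)
    arith = solve-∀

-- `m` is below `y` or above `x`, so as a threshold neither `m` nor `suc m` separates `x` from `z`.
gap-same : ∀ {y z x m} → y ℤ.≤ z → z ℤ.< x → Gap y x m → m ≢ x → Same x z m
gap-same {y} {z} {x} {m} y≤z z<x g m≢x =
  le-cong {m} {x} {m} {z} (λ h → ℤₚ.<⇒≤ (below (ℤₚ.≤∧≢⇒< h m≢x))) (λ h → ℤₚ.≤-trans h (ℤₚ.<⇒≤ z<x)) ,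
  le-cong {ℤ.suc m} {x} {ℤ.suc m} {z} (λ h → ℤₚ.i<j⇒suc[i]≤j (below (ℤₚ.suc[i]≤j⇒i<j h)))
    (λ h → ℤₚ.≤-trans h (ℤₚ.<⇒≤ z<x))
  where
  below : m ℤ.< x → m ℤ.< z
  below m<x = ℤₚ.<-≤-trans (gap-< g m<x) y≤z

gap-same-neg : ∀ {y z x p} → y ℤ.≤ - z → - z ℤ.< x → Gap y x (- p) → ∣ p ∣ ≢ ∣ x ∣ → Same z (- x) p
gap-same-neg {y} {z} {x} {p} y≤-z -z<x g ne =
  le-cong {p} {z} {p} { - x} (λ h → ≤-neg-swap {x} {p} (gap-≤ g (ℤₚ.≤-trans y≤-z (ℤₚ.neg-mono-≤ h))))
    (λ h → ℤₚ.≤-trans h -x≤z) ,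
  le-cong {ℤ.suc p} {z} {ℤ.suc p} { - x}
    (λ h → ℤₚ.i<j⇒suc[i]≤j (<-neg-swap {x} {p} (gap-> g (∣∣≢⇒-≢ ne)
      (ℤₚ.≤-trans y≤-z (ℤₚ.<⇒≤ (ℤₚ.neg-mono-< (ℤₚ.suc[i]≤j⇒i<j h)))))))
    (λ h → ℤₚ.≤-trans h -x≤z)
  where
  -x≤z : - x ℤ.≤ z
  -x≤z = ℤₚ.<⇒≤ (neg-<-swap {z} {x} -z<x)

-- Even n

EvenStep : ℕ → List Code → List Code → Set
EvenStep m A B = ∃ λ A′ → IsB m (σ A′) × Dom (enc A) (enc A′) × Dom (enc A′) (enc B) × rk A′ ≡ 1 + rk A

IsB⇒≢0 : ∀ {m w} → IsB m w → All (_≢ 0ℤ) w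
IsB⇒≢0 (_ , bounds , _) = All.map (λ { (1≤ , _) refl → <⇒≱ 1≤ z≤n }) bounds

IsB⇒Nonzero : ∀ {m A} → IsB m (σ A) → Nonzero A
IsB⇒Nonzero b = Allₚ.map⁻ (IsB⇒≢0 b)

σ₁ : ∀ P a Q → σ (P ++ a ∷ Q) ≡ σ P ++ proj₁ a ∷ σ Q
σ₁ P a Q = map-++ proj₁ P (a ∷ Q)

σ₂ : ∀ P a M b Q → σ (P ++ a ∷ M ++ b ∷ Q) ≡ σ P ++ proj₁ a ∷ σ M ++ proj₁ b ∷ σ Q
σ₂ P a M b Q = trans (σ₁ P a _) (cong (λ l → σ P ++ proj₁ a ∷ l) (σ₁ M b Q))

set-or-blocked : ∀ {m} A₁ B₁ {s A₂ t c B₂} → IsB m (σ (A₁ ++ (s , false) ∷ A₂)) → length A₁ ≡ length B₁ →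
  Dom (enc (A₁ ++ (s , false) ∷ A₂)) (enc (B₁ ++ (t , c) ∷ B₂)) →
  EvenStep m (A₁ ++ (s , false) ∷ A₂) (B₁ ++ (t , c) ∷ B₂) ⊎ Blocked s A₂ t B₂
set-or-blocked {m} A₁ B₁ {s} {A₂} {t} {c} {B₂} b e d with Dom-σ {(s , false) ∷ A₂} {(t , c) ∷ B₂}
  (Dom-enc-suffix A₁ B₁ {(s , false) ∷ A₂} {(t , c) ∷ B₂} e d)
... | c₁ ∷ dσ with settable {s} {A₂} {t} {c} {B₂} s≢0 c₁ (Dom⇒Cn dσ)
  where
  s≢0 : s ≢ 0ℤ
  s≢0 = All.head (Allₚ.++⁻ʳ A₁ (IsB⇒Nonzero {A = A₁ ++ (s , false) ∷ A₂} b))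
... | inj₂ blocked = inj₂ blocked
... | inj₁ mid = inj₁ (A₁ ++ (s , true) ∷ A₂ , subst (IsB m) (σ-setBit A₁ s A₂ false true) b ,
  setBit-raise A₁ A₂ (All.head (Allₚ.++⁻ʳ A₁ (IsB⇒Nonzero {A = A₁ ++ (s , false) ∷ A₂} b))) , setBit-Dom A₁
      B₁ e mid d , rk-setBit A₁ s A₂)

Dom-enc-lower : ∀ {s s′ u v} → s′ ℤ.< s → Dom u v → Dom (hi s ∷ lo s ∷ u) (lo s′ ∷ hi s′ ∷ v)
Dom-enc-lower {s} {s′} s′<s d =
  Dom-∷ (ℤₚ.≤-trans (lo-mono (ℤₚ.<⇒≤ s′<s)) (lo≤hi s)) (Dom-∷ (ℤₚ.<⇒≤ (hi<lo s′<s)) d)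

Dom-enc-++ : ∀ P {X Y} → Dom (enc X) (enc Y) → Dom (enc (P ++ X)) (enc (P ++ Y))
Dom-enc-++ P {X} {Y} d = subst₂ Dom (sym (enc-++ P X)) (sym (enc-++ P Y)) (Dom-++ (enc P) d)

Dom-enc-swap : ∀ P {z} M {x} Q → z ℤ.< x →
  Dom (enc (P ++ (z , true) ∷ M ++ (x , true) ∷ Q)) (enc (P ++ (x , false) ∷ M ++ (z , false) ∷ Q))
Dom-enc-swap P {z} M {x} Q z<x = Dom-enc-++ P (first ∷ (second ∷ Dom-enc-++ M (Dom-enc-lower z<x Dom-refl)))
  where
  first : Cn (enc ((z , true) ∷ M ++ (x , true) ∷ Q)) (enc ((x , false) ∷ M ++ (z , false) ∷ Q))
  first = Cn-enc {(z , true) ∷ M ++ (x , true) ∷ Q} {(x , false) ∷ M ++ (z , false) ∷ Q}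
    (subst₂ Cn (sym (σ₂ [] (z , true) M (x , true) Q)) (sym (σ₂ [] (x , false) M (z , false) Q))
      (cn λ l → ≡⇒≤ (cnt-swap l [] z (σ M) x (σ Q))))
  second : Cn (lo z ∷ enc (M ++ (x , true) ∷ Q)) (hi x ∷ enc (M ++ (z , false) ∷ Q))
  -- Exchanging `lo z` with `hi x` across `M` preserves the counts and leaves `lo x` facing `hi z`,
  -- where `hi z < lo x`.
  second = subst₂ (λ u v → Cn (lo z ∷ u) (hi x ∷ v)) (sym (enc-++ M _)) (sym (enc-++ M _))
    (Cn-trans (cn λ l → ≡⇒≤ (cnt-swap l [] (lo z) (enc M) (hi x) (lo x ∷ enc Q)))
      (Cn-++ (hi x ∷ enc M) (Cn-∷ ℤₚ.≤-refl (Cn-∷ (ℤₚ.<⇒≤ (hi<lo z<x)) Cn-refl))))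

negs-flip₂ : ∀ P z M x Q → Opposite z x → negs (P ++ - x ∷ M ++ - z ∷ Q) ≡ negs (P ++ z ∷ M ++ x ∷ Q)
negs-flip₂ P z M x Q opp = ≡-balance
  (cong₂ _+_ (sumOf-replace₂ (λ a → lt a 0ℤ) P (- x) z M (- z) x Q) (signs opp))
  (arith (negs (P ++ - x ∷ M ++ - z ∷ Q)) (negs (P ++ z ∷ M ++ x ∷ Q)) (lt z 0ℤ + lt x 0ℤ)
    (lt (- x) 0ℤ + lt (- z) 0ℤ))
  where
  arith : ∀ a b c d → a + (b + d + c) ≡ b + (a + c + d)
  arith = solve-∀
  signs : Opposite z x → lt (- x) 0ℤ + lt (- z) 0ℤ ≡ lt z 0ℤ + lt x 0ℤ
  signs (inj₁ (z<0 , 0<x)) rewrite lt-true z<0 | lt-false (ℤₚ.<-asym 0<x)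
    | lt-true (ℤₚ.neg-mono-< 0<x) | lt-false (ℤₚ.<-asym (ℤₚ.neg-mono-< z<0)) = refl
  signs (inj₂ (0<z , x<0)) rewrite lt-true x<0 | lt-false (ℤₚ.<-asym 0<z)
    | lt-true (ℤₚ.neg-mono-< 0<z) | lt-false (ℤₚ.<-asym (ℤₚ.neg-mono-< x<0)) = refl

-- Three for the new pair, less the two cleared bits.
rk-replace₂ : ∀ P {z z′} M {x x′} Q →
  invPairs (σ P ++ z′ ∷ σ M ++ x′ ∷ σ Q) ≡ 1 + invPairs (σ P ++ z ∷ σ M ++ x ∷ σ Q) →
  negs (σ P ++ z′ ∷ σ M ++ x′ ∷ σ Q) ≡ negs (σ P ++ z ∷ σ M ++ x ∷ σ Q) →
  rk (P ++ (z′ , false) ∷ M ++ (x′ , false) ∷ Q) ≡ 1 + rk (P ++ (z , true) ∷ M ++ (x , true) ∷ Q)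
rk-replace₂ P {z} {z′} M {x} {x′} Q hp hn
  rewrite σ₂ P (z′ , false) M (x′ , false) Q | σ₂ P (z , true) M (x , true) Q | hp | hn =
  ≡-balance (sumOf-replace₂ (b2n ∘ proj₂) P (z′ , false) (z , true) M (x′ , false) (x , true) Q)
    (arith (invPairs w) (negs w) (bits (P ++ (z′ , false) ∷ M ++ (x′ , false) ∷ Q))
      (bits (P ++ (z , true) ∷ M ++ (x , true) ∷ Q)))
  where
  w = σ P ++ z ∷ σ M ++ x ∷ σ Q
  arith : ∀ p n b b′ → 3 * (1 + p) + (2 * n + b) + (b′ + 0) ≡ 1 + (3 * p + (2 * n + b′)) + (b + 2)
  arith = solve-∀

-- Two for the new negative entry, less the cleared bit.
rk-replace₁ : ∀ P {x x′} Q →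
  invPairs (σ P ++ x′ ∷ σ Q) ≡ invPairs (σ P ++ x ∷ σ Q) →
  negs (σ P ++ x′ ∷ σ Q) ≡ 1 + negs (σ P ++ x ∷ σ Q) →
  rk (P ++ (x′ , false) ∷ Q) ≡ 1 + rk (P ++ (x , true) ∷ Q)
rk-replace₁ P {x} {x′} Q hp hn rewrite σ₁ P (x′ , false) Q | σ₁ P (x , true) Q | hp | hn =
  ≡-balance (sumOf-replace₁ (b2n ∘ proj₂) P (x′ , false) (x , true) Q)
    (arith (invPairs w) (negs w) (bits (P ++ (x′ , false) ∷ Q)) (bits (P ++ (x , true) ∷ Q)))
  where
  w = σ P ++ x ∷ σ Q
  arith : ∀ p n b b′ → 3 * p + (2 * (1 + n) + b) + (b′ + 0) ≡ 1 + (3 * p + (2 * n + b′)) + (b + 1)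
  arith = solve-∀

distinct₂ : ∀ {m} P a M x Q → IsB m (σ (P ++ a ∷ M ++ x ∷ Q)) →
  All (λ p → ∣ p ∣ ≢ ∣ proj₁ x ∣) (σ P) × All (λ p → ∣ p ∣ ≢ ∣ proj₁ x ∣) (σ M)
distinct₂ {m} P a M x Q b = Allₚ.++⁻ˡ (σ P) before , All.tail (Allₚ.++⁻ʳ (σ P) before)
  where
  before = AllPairs-before (σ P ++ proj₁ a ∷ σ M)
    (subst (AllPairs _) (trans (σ₂ P a M x Q) (sym (++-assoc (σ P) (proj₁ a ∷ σ M) (proj₁ x ∷ σ Q))))
      (proj₂ (proj₂ b)))

even-swap : ∀ {m} P P′ {z b} M M′ {x} Q {β y c} → length P ≡ length P′ → length M ≡ length M′ →
  IsB m (σ (P ++ (z , b) ∷ M ++ (x , true) ∷ Q)) → y ℤ.≤ z → z ℤ.< x → All (Gap y x) (σ M) →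
  Dom (σ P ++ x ∷ σ M ++ z ∷ σ Q) (σ (P′ ++ β ∷ M′ ++ (y , c) ∷ Q)) →
  Dom (enc (P ++ (z , b) ∷ M ++ (x , true) ∷ Q)) (enc (P′ ++ β ∷ M′ ++ (y , c) ∷ Q)) →
  EvenStep m (P ++ (z , b) ∷ M ++ (x , true) ∷ Q) (P′ ++ β ∷ M′ ++ (y , c) ∷ Q)
even-swap {m} P P′ {z} {false} M M′ {x} Q {β} {y} {c} e eM bA y≤z z<x gs dσ d
  with set-or-blocked P P′ bA e d
... | inj₁ found = found
... | inj₂ (refl , _ , blocked) with Dom-suffix (σ P) (σ P′)
    (trans (length-map proj₁ P) (trans e (sym (length-map proj₁ P′))))
                                    (subst (Dom _) (map-++ proj₁ P′ _) dσ)
... | _ ∷ dσ′ = contradiction (at (Dom⇒Cn dσ′) L) (<⇒≱ (begin-strict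
    cnt L (σ M ++ z ∷ σ Q)                 <⟨ loses ⟩
    cnt L (σ M ++ x ∷ σ Q)                 ≡⟨ cong (cnt L) (σ₁ M (x , true) Q) ⟨
    cnt L (σ (M ++ (x , true) ∷ Q))        ≡⟨ blocked ⟩
    cnt L (σ (M′ ++ (y , c) ∷ Q))          ∎))
  where
  open ≤-Reasoning
  -- At this threshold `x` counts and `z` does not, so after the swap the suffix just behind the
  -- first position has one entry fewer. A blocked bit leaves no room for that loss.
  L = ℤ.suc z
  loses : cnt L (σ M ++ z ∷ σ Q) < cnt L (σ M ++ x ∷ σ Q)
  loses = ≤-balance (≡⇒≤ (sumOf-replace₁ (le L) (σ M) z x (σ Q)) ⊕ ≡⇒≥ (le-true (ℤₚ.i<j⇒suc[i]≤j z<x))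
      ⊕ ≡⇒≤ (le-false {L} {z} (λ h → ℤₚ.<-irrefl refl (ℤₚ.suc[i]≤j⇒i<j h))))
    (arith (cnt L (σ M ++ z ∷ σ Q)) (cnt L (σ M ++ x ∷ σ Q)) (le L x) (le L z))
    where
    arith : ∀ a b c d → 1 + a + (b + d + (c + 0)) ≡ b + (a + c + (1 + d))
    arith = solve-∀
even-swap {m} P P′ {z} {true} M M′ {x} Q {β} {y} {c} e eM bA y≤z z<x gs dσ d =
  P ++ (x , false) ∷ M ++ (z , false) ∷ Q ,
  subst (IsB m) (sym σ-new) (raise-IsB (swap (σ P) (σ M) (σ Q) z<x)
    (subst (IsB m) (σ₂ P (z , true) M (x , true) Q) bA)) ,
  Dom-enc-swap P M Q z<x ,
  Dom-enc-replace₂ P P′ M M′ Q e eM (Allₚ.++⁻ˡ P nz) (Allₚ.++⁻ˡ M (All.tail (Allₚ.++⁻ʳ P nz)))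
    (All.universal (λ a → +-comm (le (proj₁ a) z) _ , +-comm (le (ℤ.suc (proj₁ a)) z) _) P)
    (Allₚ.map⁻ (All.zipWith (λ { (g , ne) → gap-same y≤z z<x g (∣∣≢⇒≢ ne) }) (gs , neM)))
    (subst (λ w → Dom w _) (sym σ-new) dσ) d ,
  rk-replace₂ P M Q
    (≤-antisym (pairs-swap-≤ (σ P) (σ M) (σ Q) y≤z z<x gs (All.map ∣∣≢⇒≢ neM))
      (pairs-swap-≥ (σ P) (σ M) (σ Q) z<x))
    (negs-swap (σ P) z (σ M) x (σ Q))
  where
  σ-new = σ₂ P (x , false) M (z , false) Q
  nz = IsB⇒Nonzero {A = P ++ (z , true) ∷ M ++ (x , true) ∷ Q} bA
  neM = proj₂ (distinct₂ P (z , true) M (x , true) Q bA)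

even-flip₂ : ∀ {m} P P′ {z b} M M′ {x} Q {β y c} → length P ≡ length P′ → length M ≡ length M′ →
  IsB m (σ (P ++ (z , b) ∷ M ++ (x , true) ∷ Q)) → y ℤ.≤ - z → - z ℤ.< x → Opposite z x →
  All (Gap y x) (σ P) → All (λ p → Gap y x (- p)) (σ P) → All (Gap y x) (σ M) →
  Dom (σ P ++ - x ∷ σ M ++ - z ∷ σ Q) (σ (P′ ++ β ∷ M′ ++ (y , c) ∷ Q)) →
  Dom (enc (P ++ (z , b) ∷ M ++ (x , true) ∷ Q)) (enc (P′ ++ β ∷ M′ ++ (y , c) ∷ Q)) →
  EvenStep m (P ++ (z , b) ∷ M ++ (x , true) ∷ Q) (P′ ++ β ∷ M′ ++ (y , c) ∷ Q)
even-flip₂ {m} P P′ {z} {false} M M′ {x} Q {β} {y} {c} e eM bA y≤-z -z<x opp gP gP′ gM dσ d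
  with set-or-blocked P P′ bA e d
... | inj₁ found = found
... | inj₂ (refl , blocked , _) with Dom-suffix (σ P) (σ P′)
    (trans (length-map proj₁ P) (trans e (sym (length-map proj₁ P′))))
                                    (subst (Dom _) (map-++ proj₁ P′ _) dσ)
... | dσ′ = contradiction (at (Dom⇒Cn dσ′) z) (<⇒≱ loses)
  where
  -- The threshold is `z` itself and the suffix includes the first position: there `z` is replaced
  -- by the smaller `- x`, and at the second position `- z < x` gains nothing. Being blocked means
  -- equal counts at `z` before the change.
  loses : le z (- x) + cnt z (σ M ++ - z ∷ σ Q) < le z z + cnt z (σ (M′ ++ (y , c) ∷ Q))
  loses = ≤-balance
    (≡⇒≤ (sumOf-replace₁ (le z) (σ M) (- z) x (σ Q)) ⊕ le-mono-≤ z (ℤₚ.<⇒≤ -z<x)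
      ⊕ ≡⇒≤ (trans (cong (cnt z) (sym (σ₁ M (x , true) Q))) blocked)
      ⊕ ≡⇒≥ (le-true (ℤₚ.≤-refl {z})) ⊕ ≡⇒≤ (le-false {z} { - x} (ℤₚ.<⇒≱ (neg-<-swap {z} {x} -z<x))))
    (arith (le z (- x)) (cnt z (σ M ++ - z ∷ σ Q)) (le z z) (cnt z (σ (M′ ++ (y , c) ∷ Q)))
      (cnt z (σ M ++ x ∷ σ Q)) (le z (- z)) (le z x))
    where
    arith : ∀ a b c d e f g → 1 + (a + b) + (e + f + (g + (d + (c + 0)))) ≡ c + d +
        (b + g + (f + (e + (1 + a))))
    arith = solve-∀
even-flip₂ {m} P P′ {z} {true} M M′ {x} Q {β} {y} {c} e eM bA y≤-z -z<x opp gP gP′ gM dσ d =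
  P ++ (- x , false) ∷ M ++ (- z , false) ∷ Q ,
  subst (IsB m) (sym σ-new) (raise-IsB (flip₂ (σ P) (σ M) (σ Q) -z<x)
    (subst (IsB m) (σ₂ P (z , true) M (x , true) Q) bA)) ,
  Dom-enc-++ P (Dom-enc-lower (neg-<-swap {z} {x} -z<x) (Dom-enc-++ M (Dom-enc-lower -z<x Dom-refl))) ,
  Dom-enc-replace₂ P P′ M M′ Q e eM (Allₚ.++⁻ˡ P nz) (Allₚ.++⁻ˡ M (All.tail (Allₚ.++⁻ʳ P nz)))
    (Allₚ.map⁻ (All.zipWith (λ { {p} (g , g′ , ne) → both p (gap-same-neg {z = z} y≤-z -z<x g′ ne)
        (gap-same y≤-z -z<x g (∣∣≢⇒≢ ne)) })
      (gP , All.zip (gP′ , proj₁ ne))))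
    (Allₚ.map⁻ (All.zipWith (λ { (g , ne) → gap-same y≤-z -z<x g (∣∣≢⇒≢ ne) }) (gM , proj₂ ne)))
    (subst (λ w → Dom w _) (sym σ-new) dσ) d ,
  rk-replace₂ P M Q
    (≤-antisym (pairs-flip₂-≤ (σ P) (σ M) (σ Q) y≤-z -z<x gP gP′ (proj₁ ne) gM (All.map ∣∣≢⇒≢ (proj₂ ne)))
                  (pairs-flip₂-≥ (σ P) (σ M) (σ Q) -z<x))
    (negs-flip₂ (σ P) z (σ M) x (σ Q) opp)
  where
  σ-new = σ₂ P (- x , false) M (- z , false) Q
  nz = IsB⇒Nonzero {A = P ++ (z , true) ∷ M ++ (x , true) ∷ Q} bA
  ne = distinct₂ P (z , true) M (x , true) Q bA
  both : ∀ p → Same z (- x) p → Same x (- z) p → Same₂ z x (- x) (- z) p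
  both p (h₁ , h₂) (k₁ , k₂) = cong₂ _+_ h₁ k₁ , cong₂ _+_ h₂ k₂

even-flip₁ : ∀ {m} P P′ {x} Q {y c} → length P ≡ length P′ → IsB m (σ (P ++ (x , true) ∷ Q)) →
  y ℤ.≤ - x → - x ℤ.< x → All (Gap y x) (σ P) →
  Dom (σ P ++ - x ∷ σ Q) (σ (P′ ++ (y , c) ∷ Q)) →
  Dom (enc (P ++ (x , true) ∷ Q)) (enc (P′ ++ (y , c) ∷ Q)) →
  EvenStep m (P ++ (x , true) ∷ Q) (P′ ++ (y , c) ∷ Q)
even-flip₁ {m} P P′ {x} Q {y} {c} e bA y≤-x -x<x gP dσ d =
  P ++ (- x , false) ∷ Q ,
  subst (IsB m) (sym σ-new) (raise-IsB (flip₁ (σ P) (σ Q) -x<x) (subst (IsB m) (σ₁ P (x , true) Q) bA)) ,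
  Dom-enc-++ P (Dom-enc-lower -x<x Dom-refl) ,
  Dom-enc-replace₁ P P′ Q e (Allₚ.++⁻ˡ P nz)
    (Allₚ.map⁻ (All.zipWith (λ { (g , ne) → gap-same y≤-x -x<x g (∣∣≢⇒≢ ne) }) (gP , ne)))
    (subst (λ w → Dom w _) (sym σ-new) dσ) d ,
  rk-replace₁ P Q
    (≤-antisym (pairs-flip₁-≤ (σ P) (σ Q) y≤-x -x<x gP (All.map ∣∣≢⇒≢ ne)) (pairs-flip₁-≥ (σ P) (σ Q) -x<x))
    (negs-flip₁ (σ P) x (σ Q) -x<x)
  where
  σ-new = σ₁ P (- x , false) Q
  nz = IsB⇒Nonzero {A = P ++ (x , true) ∷ Q} bA
  ne = AllPairs-before (σ P) (subst (AllPairs _) (σ₁ P (x , true) Q) (proj₂ (proj₂ bA)))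

splitLike : ∀ {A B : Set} (P : List A) a M (L : List B) → length (P ++ a ∷ M) ≡ length L →
  ∃ λ P′ → ∃ λ b → ∃ λ M′ → L ≡ P′ ++ b ∷ M′ × length P ≡ length P′ × length M ≡ length M′
splitLike [] a M (b ∷ L) e = [] , b , L , refl , refl , suc-injective e
splitLike (p ∷ P) a M (b ∷ L) e with splitLike P a M L (suc-injective e)
... | P′ , c , M′ , refl , h , h′ = b ∷ P′ , c , M′ , refl , cong suc h , h′

-- A clear bit at a position where the values differ is never blocked, because `Blocked` includes
-- equality of the values. With the bit set, the cover of `σ` that moves this position is available.
even-step-at : ∀ {m} P P′ {s t} b c Q → length P ≡ length P′ → s ≢ t →
  IsB m (σ (P ++ (s , b) ∷ Q)) → IsB m (σ (P′ ++ (t , c) ∷ Q)) →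
  Dom (enc (P ++ (s , b) ∷ Q)) (enc (P′ ++ (t , c) ∷ Q)) → EvenStep m (P ++ (s , b) ∷ Q) (P′ ++ (t , c) ∷ Q)
even-step-at P P′ false c Q e s≢t bA bB d with set-or-blocked P P′ bA e d
... | inj₁ found = found
... | inj₂ (t≡s , _) = contradiction (sym t≡s) s≢t
even-step-at {m} P P′ {s} {t} true c Q e s≢t bA bB d = byCover
  (cover (σ P) (σ P′) (σ Q) (trans (length-map proj₁ P) (trans e (sym (length-map proj₁ P′))))
    (subst (IsB m) (σ₁ P _ Q) bA) (subst (IsB m) (σ₁ P′ _ Q) bB) s≢t
      (subst₂ Dom (σ₁ P _ Q) (σ₁ P′ _ Q) (Dom-σ {P ++ (s , true) ∷ Q} {P′ ++ (t , c) ∷ Q} d)))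
  where
  byCover : CoverStep (σ P) s (σ Q) t (σ P′ ++ t ∷ σ Q) → EvenStep m (P ++ (s , true) ∷ Q) (P′ ++ (t , c) ∷ Q)
  byCover (flip₁ y≤-x -x<x gs dσ) = even-flip₁ P P′ Q e bA y≤-x -x<x gs (subst (Dom _) (sym (σ₁ P′ _ Q)) dσ) d
  byCover (swap P₁ z M eq y≤z z<x gs dσ) with map-++-inv proj₁ P P₁ eq
  ... | P̂ , (_ , b) , M̂ , refl , refl , refl , refl with splitLike P̂ (z , b) M̂ P′ e
  ... | P̂′ , β , M̂′ , refl , e₁ , e₂ = subst₂ (EvenStep m) (sym (++-assoc P̂ _ _)) (sym (++-assoc P̂′ _ _))
    (even-swap P̂ P̂′ M̂ M̂′ Q e₁ e₂ (subst (IsB m ∘ σ) (++-assoc P̂ _ _) bA) y≤z z<x gs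
      (subst (Dom _) (trans (sym (σ₁ (P̂′ ++ β ∷ M̂′) (t , c) Q)) (cong σ (++-assoc P̂′ _ _))) dσ)
      (subst₂ Dom (cong enc (++-assoc P̂ _ _)) (cong enc (++-assoc P̂′ _ _)) d))
  byCover (flip₂ P₁ z M eq y≤-z -z<x opp gs gs′ dσ) with map-++-inv proj₁ P P₁ eq
  ... | P̂ , (_ , b) , M̂ , refl , refl , refl , refl with splitLike P̂ (z , b) M̂ P′ e
  ... | P̂′ , β , M̂′ , refl , e₁ , e₂ = subst₂ (EvenStep m) (sym (++-assoc P̂ _ _)) (sym (++-assoc P̂′ _ _))
    (even-flip₂ P̂ P̂′ M̂ M̂′ Q e₁ e₂ (subst (IsB m ∘ σ) (++-assoc P̂ _ _) bA) y≤-z -z<x opp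
      (Allₚ.++⁻ˡ (σ P̂) gs₂) gs′ (All.tail (Allₚ.++⁻ʳ (σ P̂) gs₂))
      (subst (Dom _) (trans (sym (σ₁ (P̂′ ++ β ∷ M̂′) (t , c) Q)) (cong σ (++-assoc P̂′ _ _))) dσ)
      (subst₂ Dom (cong enc (++-assoc P̂ _ _)) (cong enc (++-assoc P̂′ _ _)) d))
    where
    gs₂ = subst (All (Gap t s)) (σ₁ P̂ (z , b) M̂) gs

_≟ᶜ_ : DecidableEquality Code
_≟ᶜ_ = ×-≡-dec ℤ._≟_ _≟ᵇ_

enc-length-injective : ∀ A B → length (enc A) ≡ length (enc B) → length A ≡ length B
enc-length-injective [] [] _ = refl
enc-length-injective (_ ∷ A) (_ ∷ B) e = cong suc (enc-length-injective A B (suc-injective (suc-injective e)))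

-- The last difference is taken between codes, not between the lists `σ`, so that the common tail
-- `Q` agrees in its bits too. If only the bits differ there, setting that bit is the step, whether
-- or not the values differ further left.
even-step : ∀ {m A B} → IsB m (σ A) → IsB m (σ B) → Dom (enc A) (enc B) → A ≢ B → EvenStep m A B
even-step {m} {A} {B} bA bB d A≢B with lastDifference _≟ᶜ_ A B (enc-length-injective A B (Dom⇒length d)) A≢B
... | P , (s , b) , P′ , (t , c) , Q , refl , refl , e , ne with s ℤ.≟ t
... | no s≢t = even-step-at P P′ b c Q e s≢t bA bB d
... | yes refl = byBits b c ne bA d (Dom-enc-suffix P P′ {(s , b) ∷ Q} {(s , c) ∷ Q} e d)
  where
  s≢0 : s ≢ 0ℤ
  s≢0 = All.head (Allₚ.++⁻ʳ P (IsB⇒Nonzero {A = P ++ (s , b) ∷ Q} bA))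
  byBits : ∀ b c → (s , b) ≢ (s , c) → IsB m (σ (P ++ (s , b) ∷ Q)) →
    Dom (enc (P ++ (s , b) ∷ Q)) (enc (P′ ++ (s , c) ∷ Q)) →
    Dom (enc ((s , b) ∷ Q)) (enc ((s , c) ∷ Q)) → EvenStep m (P ++ (s , b) ∷ Q) (P′ ++ (s , c) ∷ Q)
  byBits false false ne _ _ _ = contradiction refl ne
  byBits true true ne _ _ _ = contradiction refl ne
  -- In the middle of the block `lo s` faces `hi s` before identical tails, and the threshold `hi s`
  -- separates them.
  byBits true false _ _ _ (_ ∷ (mid ∷ _)) = contradiction
    (+-cancelʳ-≤ (cnt (hi s) (enc Q)) (le (hi s) (hi s)) (le (hi s) (lo s)) (at mid (hi s)))
    (<⇒≱ (subst₂ _<_ (sym (le-false (ℤₚ.<⇒≱ (lo<hi s≢0)))) (sym (le-true (ℤₚ.≤-refl {hi s}))) (s≤s z≤n)))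
  byBits false true _ bA d _ = P ++ (s , true) ∷ Q , subst (IsB m) (σ-setBit P s Q false true) bA ,
    setBit-raise P Q s≢0 , setBit-Dom P P′ e Cn-refl d , rk-setBit P s Q

-- Odd n

sumOf-insert : ∀ {A : Set} (f : A → ℕ) P e Q → sumOf f (P ++ e ∷ Q) ≡ f e + sumOf f (P ++ Q)
sumOf-insert f [] e Q = refl
sumOf-insert f (p ∷ P) e Q = trans (cong (f p ℕ.+_) (sumOf-insert f P e Q)) (arith (f p) (f e) _)
  where
  arith : ∀ a b c → a + (b + c) ≡ b + (a + c)
  arith = solve-∀

Dom-insert : ∀ P P′ {e Q Q′} → length P ≡ length P′ → Dom (P ++ Q) (P′ ++ Q′) → Dom (P ++ e ∷ Q) (P′ ++ e ∷ Q′)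
Dom-insert [] [] _ d = Dom-∷ ℤₚ.≤-refl d
Dom-insert (p ∷ P) (p′ ∷ P′) {e} {Q} {Q′} h (c ∷ d) =
  cn (λ l → subst₂ _≤_ (sym (sumOf-insert (le l) (p′ ∷ P′) e Q′)) (sym (sumOf-insert (le l) (p ∷ P) e Q))
              (+-monoʳ-≤ (le l e) (at c l)))
  ∷ Dom-insert P P′ (suc-injective h) d

Dom-delete : ∀ P P′ {e Q Q′} → length P ≡ length P′ → Dom (P ++ e ∷ Q) (P′ ++ e ∷ Q′) → Dom (P ++ Q) (P′ ++ Q′)
Dom-delete [] [] _ (_ ∷ d) = d
Dom-delete (p ∷ P) (p′ ∷ P′) {e} {Q} {Q′} h (c ∷ d) =
  cn (λ l → +-cancelˡ-≤ (le l e) _ _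
              (subst₂ _≤_ (sumOf-insert (le l) (p′ ∷ P′) e Q′) (sumOf-insert (le l) (p ∷ P) e Q) (at c l)))
  ∷ Dom-delete P P′ (suc-injective h) d

cnt-drop-insert : ∀ l k P e Q → k ≤ length P → cnt l (drop k (P ++ e ∷ Q)) ≡ le l e + cnt l (drop k (P ++ Q))
cnt-drop-insert l zero P e Q _ = sumOf-insert (le l) P e Q
cnt-drop-insert l (suc k) (p ∷ P) e Q (s≤s h) = cnt-drop-insert l k P e Q h

drop-insert : ∀ k P (e : ℤ) Q → length P ≤ k → drop (suc k) (P ++ e ∷ Q) ≡ drop k (P ++ Q)
drop-insert k [] e Q _ = refl
drop-insert (suc k) (p ∷ P) e Q (s≤s h) = drop-insert k P e Q h

cnt-drop-suc : ∀ l k w → cnt l (drop (suc k) w) ≤ cnt l (drop k w)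
cnt-drop-suc l zero [] = z≤n
cnt-drop-suc l (suc k) [] = z≤n
cnt-drop-suc l zero (x ∷ w) = m≤n+m _ (le l x)
cnt-drop-suc l (suc k) (x ∷ w) = cnt-drop-suc l k w

cnt-drop-≤ : ∀ l k w → cnt l (drop k w) ≤ 1 + cnt l (drop (suc k) w)
cnt-drop-≤ l zero [] = z≤n
cnt-drop-≤ l (suc k) [] = z≤n
cnt-drop-≤ l zero (x ∷ w) = 𝟙≤1 (l ℤ.≤? x) ⊕ ≤-refl
cnt-drop-≤ l (suc k) (x ∷ w) = cnt-drop-≤ l k w

Dom-drop : ∀ k {u v} → Dom u v → Dom (drop k u) (drop k v)
Dom-drop zero d = d
Dom-drop (suc k) [] = []
Dom-drop (suc k) (_ ∷ d) = Dom-drop k d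

-- The two deleted entries may stand at unrelated places, which shifts the suffixes against each
-- other by at most one entry; this costs at most one count.
cnt-delete : ∀ {P e Q P′ f Q′} → Dom (P ++ e ∷ Q) (P′ ++ f ∷ Q′) → ∀ k l →
  cnt l (drop k (P′ ++ Q′)) ≤ 1 + cnt l (drop k (P ++ Q))
cnt-delete {P} {e} {Q} {P′} {f} {Q′} d k l with length P′ ℕ.≤? k
... | yes P′≤k = begin
  cnt l (drop k (P′ ++ Q′))             ≡⟨ cong (cnt l) (drop-insert k P′ f Q′ P′≤k) ⟨
  cnt l (drop (suc k) (P′ ++ f ∷ Q′))   ≤⟨ at (Dom⇒Cn (Dom-drop (suc k) d)) l ⟩
  cnt l (drop (suc k) (P ++ e ∷ Q))     ≤⟨ left (suc k ℕ.≤? length P) ⟩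
  1 + cnt l (drop k (P ++ Q))           ∎
  where
  open ≤-Reasoning
  left : Dec (suc k ≤ length P) → cnt l (drop (suc k) (P ++ e ∷ Q)) ≤ 1 + cnt l (drop k (P ++ Q))
  left (yes h) = ≤-trans (≡⇒≤ (cnt-drop-insert l (suc k) P e Q h)) (𝟙≤1 (l ℤ.≤? e) ⊕ cnt-drop-suc l k (P ++ Q))
  left (no h) = ≤-trans (≡⇒≤ (cong (cnt l) (drop-insert k P e Q (≤-pred (≰⇒> h))))) (n≤1+n _)
... | no P′≰k = begin
  cnt l (drop k (P′ ++ Q′))             ≤⟨ m≤n+m _ (le l f) ⟩
  le l f + cnt l (drop k (P′ ++ Q′))    ≡⟨ cnt-drop-insert l k P′ f Q′ (<⇒≤ (≰⇒> P′≰k)) ⟨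
  cnt l (drop k (P′ ++ f ∷ Q′))         ≤⟨ at (Dom⇒Cn (Dom-drop k d)) l ⟩
  cnt l (drop k (P ++ e ∷ Q))           ≤⟨ left k (k ℕ.≤? length P) ⟩
  1 + cnt l (drop k (P ++ Q))           ∎
  where
  open ≤-Reasoning
  left : ∀ k → Dec (k ≤ length P) → cnt l (drop k (P ++ e ∷ Q)) ≤ 1 + cnt l (drop k (P ++ Q))
  left k (yes h) = ≤-trans (≡⇒≤ (cnt-drop-insert l k P e Q h)) (𝟙≤1 (l ℤ.≤? e) ⊕ ≤-refl)
  left zero (no h) = contradiction z≤n h
  left (suc k) (no h) = ≤-trans (≡⇒≤ (cong (cnt l) (drop-insert k P e Q (≤-pred (≰⇒> h)))))
    (cnt-drop-≤ l k (P ++ Q))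

-- The count lost by the deletion is absorbed by `Cn-dec`, so the underlying `σ` are comparable
-- wherever the extreme entries stand.
Dom-σ-delete : ∀ A A′ B B′ {e f} → length (A ++ A′) ≡ length (B ++ B′) →
  Dom (enc A ++ e ∷ enc A′) (enc B ++ f ∷ enc B′) → Dom (σ (A ++ A′)) (σ (B ++ B′))
Dom-σ-delete A A′ B B′ len d =
  fromDrops (A ++ A′) (B ++ B′) len (λ k l → subst₂ (λ u v → cnt l (drop k v) ≤ 1 + cnt l (drop k u))
    (sym (enc-++ A A′)) (sym (enc-++ B B′)) (cnt-delete {enc A} {P′ = enc B} d k l))
  where
  fromDrops : ∀ C D → length C ≡ length D → (∀ k l → cnt l (drop k (enc D)) ≤ 1 + cnt l (drop k (enc C))) →
      Dom (σ C) (σ D)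
  fromDrops [] [] _ _ = []
  fromDrops (c ∷ C) (d ∷ D) e h =
    Cn-dec {c ∷ C} {d ∷ D} (h 0) ∷ fromDrops C D (suc-injective e) (λ k → h (suc (suc k)))

Bounded : ℕ → List ℤ → Set
Bounded N = All (λ x → ∣ x ∣ ≤ N)

bounded-< : ∀ {N x} → ∣ x ∣ ≤ N → x ℤ.< + suc N
bounded-< {x = + k} h = ℤ.+<+ (s≤s h)
bounded-< {x = -[1+ k ]} h = ℤ.-<+

bounded-> : ∀ {N x} → ∣ x ∣ ≤ N → -[1+ N ] ℤ.< x
bounded-> {x = + k} h = ℤ.-<+
bounded-> {x = -[1+ k ]} h = ℤ.-<- h

cnt-none : ∀ {l w} → All (ℤ._< l) w → cnt l w ≡ 0
cnt-none {l} {w} h = trans (sumOf-const 0 (All.map (λ x<l → le-false (ℤₚ.<⇒≱ x<l)) h)) (*-zeroʳ (length w))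

cnt-all : ∀ {l w} → All (l ℤ.≤_) w → cnt l w ≡ length w
cnt-all {l} {w} h = trans (sumOf-const 1 (All.map le-true h)) (*-identityʳ (length w))

-- Outside this range of thresholds all entries count or none does. Inside it `- (N + 1)` never
-- counts and `N + 1` always does, which is what makes the extreme entry tractable.
Cn-bounded : ∀ {N u v} → length u ≡ length v → Bounded (suc N) u → Bounded (suc N) v →
  (∀ l → -[1+ N ] ℤ.< l → l ℤ.≤ + suc N → cnt l v ≤ cnt l u) → Cn u v
Cn-bounded {N} {u} {v} e bu bv h = cn go
  where
  go : ∀ l → cnt l v ≤ cnt l u
  go l with -[1+ N ] ℤ.<? l | l ℤ.≤? + suc N
  ... | yes p | yes q = h l p q
  ... | yes _ | no q = ≤-trans (≡⇒≤ (cnt-none (All.map (λ {x} b → ℤₚ.≤-<-trans (upper x b) (ℤₚ.≰⇒> q)) bv))) z≤n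
    where
    upper : ∀ x → ∣ x ∣ ≤ suc N → x ℤ.≤ + suc N
    upper (+ _) b = ℤ.+≤+ b
    upper -[1+ _ ] _ = ℤ.-≤+
  ... | no p | _ = ≡⇒≤ (trans (cnt-all (All.map (λ {x} → lower x) bv))
      (trans (sym e) (sym (cnt-all (All.map (λ {x} → lower x) bu)))))
    where
    lower : ∀ x → ∣ x ∣ ≤ suc N → l ℤ.≤ x
    lower (+ _) _ = ℤₚ.≤-trans (ℤₚ.≮⇒≥ p) ℤ.-≤+
    lower -[1+ _ ] (s≤s b) = ℤₚ.≤-trans (ℤₚ.≮⇒≥ p) (ℤ.-≤- b)

module _ {N : ℕ} where

  -- The threshold `suc N` counts the extreme entry and nothing else.
  largest-position : ∀ {P Q P′ Q′} → Bounded N (P ++ Q) →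
    Dom (P ++ + suc N ∷ Q) (P′ ++ + suc N ∷ Q′) → length P′ ≤ length P
  largest-position {P} {Q} {P′} {Q′} b d with length P′ ℕ.≤? length P
  ... | yes h = h
  ... | no h = contradiction (at (Dom⇒Cn (Dom-drop (suc (length P)) d)) n) (<⇒≱ (begin-strict
      cnt n (drop (suc (length P)) (P ++ n ∷ Q))              ≡⟨ cong (cnt n)
        (drop-insert (length P) P n Q ≤-refl) ⟩
      cnt n (drop (length P) (P ++ Q))                        ≡⟨ cnt-none
        (Allₚ.drop⁺ (length P) (All.map bounded-< b)) ⟩
      0                                                       <⟨ s≤s z≤n ⟩
      1                                                       ≡⟨ le-true (ℤₚ.≤-refl {n}) ⟨
      le n n                                                  ≤⟨ m≤m+n _ _ ⟩
      le n n + cnt n (drop (suc (length P)) (P′ ++ Q′))       ≡⟨ cnt-drop-insert n (suc (length P)) P′ n Q′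
        (≰⇒> h) ⟨
      cnt n (drop (suc (length P)) (P′ ++ n ∷ Q′))            ∎))
    where
    open ≤-Reasoning
    n = + suc N

  smallest-position : ∀ {P Q P′ Q′} → Bounded N (P′ ++ Q′) →
    Dom (P ++ -[1+ N ] ∷ Q) (P′ ++ -[1+ N ] ∷ Q′) → length P ≤ length P′
  smallest-position {P} {Q} {P′} {Q′} b d = subst₂ _≤_ (length-map -_ P) (length-map -_ P′)
    (largest-position {map -_ P′} {map -_ Q′} {map -_ P} {map -_ Q}
      (subst (Bounded N) (map-++ -_ P′ Q′) (Allₚ.map⁺ (All.map (λ {x} → subst (_≤ N) (sym (ℤₚ.∣-i∣≡∣i∣ x))) b)))
      (subst₂ Dom (map-++ -_ P′ _) (map-++ -_ P _) (Dom-neg d)))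

  no-sign-return : ∀ {P Q P′ Q′} → Bounded N (P ++ Q) → ¬ Dom (P ++ -[1+ N ] ∷ Q) (P′ ++ + suc N ∷ Q′)
  no-sign-return {P} {Q} {P′} {Q′} b d = contradiction (at (Dom⇒Cn d) n) (<⇒≱ (begin-strict
      cnt n (P ++ -[1+ N ] ∷ Q)      ≡⟨ sumOf-insert (le n) P -[1+ N ] Q ⟩
      cnt n (P ++ Q)                 ≡⟨ cnt-none (All.map bounded-< b) ⟩
      0                              <⟨ s≤s z≤n ⟩
      1                              ≡⟨ le-true (ℤₚ.≤-refl {n}) ⟨
      le n n                         ≤⟨ m≤m+n _ _ ⟩
      le n n + cnt n (P′ ++ Q′)      ≡⟨ sumOf-insert (le n) P′ n Q′ ⟨
      cnt n (P′ ++ n ∷ Q′)           ∎))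
    where
    open ≤-Reasoning
    n = + suc N

enc-bounded : ∀ {m A} → All (λ a → ∣ proj₁ a ∣ ≤ m) A → Bounded (m + m) (enc A)
enc-bounded [] = []
enc-bounded {m} {(s , b) ∷ A} (h ∷ hs) = first b ∷ second b ∷ enc-bounded hs
  where
  bound-hi : ∀ s → ∣ s ∣ ≤ m → ∣ hi s ∣ ≤ m + m
  bound-hi (+ zero) _ = z≤n
  bound-hi (+ suc k) h = double-mono-< h
  bound-hi -[1+ k ] h = <⇒≤ (double-mono-< h)
  bound-lo : ∀ s → ∣ s ∣ ≤ m → ∣ lo s ∣ ≤ m + m
  bound-lo s h = subst (_≤ m + m) (trans (cong ∣_∣ (sym (neg-lo s))) (ℤₚ.∣-i∣≡∣i∣ (lo s)))
    (bound-hi (- s) (subst (_≤ m) (sym (ℤₚ.∣-i∣≡∣i∣ s)) h))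
  first : ∀ b → ∣ e₁ (s , b) ∣ ≤ m + m
  first false = bound-lo s h
  first true = bound-hi s h
  second : ∀ b → ∣ e₂ (s , b) ∣ ≤ m + m
  second false = bound-hi s h
  second true = bound-lo s h

IsB⇒Bounded : ∀ {m A} → IsB m (σ A) → Bounded (m + m) (enc A)
IsB⇒Bounded (_ , bounds , _) = enc-bounded (Allₚ.map⁻ (All.map proj₂ bounds))

-- The entry ±(2m+1) of a signed Wachs permutation in the odd case.
ent : ℕ → Bool → ℤ
ent m true = + suc (m + m)
ent m false = -[1+ m + m ]

ins : ℕ → List Code → Bool → List Code → List ℤ
ins m A ε A′ = enc A ++ ent m ε ∷ enc A′

-- What the entry ±(2m+1) adds to ℓ_B.
posrk : Bool → List Code → List Code → ℕ
posrk true A A′ = 2 * length A′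
posrk false A A′ = 4 * length A + 2 * length A′ + 1

rkO : Bool → List Code → List Code → ℕ
rkO ε A A′ = rk (A ++ A′) + posrk ε A A′

OddStep : ℕ → Bool → List Code → List Code → List ℤ → Set
OddStep m ε A A′ y = ∃ λ Z → ∃ λ ζ → ∃ λ Z′ → IsB m (σ (Z ++ Z′)) ×
  Dom (ins m A ε A′) (ins m Z ζ Z′) × Dom (ins m Z ζ Z′) y × rkO ζ Z Z′ ≡ 1 + rkO ε A A′

ins-snoc : ∀ m A a ε A′ → ins m (A ++ a ∷ []) ε A′ ≡ enc A ++ e₁ a ∷ e₂ a ∷ ent m ε ∷ enc A′
ins-snoc m A a ε A′ = trans (cong (_++ ent m ε ∷ enc A′) (enc-++ A (a ∷ []))) (++-assoc (enc A) _ _)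

drop-length-++ : ∀ {A : Set} j (P : List A) w → drop (j + length P) (P ++ w) ≡ drop j w
drop-length-++ j [] w = cong (λ i → drop i w) (+-identityʳ j)
drop-length-++ j (p ∷ P) w = trans (cong (λ i → drop i (p ∷ P ++ w)) (+-suc j (length P)))
    (drop-length-++ j P w)

Dom-split : ∀ P {u y} → Dom (P ++ u) y → ∃ λ Y → ∃ λ v → y ≡ Y ++ v × length P ≡ length Y × Dom u v
Dom-split [] d = [] , _ , refl , refl , d
Dom-split (p ∷ P) (_∷_ {y = y} _ d) with Dom-split P d
... | Y , v , refl , e , d′ = y ∷ Y , v , refl , cong suc e , d′

nonempty-snoc : ∀ {A : Set} (xs : List A) → 0 < length xs → ∃ λ ys → ∃ λ y → xs ≡ ys ++ y ∷ []
nonempty-snoc (x ∷ []) _ = [] , x , refl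
nonempty-snoc (x ∷ x′ ∷ xs) _ with nonempty-snoc (x′ ∷ xs) (s≤s z≤n)
... | ys , y , e = x ∷ ys , y , cong (x ∷_) e

module _ {m : ℕ} where

  private
    n -n : ℤ
    n = ent m true
    -n = ent m false

  le-n : ∀ {l} → l ℤ.≤ n → le l n ≡ 1
  le-n = le-true

  le--n : ∀ {l} → -n ℤ.< l → le l -n ≡ 0
  le--n h = le-false (ℤₚ.<⇒≱ h)

  ∣ent∣ : ∀ ε → ∣ ent m ε ∣ ≡ suc (m + m)
  ∣ent∣ true = refl
  ∣ent∣ false = refl

  bounded-suc : ∀ {w} → Bounded (m + m) w → Bounded (suc (m + m)) w
  bounded-suc = All.map m≤n⇒m≤1+n

  ins-bounded : ∀ A ε A′ → IsB m (σ (A ++ A′)) → Bounded (suc (m + m)) (ins m A ε A′)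
  ins-bounded A ε A′ b with Allₚ.++⁻ (enc A) (subst (Bounded (m + m)) (enc-++ A A′)
    (IsB⇒Bounded {m} {A ++ A′} b))
  ... | bA , bA′ = Allₚ.++⁺ (bounded-suc bA) (≡⇒≤ (∣ent∣ ε) ∷ bounded-suc bA′)

  split-codes : ∀ A₀ (a : Code) A′ D → IsB m (σ (A₀ ++ a ∷ A′)) → IsB m (σ D) →
    ∃ λ D₀ → ∃ λ δ → ∃ λ D′ → D ≡ D₀ ++ δ ∷ D′ × length A₀ ≡ length D₀
  split-codes A₀ a A′ D bC bD with splitLike A₀ a A′ D
    (trans (sym (length-map proj₁ (A₀ ++ a ∷ A′)))
      (trans (proj₁ bC) (trans (sym (proj₁ bD)) (length-map proj₁ D))))
  ... | D₀ , δ , D′ , e , h , _ = D₀ , δ , D′ , e , h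

  -- At thresholds above `-n` the entry `-n` is invisible, and `n` is assumed to stand before the
  -- suffix. Dropping one entry more than in the code makes up for an inserted entry further left;
  -- if `-n` is still to come, it only loses counts.
  suffix-lower : ∀ B ε B′ D₀ {R} k j l → -n ℤ.< l → B ++ B′ ≡ D₀ ++ R → k ≡ length (enc D₀) →
    ε ≡ false ⊎ length (enc B) ≤ j + k →
    cnt l (drop (suc (j + k)) (ins m B ε B′)) ≤ cnt l (drop j (enc R))
  suffix-lower B ε B′ D₀ {R} k j l -n<l eq refl h = ≤-trans (go (length (enc B) ℕ.≤? j + k) h)
    (≡⇒≤ (cong (cnt l) (trans (cong (drop (j + k))
      (trans (sym (enc-++ B B′)) (trans (cong enc eq) (enc-++ D₀ R)))) (drop-length-++ j (enc D₀) (enc R)))))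
    where
    go : Dec (length (enc B) ≤ j + k) → ε ≡ false ⊎ length (enc B) ≤ j + k →
      cnt l (drop (suc (j + k)) (ins m B ε B′)) ≤ cnt l (drop (j + k) (enc B ++ enc B′))
    go (yes p) _ = ≡⇒≤ (cong (cnt l) (drop-insert (j + k) (enc B) (ent m ε) (enc B′) p))
    go (no p) (inj₂ q) = contradiction q p
    go (no p) (inj₁ refl) = ≤-trans
      (≡⇒≤ (trans (cnt-drop-insert l (suc (j + k)) (enc B) -n (enc B′) (≰⇒> p))
        (cong (_+ cnt l (drop (suc (j + k)) (enc B ++ enc B′))) (le--n -n<l))))
      (cnt-drop-suc l (j + k) (enc B ++ enc B′))

  suffix-equal : ∀ B B′ D₀ {R} k j l → -n ℤ.< l → B ++ B′ ≡ D₀ ++ R → k ≡ length (enc D₀) →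
    j + k ≤ length (enc B) → cnt l (drop (j + k) (ins m B false B′)) ≡ cnt l (drop j (enc R))
  suffix-equal B B′ D₀ {R} k j l -n<l eq refl h =
    trans (cnt-drop-insert l (j + k) (enc B) -n (enc B′) h)
      (trans (cong (_+ cnt l (drop (j + k) (enc B ++ enc B′))) (le--n -n<l))
        (cong (cnt l) (trans (cong (drop (j + k)) (trans (sym (enc-++ B B′))
          (trans (cong enc eq) (enc-++ D₀ R)))) (drop-length-++ j (enc D₀) (enc R)))))

  block-bounded : ∀ A₀ a A′ → IsB m (σ (A₀ ++ a ∷ A′)) → Bounded (suc (m + m)) (enc (a ∷ A′))
  block-bounded A₀ a A′ bC =
    bounded-suc (Allₚ.++⁻ʳ (enc A₀) (subst (Bounded (m + m)) (enc-++ A₀ _) (IsB⇒Bounded {m} {A₀ ++ a ∷ A′} bC)))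

  block-nonzero : ∀ A₀ s b A′ → IsB m (σ (A₀ ++ (s , b) ∷ A′)) → s ≢ 0ℤ
  block-nonzero A₀ s b A′ bC = All.head (Allₚ.++⁻ʳ A₀ (IsB⇒Nonzero {A = A₀ ++ (s , b) ∷ A′} bC))

  equal-lengths : ∀ {C D} → IsB m (σ C) → IsB m (σ D) → length C ≡ length D
  equal-lengths {C} {D} bC bD = trans (sym (length-map proj₁ C))
      (trans (proj₁ bC) (trans (sym (proj₁ bD)) (length-map proj₁ D)))

  -- The target `y` is cut where the block `(s , b)` and the following entry `n` stand:
  -- `y₀ , y₁ , y₂` face these three entries, and `(t , c)` is the block at this place in the code
  -- of the target. The fields `lower₁` and `lower₂` trade counts of `y` for counts of that code,
  -- from which the extreme entry is gone.
  record PlusContext (A₀ : List Code) (s : ℤ) (b : Bool) (A′ : List Code) (y : List ℤ) : Set where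
    field
      {Y} : List ℤ
      {y₀ y₁ y₂} : ℤ
      {Y′} : List ℤ
      {t} : ℤ
      {c} : Bool
      {D′} : List Code
      eqY : y ≡ Y ++ y₀ ∷ y₁ ∷ y₂ ∷ Y′
      lenY : length (enc A₀) ≡ length Y
      head₀ : Cn (e₁ (s , b) ∷ e₂ (s , b) ∷ n ∷ enc A′) (y₀ ∷ y₁ ∷ y₂ ∷ Y′)
      head₂ : Cn (n ∷ enc A′) (y₂ ∷ Y′)
      rest : Dom (enc A′) Y′
      whole : Dom (enc A₀ ++ e₁ (s , b) ∷ e₂ (s , b) ∷ n ∷ enc A′) (Y ++ y₀ ∷ y₁ ∷ y₂ ∷ Y′)
      by : Bounded (suc (m + m)) (y₁ ∷ y₂ ∷ Y′)
      lower₁ : ∀ l → -n ℤ.< l → cnt l (y₁ ∷ y₂ ∷ Y′) ≤ cnt l (enc ((t , c) ∷ D′))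
      lower₂ : ∀ l → -n ℤ.< l → cnt l (y₂ ∷ Y′) ≤ cnt l (e₂ (t , c) ∷ enc D′)
      σ₀ : Cn (s ∷ σ A′) (t ∷ σ D′)
      σ₁′ : Cn (σ A′) (σ D′)

  plusContext : ∀ A₀ {s} b A′ B ε′ B′ → IsB m (σ (A₀ ++ (s , b) ∷ A′)) → IsB m (σ (B ++ B′)) →
    ε′ ≡ false ⊎ length (enc B) ≤ length (enc A₀) →
    Dom (ins m (A₀ ++ (s , b) ∷ []) true A′) (ins m B ε′ B′) → PlusContext A₀ s b A′ (ins m B ε′ B′)
  plusContext A₀ {s} b A′ B ε′ B′ bC bD pos d with split-codes A₀ (s , b) A′ (B ++ B′) bC bD
  ... | D₀ , (t , c) , D′ , eqD , lenD
    with Dom-split (enc A₀) (subst (λ x → Dom x (ins m B ε′ B′)) (ins-snoc m A₀ (s , b) true A′) d)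
       | Dom-σ-suffix A₀ D₀ {(s , b) ∷ A′} {(t , c) ∷ D′} lenD
           (subst₂ (λ C D → Dom (σ C) (σ D)) (++-assoc A₀ _ A′) eqD
             (Dom-σ-delete (A₀ ++ (s , b) ∷ []) A′ B B′
               (trans (cong length (++-assoc A₀ _ A′)) (equal-lengths {A₀ ++ (s , b) ∷ A′} {B ++ B′} bC bD)) d))
  ... | Y , (y₀ ∷ y₁ ∷ y₂ ∷ Y′) , eqY , lenY , (c₀ ∷ (_ ∷ (c₂ ∷ d₃))) | cσ ∷ dσ = record
    { eqY = eqY ; lenY = lenY ; head₀ = c₀ ; head₂ = c₂ ; rest = d₃
    ; whole = subst₂ Dom (ins-snoc m A₀ _ true A′) eqY d
    ; by = All.tail (Allₚ.++⁻ʳ Y (subst (Bounded (suc (m + m))) eqY (ins-bounded B ε′ B′ bD)))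
    ; lower₁ = λ l h → subst (λ w → cnt l w ≤ cnt l (enc ((t , c) ∷ D′))) (suffix 0)
        (suffix-lower B ε′ B′ D₀ (length (enc A₀)) 0 l h eqD lenE pos)
    ; lower₂ = λ l h → subst (λ w → cnt l w ≤ cnt l (e₂ (t , c) ∷ enc D′)) (suffix 1)
        (suffix-lower B ε′ B′ D₀ (length (enc A₀)) 1 l h eqD lenE (Sum.map₂ m≤n⇒m≤1+n pos))
    ; t = t ; c = c ; D′ = D′ ; σ₀ = cσ ; σ₁′ = Dom⇒Cn dσ }
    where
    lenE : length (enc A₀) ≡ length (enc D₀)
    lenE = length-enc-≡ {A₀} {D₀} lenD
    suffix : ∀ j → drop (suc (j + length (enc A₀))) (ins m B ε′ B′) ≡ drop (suc j) (y₀ ∷ y₁ ∷ y₂ ∷ Y′)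
    suffix j = trans (cong₂ drop (cong (λ k → suc (j + k)) lenY) eqY) (drop-length-++ (suc j) Y _)

  -- +(2m+1) moves left past a block whose bit is set, clearing it; a clear bit is set first.
  odd-plus : ∀ A₀ {s} b A′ {y} → IsB m (σ (A₀ ++ (s , b) ∷ A′)) → PlusContext A₀ s b A′ y →
    OddStep m true (A₀ ++ (s , b) ∷ []) A′ y
  odd-plus A₀ {s} false A′ bC ctx = A₀ ++ (s , true) ∷ [] , true , A′ ,
    subst (IsB m ∘ σ) (sym (++-assoc A₀ _ A′)) (subst (IsB m) (σ-setBit A₀ s A′ false true) bC) ,
    subst₂ Dom (sym (ins-snoc m A₀ _ true A′)) (sym (ins-snoc m A₀ _ true A′))
      (raise⇒Dom (swap (enc A₀) [] (n ∷ enc A′) (lo<hi (block-nonzero A₀ s false A′ bC)))) ,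
    subst₂ Dom (sym (ins-snoc m A₀ _ true A′)) (sym eqY)
      (Dom-prefix-cong (enc A₀) Y lenY swapped
        (Cn-trans (cn λ l → ≡⇒≤ (swapped l)) head₀ ∷
         (Cn-bounded (cong (suc ∘ suc) (Dom⇒length rest)) (bounds (block-bounded A₀ _ A′ bC)) by new₁ ∷
           (head₂ ∷ rest)))
        whole) ,
    cong (_+ 2 * length A′) rank
    where
    open PlusContext ctx
    swapped : ∀ l → cnt l (lo s ∷ hi s ∷ n ∷ enc A′) ≡ cnt l (hi s ∷ lo s ∷ n ∷ enc A′)
    swapped l = cnt-swap l [] (hi s) [] (lo s) (n ∷ enc A′)
    bounds : Bounded (suc (m + m)) (lo s ∷ hi s ∷ enc A′) → Bounded (suc (m + m)) (lo s ∷ n ∷ enc A′)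
    bounds (p ∷ _ ∷ ps) = p ∷ ≤-refl ∷ ps
    -- In the middle of the block `n` counts at every threshold in range and so makes up for the
    -- missing `hi s`: a clear bit beside `n` can always be set.
    new₁ : ∀ l → -n ℤ.< l → l ℤ.≤ n → cnt l (y₁ ∷ y₂ ∷ Y′) ≤ cnt l (lo s ∷ n ∷ enc A′)
    new₁ l p q = ≤-trans (lower₁ l p) (≤-trans (at (Cn-enc {(s , false) ∷ A′} {(t , c) ∷ D′} σ₀) l)
      (+-monoʳ-≤ (le l (lo s)) (≤-trans (𝟙≤1 (l ℤ.≤? hi s)) (≡⇒≥ (le-n q)) ⊕ ≤-refl)))
    rank : rk ((A₀ ++ (s , true) ∷ []) ++ A′) ≡ 1 + rk ((A₀ ++ (s , false) ∷ []) ++ A′)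
    rank = trans (cong rk (++-assoc A₀ _ A′)) (trans (rk-setBit A₀ s A′)
        (cong (suc ∘ rk) (sym (++-assoc A₀ _ A′))))
  odd-plus A₀ {s} true A′ bC ctx = A₀ , true , (s , false) ∷ A′ ,
    subst (IsB m) (σ-setBit A₀ s A′ true false) bC ,
    subst (λ x → Dom x (ins m A₀ true ((s , false) ∷ A′))) (sym (ins-snoc m A₀ _ true A′))
      -- A single transposition, of `hi s` and `n` across `lo s`, carries `n` past the block and
      -- clears its bit.
      (raise⇒Dom (swap (enc A₀) (lo s ∷ []) (enc A′) hi<n)) ,
    subst (Dom (ins m A₀ true ((s , false) ∷ A′))) (sym eqY)
      (Dom-prefix-cong (enc A₀) Y lenY swapped
        (Cn-trans (cn λ l → ≡⇒≤ (swapped l)) head₀ ∷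
         (Cn-bounded (cong (suc ∘ suc) (Dom⇒length rest)) (bounds (block-bounded A₀ _ A′ bC)) by new₁ ∷
          (Cn-bounded (cong suc (Dom⇒length rest)) (All.tail (bounds (block-bounded A₀ _ A′ bC)))
            (All.tail by) new₂ ∷ rest)))
        whole) ,
    rank
    where
    open PlusContext ctx
    hi<n : hi s ℤ.< n
    hi<n = bounded-< (All.head (Allₚ.++⁻ʳ (enc A₀)
        (subst (Bounded (m + m)) (enc-++ A₀ _) (IsB⇒Bounded {m} {A₀ ++ (s , true) ∷ A′} bC))))
    swapped : ∀ l → cnt l (hi s ∷ lo s ∷ n ∷ enc A′) ≡ cnt l (n ∷ lo s ∷ hi s ∷ enc A′)
    swapped l = cnt-swap l [] n (lo s ∷ []) (hi s) (enc A′)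
    bounds : Bounded (suc (m + m)) (hi s ∷ lo s ∷ enc A′) → Bounded (suc (m + m)) (lo s ∷ hi s ∷ enc A′)
    bounds (p ∷ p′ ∷ ps) = p′ ∷ p ∷ ps
    new₁ : ∀ l → -n ℤ.< l → l ℤ.≤ n → cnt l (y₁ ∷ y₂ ∷ Y′) ≤ cnt l (lo s ∷ hi s ∷ enc A′)
    new₁ l p _ = ≤-trans (lower₁ l p) (at (Cn-enc {(s , false) ∷ A′} {(t , c) ∷ D′} σ₀) l)
    new₂ : ∀ l → -n ℤ.< l → l ℤ.≤ n → cnt l (y₂ ∷ Y′) ≤ cnt l (hi s ∷ enc A′)
    new₂ l p _ = ≤-trans (lower₂ l p) (at (Cn-mid {s} {false} {t} {c} {A′} {D′} σ₀ σ₁′ (λ ())) l)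
    -- Two inversions of `n` with the block passed, less the cleared bit.
    rank : rk (A₀ ++ (s , false) ∷ A′) + 2 * suc (length A′) ≡ 1 +
        (rk ((A₀ ++ (s , true) ∷ []) ++ A′) + 2 * length A′)
    rank rewrite ++-assoc A₀ ((s , true) ∷ []) A′ | rk-setBit A₀ s A′ = arith (rk (A₀ ++ (s , false) ∷ A′))
        (length A′)
      where
      arith : ∀ r k → r + 2 * suc k ≡ 1 + (1 + r + 2 * k)
      arith = solve-∀

  -- Among the suffixes only the whole window changes. There `-n` is invisible on both sides at the
  -- thresholds in range, and the comparison becomes that of the codes.
  odd-turn : ∀ A′ B B′ → IsB m (σ A′) → IsB m (σ (B ++ B′)) → Dom (ins m [] true A′) (ins m B false B′) →
    OddStep m true [] A′ (ins m B false B′)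
  odd-turn A′ B B′ bC bD d = [] , false , A′ , bC , raise⇒Dom (flip₁ [] (enc A′) ℤ.-<+) , lowered d , rank
    where
    rank : rk A′ + (4 * 0 + 2 * length A′ + 1) ≡ 1 + (rk A′ + 2 * length A′)
    rank = arith (rk A′) (length A′)
      where
      arith : ∀ r k → r + (0 + 2 * k + 1) ≡ 1 + (r + 2 * k)
      arith = solve-∀
    cσ : Cn (σ A′) (σ (B ++ B′))
    cσ = Dom⇒Cn (Dom-σ-delete [] A′ B B′ (equal-lengths {A′} {B ++ B′} bC bD) d)
    counts : ∀ l → -n ℤ.< l → l ℤ.≤ n → cnt l (ins m B false B′) ≤ cnt l (-n ∷ enc A′)
    counts l p _ = ≤-trans (≡⇒≤ (suffix-equal B B′ [] 0 0 l p refl refl z≤n))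
      (≤-trans (at (Cn-enc {A′} {B ++ B′} cσ) l) (m≤n+m _ (le l -n)))
    lowered : Dom (n ∷ enc A′) (ins m B false B′) → Dom (-n ∷ enc A′) (ins m B false B′)
    lowered d = go _ refl d
      where
      go : ∀ w → w ≡ ins m B false B′ → Dom (n ∷ enc A′) w → Dom (-n ∷ enc A′) (ins m B false B′)
      go (w₀ ∷ w) eq (_ ∷ d′) = subst (Dom (-n ∷ enc A′)) eq
        (subst (Cn (-n ∷ enc A′)) (sym eq) (Cn-bounded (trans (cong suc (Dom⇒length d′)) (cong length eq))
          (ins-bounded [] false A′ bC) (ins-bounded B false B′ bD) counts) ∷ d′)

  -- The counterpart of `PlusContext` with `-n` in front of its block. The entry `-n` of the target
  -- stands beyond the block, so it belongs to the suffixes concerned and is invisible in them; the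
  -- bounds become equalities, and `y₁` faces `e₁ (s , b)` where the code of the target has its
  -- `e₂`.
  record MinusContext (A : List Code) (s : ℤ) (b : Bool) (A′ : List Code) (y : List ℤ) : Set where
    field
      {Y} : List ℤ
      {y₀ y₁ y₂} : ℤ
      {Y′} : List ℤ
      {t} : ℤ
      {c} : Bool
      {D′} : List Code
      eqY : y ≡ Y ++ y₀ ∷ y₁ ∷ y₂ ∷ Y′
      lenY : length (enc A) ≡ length Y
      head₀ : Cn (-n ∷ e₁ (s , b) ∷ e₂ (s , b) ∷ enc A′) (y₀ ∷ y₁ ∷ y₂ ∷ Y′)
      head₁ : Cn (e₁ (s , b) ∷ e₂ (s , b) ∷ enc A′) (y₁ ∷ y₂ ∷ Y′)
      rest : Dom (enc A′) Y′
      whole : Dom (enc A ++ -n ∷ e₁ (s , b) ∷ e₂ (s , b) ∷ enc A′) (Y ++ y₀ ∷ y₁ ∷ y₂ ∷ Y′)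
      by : Bounded (suc (m + m)) (y₁ ∷ y₂ ∷ Y′)
      lower₁ : ∀ l → -n ℤ.< l → cnt l (y₁ ∷ y₂ ∷ Y′) ≡ cnt l (e₂ (t , c) ∷ enc D′)
      lower₂ : ∀ l → -n ℤ.< l → cnt l (y₂ ∷ Y′) ≡ cnt l (enc D′)
      σ₀ : Cn (s ∷ σ A′) (t ∷ σ D′)
      σ₁′ : Cn (σ A′) (σ D′)

  minusContext : ∀ A {s} b A′ B B′ → IsB m (σ (A ++ (s , b) ∷ A′)) → IsB m (σ (B ++ B′)) →
    2 + length (enc A) ≤ length (enc B) →
    Dom (ins m A false ((s , b) ∷ A′)) (ins m B false B′) → MinusContext A s b A′ (ins m B false B′)
  minusContext A {s} b A′ B B′ bC bD pos d with split-codes A (s , b) A′ (B ++ B′) bC bD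
  ... | D₀ , (t , c) , D′ , eqD , lenD
    with Dom-split (enc A) d
       | Dom-σ-suffix A D₀ {(s , b) ∷ A′} {(t , c) ∷ D′} lenD
           (subst (λ D → Dom (σ (A ++ (s , b) ∷ A′)) (σ D)) eqD
             (Dom-σ-delete A ((s , b) ∷ A′) B B′ (equal-lengths {A ++ (s , b) ∷ A′} {B ++ B′} bC bD) d))
  ... | Y , (y₀ ∷ y₁ ∷ y₂ ∷ Y′) , eqY , lenY , (c₀ ∷ (c₁ ∷ (_ ∷ d₃))) | cσ ∷ dσ = record
    { eqY = eqY ; lenY = lenY ; head₀ = c₀ ; head₁ = c₁ ; rest = d₃
    ; whole = subst (Dom _) eqY d
    ; by = All.tail (Allₚ.++⁻ʳ Y (subst (Bounded (suc (m + m))) eqY (ins-bounded B false B′ bD)))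
    ; lower₁ = λ l h → trans (cong (cnt l) (sym (suffix 1)))
        (suffix-equal B B′ D₀ (length (enc A)) 1 l h eqD lenE (<⇒≤ pos))
    ; lower₂ = λ l h → trans (cong (cnt l) (sym (suffix 2)))
        (suffix-equal B B′ D₀ (length (enc A)) 2 l h eqD lenE pos)
    ; t = t ; c = c ; D′ = D′ ; σ₀ = cσ ; σ₁′ = Dom⇒Cn dσ }
    where
    lenE : length (enc A) ≡ length (enc D₀)
    lenE = length-enc-≡ {A} {D₀} lenD
    suffix : ∀ j → drop (j + length (enc A)) (ins m B false B′) ≡ drop j (y₀ ∷ y₁ ∷ y₂ ∷ Y′)
    suffix j = trans (cong₂ drop (cong (λ k → j + k) lenY) eqY) (drop-length-++ j Y _)

  -- Going up, `-n` moves right past a block whose bit is set. A clear bit can always be set first: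
  -- behind the middle of the block the target has, apart from `-n`, only the entries of whole later
  -- blocks.
  odd-minus : ∀ A {s} b A′ {y} → IsB m (σ (A ++ (s , b) ∷ A′)) → MinusContext A s b A′ y →
    OddStep m false A ((s , b) ∷ A′) y
  odd-minus A {s} false A′ bC ctx = A , false , (s , true) ∷ A′ ,
    subst (IsB m) (σ-setBit A s A′ false true) bC ,
    Dom-++ (enc A) (Dom-∷ ℤₚ.≤-refl (raise⇒Dom (swap [] [] (enc A′) (lo<hi (block-nonzero A s false A′ bC))))) ,
    subst (Dom (ins m A false ((s , true) ∷ A′))) (sym eqY)
      (Dom-prefix-cong (enc A) Y lenY (λ l → cong (le l -n ℕ.+_) (swapped l))
        (Cn-trans (cn λ l → ≡⇒≤ (cong (le l -n ℕ.+_) (swapped l))) head₀ ∷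
         (Cn-trans (cn λ l → ≡⇒≤ (swapped l)) head₁ ∷
          (Cn-bounded (cong suc (Dom⇒length rest)) (bounds (block-bounded A _ A′ bC)) (All.tail by) new₂ ∷
            rest)))
        whole) ,
    cong (_+ (4 * length A + 2 * suc (length A′) + 1)) (rk-setBit A s A′)
    where
    open MinusContext ctx
    swapped : ∀ l → cnt l (lo s ∷ hi s ∷ enc A′) ≡ cnt l (hi s ∷ lo s ∷ enc A′)
    swapped l = cnt-swap l [] (hi s) [] (lo s) (enc A′)
    bounds : Bounded (suc (m + m)) (lo s ∷ hi s ∷ enc A′) → Bounded (suc (m + m)) (lo s ∷ enc A′)
    bounds (p ∷ _ ∷ ps) = p ∷ ps
    new₂ : ∀ l → -n ℤ.< l → l ℤ.≤ n → cnt l (y₂ ∷ Y′) ≤ cnt l (lo s ∷ enc A′)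
    new₂ l p _ = ≤-trans (≡⇒≤ (lower₂ l p)) (≤-trans (at (Cn-enc {A′} {D′} σ₁′) l) (m≤n+m _ (le l (lo s))))
  odd-minus A {s} true A′ {y} bC ctx = A ++ (s , false) ∷ [] , false , A′ ,
    subst (IsB m ∘ σ) (sym (++-assoc A _ A′)) (subst (IsB m) (σ-setBit A s A′ true false) bC) ,
    subst (Dom (ins m A false ((s , true) ∷ A′))) (sym (ins-snoc m A _ false A′))
      (raise⇒Dom (swap (enc A) (hi s ∷ []) (enc A′) -n<lo)) ,
    subst₂ Dom (sym (ins-snoc m A _ false A′)) (sym eqY)
      (Dom-prefix-cong (enc A) Y lenY swapped
        (Cn-trans (cn λ l → ≡⇒≤ (swapped l)) head₀ ∷
         (Cn-bounded (cong (suc ∘ suc) (Dom⇒length rest)) (bounds (block-bounded A _ A′ bC)) by new₁ ∷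
          (Cn-bounded (cong suc (Dom⇒length rest)) (All.tail (bounds (block-bounded A _ A′ bC)))
            (All.tail by) new₂ ∷ rest)))
        whole) ,
    rank
    where
    open MinusContext ctx
    -n<lo : -n ℤ.< lo s
    -n<lo = bounded-> (All.head (All.tail (Allₚ.++⁻ʳ (enc A)
        (subst (Bounded (m + m)) (enc-++ A _) (IsB⇒Bounded {m} {A ++ (s , true) ∷ A′} bC)))))
    swapped : ∀ l → cnt l (-n ∷ hi s ∷ lo s ∷ enc A′) ≡ cnt l (lo s ∷ hi s ∷ -n ∷ enc A′)
    swapped l = cnt-swap l [] (lo s) (hi s ∷ []) -n (enc A′)
    bounds : Bounded (suc (m + m)) (hi s ∷ lo s ∷ enc A′) → Bounded (suc (m + m)) (hi s ∷ -n ∷ enc A′)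
    bounds (p ∷ _ ∷ ps) = p ∷ ≤-refl ∷ ps
    new₁ : ∀ l → -n ℤ.< l → l ℤ.≤ n → cnt l (y₁ ∷ y₂ ∷ Y′) ≤ cnt l (hi s ∷ -n ∷ enc A′)
    new₁ l p _ = ≤-trans (≡⇒≤ (lower₁ l p)) (≤-trans (at (Cn-mid {s} {false} {t} {c} {A′} {D′} σ₀ σ₁′ (λ ())) l)
      (+-monoʳ-≤ (le l (hi s)) (m≤n+m _ (le l -n))))
    new₂ : ∀ l → -n ℤ.< l → l ℤ.≤ n → cnt l (y₂ ∷ Y′) ≤ cnt l (-n ∷ enc A′)
    new₂ l p _ = ≤-trans (≡⇒≤ (lower₂ l p)) (≤-trans (at (Cn-enc {A′} {D′} σ₁′) l) (m≤n+m _ (le l -n)))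
    rank : rk ((A ++ (s , false) ∷ []) ++ A′) + (4 * length (A ++ (s , false) ∷ []) + 2 * length A′ + 1)
      ≡ 1 + (rk (A ++ (s , true) ∷ A′) + (4 * length A + 2 * suc (length A′) + 1))
    rank rewrite ++-assoc A ((s , false) ∷ []) A′ | rk-setBit A s A′ | length-++ A {(s , false) ∷ []} =
      arith (rk (A ++ (s , false) ∷ A′)) (length A) (length A′)
      where
      arith : ∀ r a k → r + (4 * (a + 1) + 2 * k + 1) ≡ 1 + (1 + r + (4 * a + 2 * suc k + 1))
      arith = solve-∀

  -- An entry common to both windows at the same place cancels from every suffix count, which
  -- reduces this case to even n.
  odd-same : ∀ ε A A′ B B′ → length A ≡ length B → IsB m (σ (A ++ A′)) → IsB m (σ (B ++ B′)) →
    Dom (ins m A ε A′) (ins m B ε B′) → A ++ A′ ≢ B ++ B′ → OddStep m ε A A′ (ins m B ε B′)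
  odd-same ε A A′ B B′ e bC bD d ne
    with even-step {m} {A ++ A′} {B ++ B′} bC bD
           (subst₂ Dom (sym (enc-++ A A′)) (sym (enc-++ B B′))
             (Dom-delete (enc A) (enc B) (length-enc-≡ {A} {B} e) d)) ne
  ... | C , bC* , d₁ , d₂ , r with splitLengths A A′ C (equal-lengths {A ++ A′} {C} bC bC*)
    where
    splitLengths : ∀ (A A′ L : List Code) → length (A ++ A′) ≡ length L →
      ∃ λ Z → ∃ λ Z′ → L ≡ Z ++ Z′ × length A ≡ length Z × length A′ ≡ length Z′
    splitLengths [] A′ L h = [] , L , refl , refl , h
    splitLengths (_ ∷ A) A′ (x ∷ L) h with splitLengths A A′ L (suc-injective h)
    ... | Z , Z′ , refl , h₁ , h₂ = x ∷ Z , Z′ , refl , cong suc h₁ , h₂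
  ... | Z , Z′ , refl , lZ , lZ′ = Z , ε , Z′ , bC* ,
    Dom-insert (enc A) (enc Z) (length-enc-≡ {A} {Z} lZ) (subst₂ Dom (enc-++ A A′) (enc-++ Z Z′) d₁) ,
    Dom-insert (enc Z) (enc B) (length-enc-≡ {Z} {B} (trans (sym lZ) e))
      (subst₂ Dom (enc-++ Z Z′) (enc-++ B B′) d₂) ,
    cong₂ _+_ r (pos ε)
    where
    pos : ∀ ε → posrk ε Z Z′ ≡ posrk ε A A′
    pos true = cong (2 *_) (sym lZ′)
    pos false = cong₂ (λ a b → 4 * a + 2 * b + 1) (sym lZ) (sym lZ′)

  -- Going up, the positive extreme entry moves left, turns negative at the first position and then
  -- moves right. Its two places and signs in `x` and `y` show which motion is still possible; if
  -- they agree, the codes differ.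
  odd-step : ∀ ε A A′ ε′ B B′ → IsB m (σ (A ++ A′)) → IsB m (σ (B ++ B′)) →
    Dom (ins m A ε A′) (ins m B ε′ B′) → ins m A ε A′ ≢ ins m B ε′ B′ → OddStep m ε A A′ (ins m B ε′ B′)
  odd-step ε A A′ ε′ B B′ bC bD d ne = bySigns ε ε′ d ne
    where
    enc-≤ : ∀ {A B} → length A ≤ length B → length (enc A) ≤ length (enc B)
    enc-≤ {A} {B} h = subst₂ _≤_ (sym (length-enc A)) (sym (length-enc B)) (h ⊕ h)
    enc-≤⁻ : ∀ {A B} → length (enc A) ≤ length (enc B) → length A ≤ length B
    enc-≤⁻ {A} {B} h = half-mono (m≤n⇒m≤1+n (subst₂ _≤_ (length-enc A) (length-enc B) h))
    ++-cancel : ∀ (A A′ B B′ : List Code) → length A ≡ length B → A ++ A′ ≡ B ++ B′ → A ≡ B × A′ ≡ B′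
    ++-cancel [] A′ [] B′ _ e = refl , e
    ++-cancel (a ∷ A) A′ (b ∷ B) B′ h e with ∷-injective e
    ... | refl , e′ with ++-cancel A A′ B B′ (suc-injective h) e′
    ... | refl , e″ = refl , e″
    codes≢ : ∀ {ε} → length A ≡ length B → ins m A ε A′ ≢ ins m B ε B′ → A ++ A′ ≢ B ++ B′
    codes≢ {ε} h ne e = ne (cong₂ (λ X X′ → ins m X ε X′) (proj₁ (++-cancel A A′ B B′ h e))
        (proj₂ (++-cancel A A′ B B′ h e)))
    bounded : ∀ {A A′} → IsB m (σ (A ++ A′)) → Bounded (m + m) (enc A ++ enc A′)
    bounded {A} {A′} b = subst (Bounded (m + m)) (enc-++ A A′) (IsB⇒Bounded {m} {A ++ A′} b)
    plus : ∀ A ε′ → IsB m (σ (A ++ A′)) → 0 < length A → ε′ ≡ false ⊎ length B < length A →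
      Dom (ins m A true A′) (ins m B ε′ B′) → OddStep m true A A′ (ins m B ε′ B′)
    plus A ε′ bC 0<A pos d with nonempty-snoc A 0<A
    ... | A₀ , (s , b) , refl = odd-plus A₀ b A′ bC′
        (plusContext A₀ b A′ B ε′ B′ bC′ bD (Sum.map₂ shorter pos) d)
      where
      bC′ = subst (IsB m ∘ σ) (++-assoc A₀ _ A′) bC
      shorter : length B < length (A₀ ++ (s , b) ∷ []) → length (enc B) ≤ length (enc A₀)
      shorter h = enc-≤ {B} {A₀} (≤-pred (subst (length B <_) (trans (length-++ A₀) (+-comm (length A₀) 1)) h))
    minus : ∀ A′ → IsB m (σ (A ++ A′)) → length A < length B →
      Dom (ins m A false A′) (ins m B false B′) → OddStep m false A A′ (ins m B false B′)
    minus [] bC h _ = contradiction (≤-trans (m≤m+n (length B) (length B′))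
        (≡⇒≤ (trans (sym (length-++ B)) (trans (equal-lengths {B ++ B′} {A ++ []} bD bC)
          (trans (length-++ A) (+-identityʳ _))))))
      (<⇒≱ h)
    minus ((s , b) ∷ A″) bC h d = odd-minus A b A″ bC (minusContext A b A″ B B′ bC bD
      (subst₂ _≤_ (trans (cong suc (+-suc (length A) (length A))) (cong (suc ∘ suc) (sym (length-enc A))))
        (sym (length-enc B)) (h ⊕ h)) d)
    bySigns : ∀ ε ε′ → Dom (ins m A ε A′) (ins m B ε′ B′) → ins m A ε A′ ≢ ins m B ε′ B′ →
      OddStep m ε A A′ (ins m B ε′ B′)
    bySigns false true d _ = contradiction d (no-sign-return {m + m} {enc A} (bounded {A} bC))
    bySigns true true d ne with length A ℕ.≟ length B
    ... | yes e = odd-same true A A′ B B′ e bC bD d (codes≢ e ne)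
    ... | no ¬e = plus A true bC (≤-<-trans z≤n B<A) (inj₂ B<A) d
      where
      B<A : length B < length A
      B<A = ≤∧≢⇒< (enc-≤⁻ {B} {A} (largest-position {m + m} {enc A} {enc A′} {enc B} {enc B′}
          (bounded {A} bC) d)) (¬e ∘ sym)
    bySigns false false d ne with length A ℕ.≟ length B
    ... | yes e = odd-same false A A′ B B′ e bC bD d (codes≢ e ne)
    ... | no ¬e = minus A′ bC
      (≤∧≢⇒< (enc-≤⁻ {A} {B} (smallest-position {m + m} {enc A} {enc A′} {enc B} {enc B′} (bounded {B} bD)
        d)) ¬e) d
    bySigns true false d _ = turnOrPlus A bC d
      where
      turnOrPlus : ∀ A → IsB m (σ (A ++ A′)) → Dom (ins m A true A′) (ins m B false B′) → OddStep m true A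
          A′ (ins m B false B′)
      turnOrPlus [] bC d = odd-turn A′ B B′ bC bD d
      turnOrPlus A@(_ ∷ _) bC d = plus A false bC (s≤s z≤n) (inj₁ refl) d

-- Length of coded permutations

data InBlock (s : ℤ) : ℤ → Set where
  low  : InBlock s (lo s)
  high : InBlock s (hi s)

InBlock-e₁ : ∀ a → InBlock (proj₁ a) (e₁ a)
InBlock-e₁ (_ , false) = low
InBlock-e₁ (_ , true) = high

InBlock-e₂ : ∀ a → InBlock (proj₁ a) (e₂ a)
InBlock-e₂ (_ , false) = high
InBlock-e₂ (_ , true) = low

InBlock-neg : ∀ {s e} → InBlock s e → InBlock (- s) (- e)
InBlock-neg {s} low = subst (InBlock (- s)) (sym (neg-lo s)) high
InBlock-neg {s} high = subst (InBlock (- s)) (sym (neg-hi s)) low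

block-≥ : ∀ {s e} → InBlock s e → lo s ℤ.≤ e
block-≥ low = ℤₚ.≤-refl
block-≥ {s} high = lo≤hi s

block-≤ : ∀ {s e} → InBlock s e → e ℤ.≤ hi s
block-≤ {s} low = lo≤hi s
block-≤ high = ℤₚ.≤-refl

block-< : ∀ {s e t f} → InBlock s e → InBlock t f → s ℤ.< t → e ℤ.< f
block-< p q s<t = ℤₚ.≤-<-trans (block-≤ p) (ℤₚ.<-≤-trans (hi<lo s<t) (block-≥ q))

lt-block : ∀ {s e t f} → InBlock s e → InBlock t f → s ≢ t → lt e f ≡ lt s t
lt-block p q s≢t = lt-cong
  (λ e<f → ℤₚ.≰⇒> (λ t≤s → ℤₚ.<-asym e<f (block-< q p (ℤₚ.≤∧≢⇒< t≤s (s≢t ∘ sym))))) (block-< p q)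

invs-block : ∀ {s e t f} → InBlock s e → InBlock t f → ∣ s ∣ ≢ ∣ t ∣ → invs e f ≡ invs s t
invs-block p q ne = cong₂ _+_ (lt-block q p (∣∣≢⇒≢ (ne ∘ sym)))
  (lt-block q (InBlock-neg p) (λ t≡-s → ∣∣≢⇒-≢ ne (sym t≡-s)))

lt-0 : ∀ {s e} → InBlock s e → s ≢ 0ℤ → lt e 0ℤ ≡ lt s 0ℤ
lt-0 p = lt-block p (low {0ℤ})

lt-self : ∀ s → s ≢ 0ℤ → lt s (- s) ≡ lt s 0ℤ
lt-self (+ zero) ne = contradiction refl ne
lt-self (+ suc _) _ = refl
lt-self -[1+ _ ] _ = refl

s≢-s : ∀ {s} → s ≢ 0ℤ → s ≢ - s
s≢-s {+ zero} ne _ = ne refl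
s≢-s {+ suc _} _ ()
s≢-s { -[1+ _ ]} _ ()

invs-own-block : ∀ s b → s ≢ 0ℤ → invs (e₁ (s , b)) (e₂ (s , b)) ≡ b2n b + lt s 0ℤ
invs-own-block s b s≢0 = cong₂ _+_ (order b)
  (trans (lt-block (InBlock-e₂ (s , b)) (InBlock-neg (InBlock-e₁ (s , b))) (s≢-s s≢0)) (lt-self s s≢0))
  where
  order : ∀ b → lt (e₂ (s , b)) (e₁ (s , b)) ≡ b2n b
  order false = lt-false (ℤₚ.<-asym (lo<hi s≢0))
  order true = lt-true (lo<hi s≢0)

negs-enc : ∀ A → Nonzero A → negs (enc A) ≡ 2 * negs (σ A)
negs-enc [] _ = refl
negs-enc (a ∷ A) (s≢0 ∷ nz) = trans
  (cong₂ _+_ (lt-0 (InBlock-e₁ a) s≢0) (cong₂ _+_ (lt-0 (InBlock-e₂ a) s≢0) (negs-enc A nz)))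
  (arith (lt (proj₁ a) 0ℤ) (negs (σ A)))
  where
  arith : ∀ x y → x + (x + 2 * y) ≡ 2 * (x + y)
  arith = solve-∀

row-enc : ∀ {s e} A → InBlock s e → All (λ t → ∣ s ∣ ≢ ∣ t ∣) (σ A) → sumOf (invs e) (enc A) ≡ 2 * sumOf
    (invs s) (σ A)
row-enc [] _ _ = refl
row-enc {s} (a ∷ A) p (ne ∷ nes) = trans
  (cong₂ _+_ (invs-block p (InBlock-e₁ a) ne) (cong₂ _+_ (invs-block p (InBlock-e₂ a) ne) (row-enc A p nes)))
  (arith (invs s (proj₁ a)) (sumOf (invs s) (σ A)))
  where
  arith : ∀ x y → x + (x + 2 * y) ≡ 2 * (x + y)
  arith = solve-∀

-- Two blocks form four pairs of entries, each compared as the values are. Inside a block a set bit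
-- is an inversion and a negative value gives a negative sum.
pairs-enc : ∀ A → Nonzero A → Distinct (σ A) →
  invPairs (enc A) ≡ 4 * invPairs (σ A) + negs (σ A) + bits A
pairs-enc [] _ _ = refl
pairs-enc (a@(s , b) ∷ A) (s≢0 ∷ nz) (ne ∷ nes) = trans
  (cong₂ _+_ (cong₂ _+_ (invs-own-block s b s≢0) (row-enc A (InBlock-e₁ a) ne))
    (cong₂ _+_ (row-enc A (InBlock-e₂ a) ne) (pairs-enc A nz nes)))
  (arith (b2n b) (lt s 0ℤ) (sumOf (invs s) (σ A)) (invPairs (σ A)) (negs (σ A)) (bits A))
  where
  arith : ∀ b n r p q t → b + n + 2 * r + (2 * r + (4 * p + q + t)) ≡ 4 * (r + p) + (n + q) + (b + t)
  arith = solve-∀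

ℓB-enc : ∀ {m A} → IsB m (σ A) → ℓB (enc A) ≡ ℓB (σ A) + rk A
ℓB-enc {m} {A} b = trans (ℓB≡ (enc A)) (trans
  (cong₂ _+_ (pairs-enc A (IsB⇒Nonzero {A = A} b) (proj₂ (proj₂ b))) (negs-enc A (IsB⇒Nonzero {A = A} b)))
  (trans (arith (invPairs (σ A)) (negs (σ A)) (bits A)) (cong (_+ rk A) (sym (ℓB≡ (σ A))))))
  where
  arith : ∀ p n t → 4 * p + n + t + 2 * n ≡ p + n + (3 * p + (2 * n + t))
  arith = solve-∀

pairSum-insert : ∀ R P e Q → pairSum R (P ++ e ∷ Q) ≡ pairSum R (P ++ Q) +
    (sumOf (λ p → R p e) P + sumOf (R e) Q)
pairSum-insert R [] e Q = +-comm (sumOf (R e) Q) _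
pairSum-insert R (p ∷ P) e Q = trans (cong₂ _+_ (sumOf-insert (R p) P e Q) (pairSum-insert R P e Q))
  (arith (R p e) (sumOf (R p) (P ++ Q)) (pairSum R (P ++ Q)) (sumOf (λ p → R p e) P) (sumOf (R e) Q))
  where
  arith : ∀ a b c d f → a + b + (c + (d + f)) ≡ b + c + (a + d + f)
  arith = solve-∀

-- The entry `2m + 1` is inverted with both entries of each later block. The entry `- (2m + 1)`
-- forms an inversion and a negative sum with each earlier entry, a negative sum with each later
-- one, and is itself negative.
ℓB-ins : ∀ {m} A ε A′ → IsB m (σ (A ++ A′)) → ℓB (ins m A ε A′) ≡ ℓB (enc (A ++ A′)) + posrk ε A A′
ℓB-ins {m} A ε A′ b = trans (ℓB≡ (ins m A ε A′)) (trans
  (cong₂ _+_ (pairSum-insert invs (enc A) (ent m ε) (enc A′))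
    (sumOf-insert (λ x → lt x 0ℤ) (enc A) (ent m ε) (enc A′)))
  (trans (arith (invPairs w) (sumOf (λ p → invs p (ent m ε)) (enc A) + sumOf (invs (ent m ε)) (enc A′))
    (lt (ent m ε) 0ℤ) (negs w))
    (cong₂ _+_ (trans (sym (ℓB≡ w)) (cong ℓB (sym (enc-++ A A′)))) (extra ε))))
  where
  w = enc A ++ enc A′
  arith : ∀ p r k q → p + r + (k + q) ≡ p + q + (r + k)
  arith = solve-∀
  bounds : Bounded (m + m) w
  bounds = subst (Bounded (m + m)) (enc-++ A A′) (IsB⇒Bounded {m} {A ++ A′} b)
  boundA = Allₚ.++⁻ˡ (enc A) bounds
  boundA′ = Allₚ.++⁻ʳ (enc A) bounds
  neg-bound : ∀ {x} → ∣ x ∣ ≤ m + m → ∣ - x ∣ ≤ m + m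
  neg-bound {x} = subst (_≤ m + m) (sym (ℤₚ.∣-i∣≡∣i∣ x))
  extra : ∀ ε → sumOf (λ p → invs p (ent m ε)) (enc A) + sumOf (invs (ent m ε)) (enc A′) + lt (ent m ε) 0ℤ ≡
      posrk ε A A′
  extra true = trans (cong₂ (λ p q → p + q + 0)
      (sumOf-const 0 (All.map (λ {x} h → cong₂ _+_ (lt-false (ℤₚ.<-asym (bounded-< {x = x} h)))
                                         (lt-false (ℤₚ.<-asym (bounded-< {x = - x} (neg-bound {x} h)))))
                                             boundA))
      (sumOf-const 1 (All.map (λ {x} h → cong₂ _+_ (lt-true (bounded-< {x = x} h))
          (lt-false (ℤₚ.<-asym (bounded-> {x = x} h)))) boundA′)))
    (trans (cong₂ (λ p q → p * 0 + q * 1 + 0) (length-enc A) (length-enc A′)) (count (length A) (length A′)))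
    where
    count : ∀ a k → (a + a) * 0 + (k + k) * 1 + 0 ≡ 2 * k
    count = solve-∀
  extra false = trans (cong₂ (λ p q → p + q + 1)
      (sumOf-const 2 (All.map (λ {x} h → cong₂ _+_ (lt-true (bounded-> {x = x} h))
                                         (lt-true (bounded-> {x = - x} (neg-bound {x} h)))) boundA))
      (sumOf-const 1 (All.map (λ {x} h → cong₂ _+_ (lt-false (ℤₚ.<-asym (bounded-> {x = x} h)))
          (lt-true (bounded-< {x = x} h))) boundA′)))
    (trans (cong₂ (λ p q → p * 2 + q * 1 + 1) (length-enc A) (length-enc A′)) (count (length A) (length A′)))
    where
    count : ∀ a k → (a + a) * 2 + (k + k) * 1 + 1 ≡ 4 * a + 2 * k + 1
    count = solve-∀

-- Recovering σ and ℓ_W from the window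

double : ∀ k → k * 2 ≡ k + k
double = solve-∀

[k+k]/2 : ∀ k → (k + k) / 2 ≡ k
[k+k]/2 k = trans (cong (_/ 2) (sym (double k))) (m*n/n≡m k 2)

[1+k+k]/2 : ∀ k → suc (k + k) / 2 ≡ k
[1+k+k]/2 k = trans (+-distrib-/-∣ʳ 1 (divides k (sym (double k)))) ([k+k]/2 k)

[2+k+k]/2 : ∀ k → suc (suc (k + k)) / 2 ≡ suc k
[2+k+k]/2 k = trans (cong (λ j → suc j / 2) (sym (+-suc k k))) ([k+k]/2 (suc k))

[3+k+k]/2 : ∀ k → suc (suc (suc (k + k))) / 2 ≡ suc k
[3+k+k]/2 k = trans (cong (λ j → suc (suc j) / 2) (sym (+-suc k k))) ([1+k+k]/2 (suc k))

[k+k]%2 : ∀ k → (k + k) % 2 ≡ 0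
[k+k]%2 k = trans (cong (_% 2) (sym (double k))) (m*n%n≡0 k 2)

[1+k+k]%2 : ∀ k → suc (k + k) % 2 ≡ 1
[1+k+k]%2 k = trans (cong (λ j → suc j % 2) (sym (double k))) ([m+kn]%n≡m%n 1 k 2)

dec-block : ∀ {s e} → InBlock s e → decEntry e ≡ s
dec-block {+ zero} low = refl
dec-block {+ zero} high = refl
dec-block {+ suc k} low = cong +_ ([2+k+k]/2 k)
dec-block {+ suc k} high = cong +_ ([3+k+k]/2 k)
dec-block { -[1+ k ]} low = cong (λ j → - (+ j)) ([3+k+k]/2 k)
dec-block { -[1+ k ]} high = cong (λ j → - (+ j)) ([2+k+k]/2 k)

abs-dec : ∀ e → ∣ decEntry e ∣ ≡ suc ∣ e ∣ / 2
abs-dec (+ k) = refl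
abs-dec -[1+ k ] = ℤₚ.∣-i∣≡∣i∣ (+ (suc (suc k) / 2))

map-decEntry-odds : ∀ A → map decEntry (odds (enc A)) ≡ σ A
map-decEntry-odds [] = refl
map-decEntry-odds (a ∷ A) = cong₂ _∷_ (dec-block (InBlock-e₁ a)) (map-decEntry-odds A)

sigmaOf-even : ∀ m A → sigmaOf (m + m) (enc A) ≡ σ A
sigmaOf-even m A rewrite [k+k]%2 m = map-decEntry-odds A

sigmaOf-odd : ∀ m A ε A′ → IsB m (σ (A ++ A′)) → sigmaOf (suc (m + m)) (ins m A ε A′) ≡ σ (A ++ A′)
sigmaOf-odd m A ε A′ b rewrite [1+k+k]%2 m = trans (cong (map decEntry ∘ odds) filtered)
    (map-decEntry-odds (A ++ A′))
  where
  keep? : ∀ x → Dec (¬ ∣ x ∣ ≡ suc (m + m))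
  keep? x = ¬? (∣ x ∣ ℕ.≟ suc (m + m))
  kept : All (λ x → ¬ ∣ x ∣ ≡ suc (m + m)) (enc A ++ enc A′)
  kept = All.map (λ h e → <⇒≱ (n<1+n (m + m)) (≤-trans (≡⇒≥ e) h))
    (subst (Bounded (m + m)) (enc-++ A A′) (IsB⇒Bounded {m} {A ++ A′} b))
  filtered : filter keep? (ins m A ε A′) ≡ enc (A ++ A′)
  filtered = trans (filter-++ keep? (enc A) (ent m ε ∷ enc A′)) (trans
    (cong₂ _++_ (filter-all keep? (Allₚ.++⁻ˡ (enc A) kept))
      (trans (filter-reject keep? {ent m ε} {enc A′} (λ ne → ne (∣ent∣ {m} ε)))
        (filter-all keep? (Allₚ.++⁻ʳ (enc A) kept))))
    (sym (enc-++ A A′)))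

ℓW-even : ∀ {m A} → IsB m (σ A) → ℓW (m + m) (enc A) ≡ rk A
ℓW-even {m} {A} b = trans (cong₂ ℕ._∸_ (ℓB-enc {m} {A} b) (cong ℓB (sigmaOf-even m A)))
    (m+n∸m≡n (ℓB (σ A)) (rk A))

ℓW-odd : ∀ {m} A ε A′ → IsB m (σ (A ++ A′)) → ℓW (suc (m + m)) (ins m A ε A′) ≡ rkO ε A A′
ℓW-odd {m} A ε A′ b = trans
  (cong₂ ℕ._∸_ (trans (ℓB-ins A ε A′ b) (trans (cong (_+ posrk ε A A′) (ℓB-enc {m} {A ++ A′} b))
    (+-assoc (ℓB (σ (A ++ A′))) _ _)))
    (cong ℓB (sigmaOf-odd m A ε A′ b)))
  (m+n∸m≡n (ℓB (σ (A ++ A′))) (rkO ε A A′))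

-- Codes and their windows as signed permutations

map-insert-↭ : ∀ (P : List ℤ) e Q → map ∣_∣ (P ++ e ∷ Q) ↭ ∣ e ∣ ∷ map ∣_∣ (P ++ Q)
map-insert-↭ P e Q = Permₚ.map⁺ ∣_∣ (Permₚ.shift e P Q)

range-suc-↭ : ∀ k → suc k ∷ applyUpTo suc k ↭ applyUpTo suc (suc k)
range-suc-↭ k = ↭-trans (Permₚ.∷↭∷ʳ (suc k) (applyUpTo suc k)) (↭-reflexive (applyUpTo-∷ʳ suc k))

IsB-insert : ∀ {k} P {e} Q → ∣ e ∣ ≡ suc k → IsB k (P ++ Q) → IsB (suc k) (P ++ e ∷ Q)
IsB-insert {k} P {e} Q h b = ↭⇒IsB (↭-trans (map-insert-↭ P e Q)
  (↭-trans (↭-reflexive (cong (_∷ map ∣_∣ (P ++ Q)) h)) (↭-trans (prep (suc k) (IsB⇒↭ b)) (range-suc-↭ k))))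

IsB-delete : ∀ {k} P {e} Q → ∣ e ∣ ≡ suc k → IsB (suc k) (P ++ e ∷ Q) → IsB k (P ++ Q)
IsB-delete {k} P {e} Q h b = ↭⇒IsB (Permₚ.drop-∷ {x = suc k}
    (↭-trans (↭-reflexive (cong (_∷ map ∣_∣ (P ++ Q)) (sym h)))
  (↭-trans (↭-sym (map-insert-↭ P e Q)) (↭-trans (IsB⇒↭ b) (↭-sym (range-suc-↭ k))))))

∣lo∣≢∣hi∣ : ∀ {s} → s ≢ 0ℤ → ∣ lo s ∣ ≢ ∣ hi s ∣
∣lo∣≢∣hi∣ {+ zero} ne _ = ne refl
∣lo∣≢∣hi∣ {+ suc k} _ e = 1+n≢n (sym e)
∣lo∣≢∣hi∣ { -[1+ k ]} _ e = 1+n≢n e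

block-∣∣ : ∀ {s e t f} → InBlock s e → InBlock t f → ∣ e ∣ ≡ ∣ f ∣ → ∣ s ∣ ≡ ∣ t ∣
block-∣∣ {s} {e} {t} {f} p q h = begin
  ∣ s ∣            ≡⟨ cong ∣_∣ (dec-block p) ⟨
  ∣ decEntry e ∣   ≡⟨ abs-dec e ⟩
  suc ∣ e ∣ / 2    ≡⟨ cong (λ j → suc j / 2) h ⟩
  suc ∣ f ∣ / 2    ≡⟨ abs-dec f ⟨
  ∣ decEntry f ∣   ≡⟨ cong ∣_∣ (dec-block q) ⟩
  ∣ t ∣            ∎
  where open ≡-Reasoning

IsB-enc : ∀ {m A} → IsB m (σ A) → IsB (m + m) (enc A)
IsB-enc {m} {A} b@(len , bounds , distinct) =
  trans (length-enc A) (cong (λ k → k + k) (trans (sym (length-map proj₁ A)) len)) ,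
  All.zipWith (λ z → z) (positive A (IsB⇒Nonzero {A = A} b) , IsB⇒Bounded {m} {A} b) ,
  pairs A (IsB⇒Nonzero {A = A} b) distinct
  where
  positive-block : ∀ {s e} → InBlock s e → s ≢ 0ℤ → 1 ≤ ∣ e ∣
  positive-block {+ zero} _ ne = contradiction refl ne
  positive-block {+ suc _} low _ = s≤s z≤n
  positive-block {+ suc _} high _ = s≤s z≤n
  positive-block { -[1+ _ ]} low _ = s≤s z≤n
  positive-block { -[1+ _ ]} high _ = s≤s z≤n
  positive : ∀ A → Nonzero A → All (λ x → 1 ≤ ∣ x ∣) (enc A)
  positive [] _ = []
  positive (a ∷ A) (ne ∷ nz) = positive-block (InBlock-e₁ a) ne ∷ positive-block (InBlock-e₂ a) ne ∷
      positive A nz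
  others : ∀ {s e} A → InBlock s e → All (λ t → ∣ s ∣ ≢ ∣ t ∣) (σ A) → All (λ f → ∣ e ∣ ≢ ∣ f ∣) (enc A)
  others [] _ _ = []
  others (a ∷ A) p (ne ∷ nes) =
    (λ h → ne (block-∣∣ p (InBlock-e₁ a) h)) ∷ (λ h → ne (block-∣∣ p (InBlock-e₂ a) h)) ∷ others A p nes
  own : ∀ s b → s ≢ 0ℤ → ∣ e₁ (s , b) ∣ ≢ ∣ e₂ (s , b) ∣
  own s false ne = ∣lo∣≢∣hi∣ ne
  own s true ne = ∣lo∣≢∣hi∣ ne ∘ sym
  pairs : ∀ A → Nonzero A → Distinct (σ A) → Distinct (enc A)
  pairs [] _ _ = []
  pairs (a ∷ A) (ne ∷ nz) (d ∷ ds) =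
    (own (proj₁ a) (proj₂ a) ne ∷ others A (InBlock-e₁ a) d) ∷ (others A (InBlock-e₂ a) d ∷ pairs A nz ds)

block-size : ∀ {s e} → InBlock s e → ∣ s ∣ ℕ.+ ∣ s ∣ ≤ suc ∣ e ∣
block-size {+ zero} _ = z≤n
block-size {+ suc k} low = s≤s (≡⇒≤ (+-suc k k))
block-size {+ suc k} high = m≤n⇒m≤1+n (s≤s (≡⇒≤ (+-suc k k)))
block-size { -[1+ k ]} low = m≤n⇒m≤1+n (s≤s (≡⇒≤ (+-suc k k)))
block-size { -[1+ k ]} high = s≤s (≡⇒≤ (+-suc k k))

IsB-dec : ∀ {m A} → IsB (m + m) (enc A) → IsB m (σ A)
IsB-dec {m} {A} (len , bounds , distinct) =
  trans (length-map proj₁ A) (≤-antisym (half-mono (m≤n⇒m≤1+n (≡⇒≤ len′))) (half-mono (m≤n⇒m≤1+n (≡⇒≥ len′)))) ,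
  bounded A bounds , pairs A distinct
  where
  len′ : length A + length A ≡ m + m
  len′ = trans (sym (length-enc A)) len
  nonzero : ∀ {s e} → InBlock s e → 1 ≤ ∣ e ∣ → 1 ≤ ∣ s ∣
  nonzero {+ zero} low ()
  nonzero {+ zero} high ()
  nonzero {+ suc _} _ _ = s≤s z≤n
  nonzero { -[1+ _ ]} _ _ = s≤s z≤n
  bounded : ∀ A → All (λ x → 1 ≤ ∣ x ∣ × ∣ x ∣ ≤ m + m) (enc A) → All (λ x → 1 ≤ ∣ x ∣ × ∣ x ∣ ≤ m) (σ A)
  bounded [] _ = []
  bounded (a ∷ A) ((l , h) ∷ _ ∷ hs) =
    (nonzero (InBlock-e₁ a) l , half-mono (≤-trans (block-size (InBlock-e₁ a)) (s≤s h))) ∷ bounded A hs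
  member : ∀ {s e} A → InBlock s e → All (λ f → ∣ lo s ∣ ≢ ∣ f ∣) (enc A) → All (λ t → ∣ s ∣ ≢ ∣ t ∣) (σ A)
  member [] _ _ = []
  member {s} ((t , b) ∷ A) p (n₁ ∷ n₂ ∷ ns) = clash b n₁ n₂ ∷ member A p ns
    where
    ∣lo∣ : ∀ t → ∣ s ∣ ≡ ∣ t ∣ → ∣ lo s ∣ ≡ ∣ lo t ∣ ⊎ ∣ lo s ∣ ≡ ∣ hi t ∣
    ∣lo∣ t h with ∣x∣≡∣y∣ s t h
    ... | inj₁ refl = inj₁ refl
    ... | inj₂ refl = inj₂ (trans (cong ∣_∣ (sym (neg-hi t))) (ℤₚ.∣-i∣≡∣i∣ (hi t)))
    clash : ∀ b → ∣ lo s ∣ ≢ ∣ e₁ (t , b) ∣ → ∣ lo s ∣ ≢ ∣ e₂ (t , b) ∣ → ∣ s ∣ ≢ ∣ t ∣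
    clash b n₁ n₂ h with ∣lo∣ t h
    clash false n₁ n₂ h | inj₁ e = n₁ e
    clash false n₁ n₂ h | inj₂ e = n₂ e
    clash true n₁ n₂ h | inj₁ e = n₂ e
    clash true n₁ n₂ h | inj₂ e = n₁ e
  pairs : ∀ A → Distinct (enc A) → Distinct (σ A)
  pairs [] _ = []
  pairs ((s , false) ∷ A) ((_ ∷ n) ∷ (_ ∷ ns)) = member {s} A low n ∷ pairs A ns
  pairs ((s , true) ∷ A) (_ ∷ (n ∷ ns)) = member {s} A low n ∷ pairs A ns

-- Decoding

nth-∈ : ∀ v {i} → i < length v → nth v i ∈ v
nth-∈ (x ∷ v) {zero} _ = here refl
nth-∈ (x ∷ v) {suc i} (s≤s h) = there (nth-∈ v h)

∈-nth : ∀ {x v} → x ∈ v → ∃ λ i → i < length v × nth v i ≡ x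
∈-nth (here refl) = 0 , s≤s z≤n , refl
∈-nth (there p) with ∈-nth p
... | i , h , e = suc i , s≤s h , e

nth-injective : ∀ v {i j} → Distinct v → i < length v → j < length v →
  ∣ nth v i ∣ ≡ ∣ nth v j ∣ → i ≡ j
nth-injective (x ∷ v) {zero} {zero} _ _ _ _ = refl
nth-injective (x ∷ v) {zero} {suc j} (d ∷ _) _ (s≤s h) e = contradiction e (All.lookup d (nth-∈ v h))
nth-injective (x ∷ v) {suc i} {zero} (d ∷ _) (s≤s h) _ e = contradiction (sym e) (All.lookup d (nth-∈ v h))
nth-injective (x ∷ v) {suc i} {suc j} (_ ∷ ds) (s≤s h) (s≤s h′) e = cong suc (nth-injective v ds h h′ e)

Adj : ℕ → ℕ → Set
Adj i j = i ≡ suc j ⊎ j ≡ suc i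

Mate : ℤ → ℤ → Set
Mate e f = ∃ λ s → s ≢ 0ℤ × ((e ≡ lo s × f ≡ hi s) ⊎ (e ≡ hi s × f ≡ lo s))

Mate-code : ∀ {e f} → Mate e f → ∃ λ a → e ≡ e₁ a × f ≡ e₂ a
Mate-code (s , _ , inj₁ (p , q)) = (s , false) , p , q
Mate-code (s , _ , inj₂ (p , q)) = (s , true) , p , q

Mate-unique : ∀ {e x y} → Mate e y → Mate x y → e ≡ x
Mate-unique {e} {x} {y} (s , s≢0 , p) (t , t≢0 , q) with trans (sym (value p)) (value q)
  where
  value : ∀ {e s} → (e ≡ lo s × y ≡ hi s) ⊎ (e ≡ hi s × y ≡ lo s) → decEntry y ≡ s
  value (inj₁ (_ , refl)) = dec-block high
  value (inj₂ (_ , refl)) = dec-block low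
Mate-unique (s , _ , inj₁ (refl , _)) (_ , _ , inj₁ (refl , _)) | refl = refl
Mate-unique (s , _ , inj₂ (refl , _)) (_ , _ , inj₂ (refl , _)) | refl = refl
Mate-unique (s , s≢0 , inj₁ (_ , p)) (_ , _ , inj₂ (_ , q)) | refl = contradiction (trans (sym q) p)
    (ℤₚ.<⇒≢ (lo<hi s≢0))
Mate-unique (s , s≢0 , inj₂ (_ , p)) (_ , _ , inj₁ (_ , q)) | refl = contradiction (trans (sym p) q)
    (ℤₚ.<⇒≢ (lo<hi s≢0))

Mate-signs : ∀ {e f} → Mate e f → ∃ λ x → ∃ λ y → (e ≡ + suc x × f ≡ + suc y) ⊎ (e ≡ -[1+ x ] × f ≡ -[1+ y ])
Mate-signs (+ zero , ne , _) = contradiction refl ne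
Mate-signs (+ suc k , _ , inj₁ (refl , refl)) = _ , _ , inj₁ (refl , refl)
Mate-signs (+ suc k , _ , inj₂ (refl , refl)) = _ , _ , inj₁ (refl , refl)
Mate-signs (-[1+ k ] , _ , inj₁ (refl , refl)) = _ , _ , inj₂ (refl , refl)
Mate-signs (-[1+ k ] , _ , inj₂ (refl , refl)) = _ , _ , inj₂ (refl , refl)

star-odd : ∀ {n} k → suc (suc (k + k)) ≤ n → star n (suc (k + k)) ≡ suc (suc (k + k))
star-odd {n} k h rewrite [1+k+k]%2 k with suc (suc (k + k)) ≤ᵇ n | ≤⇒≤ᵇ h
... | true | _ = refl

star-even : ∀ n k → star n (suc (suc (k + k))) ≡ suc (k + k)
star-even n k rewrite trans (cong (λ j → suc j % 2) (sym (+-suc k k))) ([k+k]%2 (suc k)) = refl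

Mate-star : ∀ {n e f} → Mate e f → ∣ e ∣ ≤ n → ∣ f ∣ ≤ n → ∣ f ∣ ≡ star n ∣ e ∣
Mate-star (+ zero , ne , _) _ _ = contradiction refl ne
Mate-star (+ suc k , _ , inj₁ (refl , refl)) _ h = sym (star-odd k h)
Mate-star {n} (+ suc k , _ , inj₂ (refl , refl)) _ h = sym (star-even n k)
Mate-star {n} (-[1+ k ] , _ , inj₁ (refl , refl)) _ h = sym (star-even n k)
Mate-star (-[1+ k ] , _ , inj₂ (refl , refl)) _ h = sym (star-odd k h)

Mate-bounded : ∀ {m e f} → Mate e f → ∣ e ∣ ≤ m + m → ∣ f ∣ ≤ m + m
Mate-bounded {m} {e} {f} (s , _ , p) h = bound p
  where
  ∣s∣≤m : (e ≡ lo s × f ≡ hi s) ⊎ (e ≡ hi s × f ≡ lo s) → ∣ s ∣ ≤ m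
  ∣s∣≤m (inj₁ (refl , _)) = half-mono (≤-trans (block-size {s} low) (s≤s h))
  ∣s∣≤m (inj₂ (refl , _)) = half-mono (≤-trans (block-size {s} high) (s≤s h))
  bound : (e ≡ lo s × f ≡ hi s) ⊎ (e ≡ hi s × f ≡ lo s) → ∣ f ∣ ≤ m + m
  bound p@(inj₁ (_ , refl)) = All.head (All.tail (enc-bounded {m} {(s , false) ∷ []} (∣s∣≤m p ∷ [])))
  bound p@(inj₂ (_ , refl)) = All.head (All.tail (enc-bounded {m} {(s , true) ∷ []} (∣s∣≤m p ∷ [])))

-- The Wachs condition, read off positions of the window; N = 2m is the largest value in a block.
Paired : ℕ → List ℤ → Set
Paired N v = ∀ i → i < length v → ∣ nth v i ∣ ≤ N → ∃ λ j → j < length v × Adj i j × Mate (nth v i) (nth v j)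

∣⊖∣-adj : ∀ {i j} → Adj i j → ∣ suc i ℤ.⊖ suc j ∣ ≤ 1
∣⊖∣-adj {i} {j} (inj₁ refl) = ≡⇒≤ (trans (cong ∣_∣ (ℤₚ.⊖-≥ (n≤1+n (suc j)))) (m+n∸n≡m 1 (suc j)))
∣⊖∣-adj {i} {j} (inj₂ refl) = ≡⇒≤ (trans (ℤₚ.∣⊖∣-≤ (n≤1+n (suc i))) (m+n∸n≡m 1 (suc i)))

adj-∣⊖∣ : ∀ {i j} → i ≢ j → ∣ suc i ℤ.⊖ suc j ∣ ≤ 1 → Adj i j
adj-∣⊖∣ {i} {j} i≢j h with <-cmp i j
... | tri≈ _ e _ = contradiction e i≢j
... | tri< i<j _ _ = inj₂ (≤-antisym (≤-pred (≤-trans (m≤n+m∸n (suc j) (suc i))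
        (≤-trans (+-monoʳ-≤ (suc i) (subst (_≤ 1) (ℤₚ.∣⊖∣-≤ (s≤s (<⇒≤ i<j))) h)) (≡⇒≤ (+-comm (suc i) 1)))))
          i<j)
... | tri> _ _ j<i = inj₁ (≤-antisym (≤-pred (≤-trans (m≤n+m∸n (suc i) (suc j))
        (≤-trans (+-monoʳ-≤ (suc j) (subst (_≤ 1) (cong ∣_∣ (ℤₚ.⊖-≥ (s≤s (<⇒≤ j<i)))) h))
          (≡⇒≤ (+-comm (suc j) 1))))) j<i)

Adj-sym : ∀ {i j} → Adj i j → Adj j i
Adj-sym (inj₁ e) = inj₂ e
Adj-sym (inj₂ e) = inj₁ e

-- 0 is not a position, so positions of different signs are at distance at least two.
close-positions : ∀ p q → 1 ≤ ∣ p ∣ → 1 ≤ ∣ q ∣ → p ≢ q → ∣ p ℤ.- q ∣ ≤ 1 →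
  ∃ λ i → ∃ λ j → Adj i j × ((p ≡ + suc i × q ≡ + suc j) ⊎ (p ≡ -[1+ i ] × q ≡ -[1+ j ]))
close-positions (+ suc i) (+ suc j) _ _ ne h = i , j , adj-∣⊖∣ (λ e → ne (cong (λ k → + suc k) e)) h , inj₁
    (refl , refl)
close-positions (+ suc i) -[1+ j ] _ _ _ h = contradiction h (<⇒≱ (s≤s (≤-trans (s≤s z≤n) (m≤n+m (suc j) i))))
close-positions -[1+ i ] (+ suc j) _ _ _ (s≤s ())
close-positions -[1+ i ] -[1+ j ] _ _ ne h =
  i , j , Adj-sym (adj-∣⊖∣ (λ e → ne (cong -[1+_] (sym e))) h) , inj₂ (refl , refl)

app-surjective : ∀ {n v} → IsB n v → ∀ {a} → 1 ≤ a → a ≤ n → ∃ λ p → 1 ≤ ∣ p ∣ × ∣ p ∣ ≤ n × app v p ≡ + a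
app-surjective {n} {v} b {a} 1≤a a≤n with IsB-∋ b {+ a} 1≤a a≤n
... | x , x∈ , h with ∈-nth x∈ | ∣x∣≡∣y∣ (+ a) x h
... | i , i< , refl | inj₁ e = + suc i , s≤s z≤n , subst (suc i ≤_) (proj₁ b) i< , sym e
... | i , i< , refl | inj₂ e = -[1+ i ] , s≤s z≤n , subst (suc i ≤_) (proj₁ b) i< , sym e

-- For each block the Wachs condition at its odd element `2k + 1` places both members next to each
-- other with equal signs. Distinctness then identifies one of the two positions with `i`.
Wachs⇒Paired : ∀ {m n v} → m + m ≤ n → IsWachs n v → Paired (m + m) v
Wachs⇒Paired {m} {n} {v} 2m≤n (b , wachs) i i<len bound = fromSize ∣ nth v i ∣ refl
  where
  positive : 1 ≤ ∣ nth v i ∣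
  positive = proj₁ (All.lookup (proj₁ (proj₂ b)) (nth-∈ v i<len))
  module Block (k : ℕ) (fits : suc (suc (k + k)) ≤ m + m) where
    a = suc (k + k)
    a′ = suc (suc (k + k))
    a′≤n : a′ ≤ n
    a′≤n = ≤-trans fits 2m≤n
    placed : ∃ λ i₁ → ∃ λ i₂ → i₁ < length v × i₂ < length v × Adj i₁ i₂ ×
      ((nth v i₁ ≡ + a × nth v i₂ ≡ + a′) ⊎ (nth v i₁ ≡ - (+ a) × nth v i₂ ≡ - (+ a′)))
    placed with app-surjective b {a} (s≤s z≤n) (<⇒≤ a′≤n) | app-surjective b {a′} (s≤s z≤n) a′≤n
    ... | p , 1≤p , p≤n , ep | q , 1≤q , q≤n , eq
      with close-positions p q 1≤p 1≤q (λ { refl → 1+n≢n (ℤₚ.+-injective (trans (sym eq) ep)) })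
             (wachs a (s≤s z≤n) a′≤n p q 1≤p p≤n 1≤q q≤n ep (trans eq (cong +_ (sym (star-odd k a′≤n)))))
    ... | i₁ , i₂ , adj , inj₁ (refl , refl) =
      i₁ , i₂ , subst (i₁ <_) (sym (proj₁ b)) p≤n , subst (i₂ <_) (sym (proj₁ b)) q≤n , adj , inj₁ (ep , eq)
    ... | i₁ , i₂ , adj , inj₂ (refl , refl) =
      i₁ , i₂ , subst (i₁ <_) (sym (proj₁ b)) p≤n , subst (i₂ <_) (sym (proj₁ b)) q≤n , adj ,
      inj₂ (trans (sym (ℤₚ.neg-involutive _)) (cong -_ ep) , trans (sym (ℤₚ.neg-involutive _)) (cong -_ eq))
    locate : ∀ {i′} → i′ < length v → ∣ nth v i ∣ ≡ ∣ nth v i′ ∣ → i ≡ i′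
    locate h e = nth-injective v (proj₂ (proj₂ b)) i<len h e
    partner : ∣ nth v i ∣ ≡ a ⊎ ∣ nth v i ∣ ≡ a′ → ∃ λ j → j < length v × Adj i j × Mate (nth v i) (nth v j)
    partner h with placed
    partner (inj₁ h) | i₁ , i₂ , l₁ , l₂ , adj , inj₁ (e₁ , e₂) with locate l₁ (trans h (cong ∣_∣ (sym e₁)))
    ... | refl = i₂ , l₂ , adj , + suc k , (λ ()) , inj₁ (e₁ , e₂)
    partner (inj₁ h) | i₁ , i₂ , l₁ , l₂ , adj , inj₂ (e₁ , e₂) with locate l₁ (trans h (cong ∣_∣ (sym e₁)))
    ... | refl = i₂ , l₂ , adj , -[1+ k ] , (λ ()) , inj₂ (e₁ , e₂)
    partner (inj₂ h) | i₁ , i₂ , l₁ , l₂ , adj , inj₁ (e₁ , e₂) with locate l₂ (trans h (cong ∣_∣ (sym e₂)))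
    ... | refl = i₁ , l₁ , Adj-sym adj , + suc k , (λ ()) , inj₂ (e₂ , e₁)
    partner (inj₂ h) | i₁ , i₂ , l₁ , l₂ , adj , inj₂ (e₁ , e₂) with locate l₂ (trans h (cong ∣_∣ (sym e₂)))
    ... | refl = i₁ , l₁ , Adj-sym adj , -[1+ k ] , (λ ()) , inj₁ (e₂ , e₁)
  fit : ∀ k → suc (k + k) ≤ m + m → suc (suc (k + k)) ≤ m + m
  fit k h = double-mono-< (half-mono {m} {suc k} (≤-trans (s≤s (≡⇒≤ (+-suc k k))) (s≤s h)))
  fromSize : ∀ r → ∣ nth v i ∣ ≡ r → ∃ λ j → j < length v × Adj i j × Mate (nth v i) (nth v j)
  fromSize zero e = contradiction e (λ e → <⇒≢ positive (sym e))
  fromSize (suc r) e with half r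
  ... | k , inj₁ refl = Block.partner k (fit k (subst (_≤ m + m) e bound)) (inj₁ e)
  ... | k , inj₂ refl = Block.partner k (subst (_≤ m + m) e bound) (inj₂ e)

-- `a < n ≤ suc N` confines the condition to values `a ≤ N`, all of which have mates.
Paired⇒Wachs : ∀ {N n v} → IsB n v → n ≤ suc N → Paired N v → IsWachs n v
Paired⇒Wachs {N} {n} {v} b n≤1+N paired = b , λ a 1≤a a<n → positions a 1≤a (≤-pred (≤-trans a<n n≤1+N))
  where
  within : ∀ {i} → suc i ≤ n → i < length v
  within {i} = subst (suc i ≤_) (sym (proj₁ b))
  bounded : ∀ {i} → i < length v → ∣ nth v i ∣ ≤ n
  bounded h = proj₂ (All.lookup (proj₁ (proj₂ b)) (nth-∈ v h))
  neg-nth : ∀ {i a} → - nth v i ≡ + a → nth v i ≡ - (+ a)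
  neg-nth e = trans (sym (ℤₚ.neg-involutive _)) (cong -_ e)
  module At (a : ℕ) (1≤a : 1 ≤ a) (a≤N : a ≤ N) (i : ℕ) (i< : i < length v) (size : ∣ nth v i ∣ ≡ a) where
    found = paired i i< (subst (_≤ N) (sym size) a≤N)
    j = proj₁ found
    j< = proj₁ (proj₂ found)
    adj = proj₁ (proj₂ (proj₂ found))
    mate = proj₂ (proj₂ (proj₂ found))
    same : ∀ {i′} → i′ < length v → ∣ nth v i′ ∣ ≡ star n a → i′ ≡ j
    same h e = nth-injective v (proj₂ (proj₂ b)) h j<
      (trans e (trans (cong (star n) (sym size)) (sym (Mate-star mate (bounded i<) (bounded j<)))))
  positions : ∀ a → 1 ≤ a → a ≤ N → ∀ p q → 1 ≤ ∣ p ∣ → ∣ p ∣ ≤ n → 1 ≤ ∣ q ∣ → ∣ q ∣ ≤ n →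
    app v p ≡ + a → app v q ≡ + star n a → ∣ p ℤ.- q ∣ ≤ 1
  positions a 1≤a a≤N (+ suc i) (+ suc i′) _ p≤ _ q≤ ep eq with At.same a 1≤a a≤N i (within p≤)
    (cong ∣_∣ ep) (within q≤) (cong ∣_∣ eq)
  ... | refl = ∣⊖∣-adj (At.adj a 1≤a a≤N i (within p≤) (cong ∣_∣ ep))
  positions a 1≤a a≤N -[1+ i ] -[1+ i′ ] _ p≤ _ q≤ ep eq
    with At.same a 1≤a a≤N i (within p≤) size (within q≤)
      (trans (cong ∣_∣ (neg-nth eq)) (ℤₚ.∣-i∣≡∣i∣ (+ star n a)))
    where
    size : ∣ nth v i ∣ ≡ a
    size = trans (cong ∣_∣ (neg-nth ep)) (ℤₚ.∣-i∣≡∣i∣ (+ a))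
  ... | refl = ∣⊖∣-adj (Adj-sym (At.adj a 1≤a a≤N i (within p≤)
      (trans (cong ∣_∣ (neg-nth ep)) (ℤₚ.∣-i∣≡∣i∣ (+ a)))))
  positions a 1≤a a≤N (+ suc i) -[1+ i′ ] _ p≤ _ q≤ ep eq
    with At.same a 1≤a a≤N i (within p≤) (cong ∣_∣ ep) (within q≤)
      (trans (cong ∣_∣ (neg-nth eq)) (ℤₚ.∣-i∣≡∣i∣ (+ star n a)))
       | Mate-signs (At.mate a 1≤a a≤N i (within p≤) (cong ∣_∣ ep))
  ... | refl | _ , _ , inj₁ (_ , f) = contradiction (trans (cong -_ (sym f)) eq) (λ ())
  ... | refl | _ , _ , inj₂ (e , _) = contradiction (trans (sym ep) e) (λ ())
  positions a 1≤a a≤N -[1+ i ] (+ suc i′) _ p≤ _ q≤ ep eq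
    with At.same a 1≤a a≤N i (within p≤) size (within q≤) (cong ∣_∣ eq) | Mate-signs
      (At.mate a 1≤a a≤N i (within p≤) size)
    where
    size : ∣ nth v i ∣ ≡ a
    size = trans (cong ∣_∣ (neg-nth ep)) (ℤₚ.∣-i∣≡∣i∣ (+ a))
  ... | refl | _ , _ , inj₁ (e , _) = contradiction (trans (cong -_ (sym e)) ep) (λ ())
  ... | refl | _ , _ , inj₂ (_ , f) = contradiction (trans (sym eq) f) (λ ())

shift-Adj : ∀ {i j} → Adj i j → Adj (suc i) (suc j)
shift-Adj (inj₁ e) = inj₁ (cong suc e)
shift-Adj (inj₂ e) = inj₂ (cong suc e)

Paired-∷ : ∀ {N x v} → suc N ≤ ∣ x ∣ → Paired N v → Paired N (x ∷ v)
Paired-∷ big _ zero _ h = contradiction h (<⇒≱ big)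
Paired-∷ _ p (suc i) (s≤s h) b with p i h b
... | j , j< , adj , mate = suc j , s≤s j< , shift-Adj adj , mate

Paired-block : ∀ {N a v} → proj₁ a ≢ 0ℤ → Paired N v → Paired N (e₁ a ∷ e₂ a ∷ v)
Paired-block {a = s , false} ne _ zero _ _ = 1 , s≤s (s≤s z≤n) , inj₂ refl , s , ne , inj₁ (refl , refl)
Paired-block {a = s , true} ne _ zero _ _ = 1 , s≤s (s≤s z≤n) , inj₂ refl , s , ne , inj₂ (refl , refl)
Paired-block {a = s , false} ne _ (suc zero) _ _ = 0 , s≤s z≤n , inj₁ refl , s , ne , inj₂ (refl , refl)
Paired-block {a = s , true} ne _ (suc zero) _ _ = 0 , s≤s z≤n , inj₁ refl , s , ne , inj₁ (refl , refl)
Paired-block ne p (suc (suc i)) (s≤s (s≤s h)) b with p i h b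
... | j , j< , adj , mate = suc (suc j) , s≤s (s≤s j<) , shift-Adj (shift-Adj adj) , mate

Paired-enc-++ : ∀ {N} A {v} → Nonzero A → Paired N v → Paired N (enc A ++ v)
Paired-enc-++ [] _ p = p
Paired-enc-++ {N} (a ∷ A) (ne ∷ nz) p = Paired-block {N} {a} ne (Paired-enc-++ A nz p)

Paired-tail : ∀ {N x v} → (∀ e → ∣ e ∣ ≤ N → e ∈ v → ¬ Mate e x) → Paired N (x ∷ v) → Paired N v
Paired-tail ¬mate p i h b with p (suc i) (s≤s h) b
... | suc j , s≤s j< , inj₁ refl , mate = j , j< , inj₁ refl , mate
... | suc j , s≤s j< , inj₂ refl , mate = j , j< , inj₂ refl , mate
Paired-tail {v = v} ¬mate p i h b | zero , _ , inj₁ refl , mate = contradiction mate (¬mate _ b (nth-∈ v h))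

Decoded : ℕ → List ℤ → Set
Decoded m v = (∃ λ A → v ≡ enc A) ⊎ (∃ λ A → ∃ λ x → ∃ λ A′ → v ≡ enc A ++ x ∷ enc A′ × ∣ x ∣ ≡ suc (m + m))

-- The window is read from the left: a first entry that is not extreme must have its mate as the
-- next entry, and the two form a block. Distinctness allows a single extreme entry.
decode : ∀ {m} v → Paired (m + m) v → Distinct v → Bounded (suc (m + m)) v → Decoded m v
decode [] _ _ _ = inj₁ ([] , refl)
decode {m} (x ∷ v) p (d ∷ ds) (b ∷ bs) with ∣ x ∣ ℕ.≤? m + m
decode {m} (x ∷ v) p (d ∷ ds) (b ∷ bs) | no big = special
    (decode {m} v (Paired-tail (λ e h _ mate → big (Mate-bounded {m} mate h)) p) ds bs)
  where
  ∣x∣ : ∣ x ∣ ≡ suc (m + m)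
  ∣x∣ = ≤-antisym b (≰⇒> big)
  special : Decoded m v → Decoded m (x ∷ v)
  special (inj₁ (A , e)) = inj₂ ([] , x , A , cong (x ∷_) e , ∣x∣)
  special (inj₂ (A , y , A′ , e , ∣y∣)) =
    contradiction (trans ∣x∣ (sym ∣y∣)) (All.lookup d (subst (y ∈_) (sym e) (∈-++⁺ʳ (enc A) (here refl))))
decode {m} (x ∷ []) p _ _ | yes small with p 0 (s≤s z≤n) small
... | zero , _ , inj₁ () , _
... | zero , _ , inj₂ () , _
... | suc _ , s≤s () , _
decode {m} (x ∷ y ∷ v) p ((_ ∷ d) ∷ (_ ∷ ds)) (_ ∷ _ ∷ bs) | yes small with p 0 (s≤s z≤n) small
... | zero , _ , inj₁ () , _
... | zero , _ , inj₂ () , _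
... | suc (suc j) , _ , inj₂ () , _
... | suc zero , _ , _ , mate with Mate-code mate
... | a , refl , refl = block (decode {m} v rest ds bs)
  where
  rest : Paired (m + m) v
  rest i h b with p (suc (suc i)) (s≤s (s≤s h)) b
  ... | zero , _ , inj₁ () , _
  ... | zero , _ , inj₂ () , _
  ... | suc (suc j) , s≤s (s≤s j<) , inj₁ refl , mate′ = j , j< , inj₁ refl , mate′
  ... | suc (suc j) , s≤s (s≤s j<) , inj₂ refl , mate′ = j , j< , inj₂ refl , mate′
  -- An entry paired back into the block just read would share its mate with `x`, hence equal `x`.
  ... | suc zero , _ , inj₁ refl , mate′ =
    contradiction (cong ∣_∣ (sym (Mate-unique mate′ mate))) (All.lookup d (nth-∈ v h))
  block : Decoded m v → Decoded m (e₁ a ∷ e₂ a ∷ v)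
  block (inj₁ (A , refl)) = inj₁ (a ∷ A , refl)
  block (inj₂ (A , x , A′ , refl , ∣x∣)) = inj₂ (a ∷ A , x , A′ , refl , ∣x∣)

-- Identity and longest element

-- The window `c + 1 , … , c + r`; with a free start its suffixes have the same form.
rng : ℕ → ℕ → List ℤ
rng c zero = []
rng c (suc r) = + suc c ∷ rng (suc c) r

length-rng : ∀ c r → length (rng c r) ≡ r
length-rng c zero = refl
length-rng c (suc r) = cong suc (length-rng (suc c) r)

rng≡ι : ∀ k → rng 0 k ≡ ι k
rng≡ι k = go 0 k
  where
  go : ∀ c r → rng c r ≡ applyUpTo (λ i → + suc (c + i)) r
  go c zero = refl
  go c (suc r) = cong₂ _∷_ (cong (λ j → + suc j) (sym (+-identityʳ c)))
    (trans (go (suc c) r) (applyUpTo-cong (λ i → cong (λ j → + suc j) (sym (+-suc c i))) r))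

IsB-rng : ∀ k → IsB k (rng 0 k)
IsB-rng k = subst (IsB k) (sym (rng≡ι k)) (IsB-ι k)

rng-> : ∀ c r → All (+ c ℤ.<_) (rng c r)
rng-> c zero = []
rng-> c (suc r) = ℤ.+<+ (n<1+n c) ∷ All.map (ℤₚ.<-trans (ℤ.+<+ (n<1+n c))) (rng-> (suc c) r)

AllPairs-rng : ∀ {R : ℤ → ℤ → Set} → (∀ {x y} → 0ℤ ℤ.< x → x ℤ.< y → R x y) → ∀ c r → AllPairs R (rng c r)
AllPairs-rng h c zero = []
AllPairs-rng h c (suc r) = All.map (h (ℤ.+<+ (s≤s z≤n))) (rng-> (suc c) r) ∷ AllPairs-rng h (suc c) r

ℓB-rng : ∀ n → ℓB (rng 0 n) ≡ 0
ℓB-rng n = trans (ℓB≡ (rng 0 n)) (cong₂ _+_ (pairs (AllPairs-rng increasing 0 n))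
  (trans (sumOf-const 0 (All.map (λ 0<x → lt-false (ℤₚ.<-asym 0<x)) (rng-> 0 n))) (*-zeroʳ (length (rng 0 n)))))
  where
  increasing : ∀ {x y} → 0ℤ ℤ.< x → x ℤ.< y → invs x y ≡ 0
  increasing 0<x x<y = cong₂ _+_ (lt-false (ℤₚ.<-asym x<y))
    (lt-false (ℤₚ.<-asym (ℤₚ.<-trans (ℤₚ.neg-mono-< 0<x) (ℤₚ.<-trans 0<x x<y))))
  pairs : ∀ {w} → AllPairs (λ x y → invs x y ≡ 0) w → invPairs w ≡ 0
  pairs [] = refl
  pairs {x ∷ w} (d ∷ ds) = cong₂ _+_ (trans (sumOf-const 0 d) (*-zeroʳ (length w))) (pairs ds)

w₀ : ℕ → List ℤ
w₀ n = map -_ (rng 0 n)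

IsB-neg : ∀ {k w} → IsB k w → IsB k (map -_ w)
IsB-neg {k} {w} = IsB-cong (↭-reflexive (trans (map-cong (λ x → sym (ℤₚ.∣-i∣≡∣i∣ x)) w) (map-∘ w)))

ℓB-w₀ : ∀ n → ℓB (w₀ n) ≡ n * n
ℓB-w₀ n = trans (ℓB≡ (w₀ n)) (trans
  (cong (invPairs (w₀ n) ℕ.+_)
    (trans (sumOf-const 1 (Allₚ.map⁺ (All.map (λ 0<x → lt-true (ℤₚ.neg-mono-< 0<x)) (rng-> 0 n))))
      (*-identityʳ _)))
  (trans (pairs (AllPairsₚ.map⁺ (AllPairs-rng decreasing 0 n)))
    (cong (λ k → k * k) (trans (length-map -_ (rng 0 n)) (length-rng 0 n)))))
  where
  decreasing : ∀ {x y} → 0ℤ ℤ.< x → x ℤ.< y → invs (- x) (- y) ≡ 2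
  decreasing {x} {y} 0<x x<y rewrite ℤₚ.neg-involutive x = cong₂ _+_ (lt-true (ℤₚ.neg-mono-< x<y))
    (lt-true (ℤₚ.<-trans (ℤₚ.neg-mono-< (ℤₚ.<-trans 0<x x<y)) 0<x))
  pairs : ∀ {w} → AllPairs (λ x y → invs x y ≡ 2) w → invPairs w + length w ≡ length w * length w
  pairs [] = refl
  pairs {x ∷ w} (d ∷ ds) = trans (cong (λ r → r + invPairs w + suc (length w)) (sumOf-const 2 d))
    (trans (arith₁ (length w) (invPairs w)) (trans (cong (λ p → p + (length w * 2 + 1)) (pairs ds))
      (arith₂ (length w))))
    where
    arith₁ : ∀ k p → k * 2 + p + suc k ≡ p + k + (k * 2 + 1)
    arith₁ = solve-∀
    arith₂ : ∀ k → k * k + (k * 2 + 1) ≡ suc k * suc k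
    arith₂ = solve-∀

length-filter-≥ : ∀ l w → length (filter (l ℤ.≤?_) w) ≡ cnt l w
length-filter-≥ l [] = refl
length-filter-≥ l (x ∷ w) with l ℤ.≤? x
... | yes _ = cong suc (length-filter-≥ l w)
... | no _ = length-filter-≥ l w

module _ (j : ℕ) where

  private
    l = + suc j

  cnt-rng-all : ∀ c r → j ≤ c → cnt l (rng c r) ≡ r
  cnt-rng-all c r j≤c = trans (cnt-all (All.map (λ c<x → ℤₚ.≤-trans (ℤ.+≤+ (s≤s j≤c)) (ℤₚ.i<j⇒suc[i]≤j c<x))
      (rng-> c r))) (length-rng c r)

  cnt-rng-≥ : ∀ c r → c ≤ j → c + r ≤ j + cnt l (rng c r)
  cnt-rng-≥ c zero c≤j = +-monoˡ-≤ 0 c≤j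
  cnt-rng-≥ c (suc r) c≤j with c ℕ.≟ j
  ... | yes refl = ≡⇒≤ (cong (c ℕ.+_) (sym (cnt-rng-all c (suc r) ≤-refl)))
  ... | no c≢j = ≤-trans (≡⇒≤ (+-suc c r)) (≤-trans (cnt-rng-≥ (suc c) r (≤∧≢⇒< c≤j c≢j))
      (+-monoʳ-≤ j (m≤n+m _ (le l (+ suc c)))))

  -- Pigeonhole: the entries counted are positive, and their sizes are distinct elements of
  -- `j + 1 , … , N`.
  cnt-distinct-≤ : ∀ {N w} → Distinct w → Bounded N w → cnt l w ≤ N ∸ j
  cnt-distinct-≤ {N} {w} distinct bounds = subst₂ _≤_ (trans (length-map ∣_∣ F) (length-filter-≥ l w))
      (length-applyUpTo _ (N ∸ j))
    (unique-⊆-length {xs = map ∣_∣ F} (AllPairsₚ.map⁺ (AllPairsₚ.filter⁺ (l ℤ.≤?_) distinct)) sub)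
    where
    F = filter (l ℤ.≤?_) w
    entry : ∀ x → l ℤ.≤ x → ∣ x ∣ ≤ N → ∣ x ∣ ∈ applyUpTo (λ i → suc (j + i)) (N ∸ j)
    entry (+ k) (ℤ.+≤+ j<k) k≤N = subst (_∈ applyUpTo (λ i → suc (j + i)) (N ∸ j)) (m+[n∸m]≡n j<k)
      (∈-applyUpTo⁺ (λ i → suc (j + i)) (≤-trans (≡⇒≤ (sym (+-∸-assoc 1 j<k))) (∸-monoˡ-≤ j k≤N)))
    sub : ∀ {a} → a ∈ map ∣_∣ F → a ∈ applyUpTo (λ i → suc (j + i)) (N ∸ j)
    sub a∈ with ∈-map⁻ ∣_∣ a∈
    ... | x , x∈ , refl with ∈-filter⁻ (l ℤ.≤?_) {xs = w} x∈
    ... | x∈w , l≤x = entry x l≤x (All.lookup bounds x∈w)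

-- At thresholds up to `suc c` all of `rng c r` counts; larger thresholds are positive and settled
-- by pigeonhole.
Dom-rng : ∀ c r {w} → length w ≡ r → Distinct w → Bounded (c + r) w → Dom (rng c r) w
Dom-rng c zero {[]} _ _ _ = []
Dom-rng c (suc r) {y ∷ w} e d b = cn (counts c (suc r) e d b)
  ∷ Dom-rng (suc c) r (suc-injective e) (tail d) (subst (λ N → Bounded N w) (+-suc c r) (All.tail b))
  where
  tail : ∀ {x w} → Distinct (x ∷ w) → Distinct w
  tail (_ ∷ ds) = ds
  counts : ∀ c r {w} → length w ≡ r → Distinct w → Bounded (c + r) w → ∀ l → cnt l w ≤ cnt l (rng c r)
  counts c r {w} e d b l with l ℤ.≤? + suc c
  ... | yes l≤ = begin
    cnt l w            ≤⟨ sumOf-bounded 1 (λ x → 𝟙≤1 (l ℤ.≤? x)) w ⟩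
    length w * 1       ≡⟨ *-identityʳ (length w) ⟩
    length w           ≡⟨ trans e (sym (length-rng c r)) ⟩
    length (rng c r)   ≡⟨ cnt-all (All.map (λ c<x → ℤₚ.≤-trans l≤ (ℤₚ.i<j⇒suc[i]≤j c<x)) (rng-> c r)) ⟨
    cnt l (rng c r)    ∎
    where open ≤-Reasoning
  counts c r {w} e d b (+ zero) | no l≰ = contradiction (ℤ.+≤+ z≤n) l≰
  counts c r {w} e d b -[1+ _ ] | no l≰ = contradiction ℤ.-≤+ l≰
  counts c r {w} e d b (+ suc j) | no l≰ = ≤-trans (cnt-distinct-≤ j d b)
    (m≤n+o⇒m∸n≤o (c + r) j (cnt-rng-≥ j c r (<⇒≤ (≰⇒> (λ j≤c → l≰ (ℤ.+≤+ (s≤s j≤c)))))))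

Dom-identity : ∀ {n v} → IsB n v → Dom (rng 0 n) v
Dom-identity {n} (len , bounds , distinct) = Dom-rng 0 n len distinct (All.map proj₂ bounds)

Dom-w₀ : ∀ {n v} → IsB n v → Dom v (w₀ n)
Dom-w₀ {n} {v} b = subst (λ u → Dom u (w₀ n)) (trans (sym (map-∘ v))
    (trans (map-cong ℤₚ.neg-involutive v) (map-id v)))
  (Dom-neg (Dom-identity (IsB-neg b)))

Star-ℓB : ∀ {n u v} → Bruhat n u v → u ≡ v ⊎ ℓB u < ℓB v
Star-ℓB nil = inj₁ refl
Star-ℓB ((_ , _ , _ , _ , _ , ℓ<) ◅ ss) with Star-ℓB ss
... | inj₁ refl = inj₂ ℓ<
... | inj₂ ℓ<′ = inj₂ (<-trans ℓ< ℓ<′)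

Dom-ℓB : ∀ {n u v} → IsB n u → IsB n v → Dom u v → u ≢ v → ℓB u < ℓB v
Dom-ℓB bu bv d ne with Star-ℓB (Dom⇒Bruhat bu bv d)
... | inj₁ e = contradiction e ne
... | inj₂ h = h

-- Gradedness

WachsStep : ℕ → Set
WachsStep n = ∀ {x y} → IsWachs n x → IsWachs n y → Dom x y → x ≢ y →
  ∃ λ z → IsWachs n z × Dom x z × Dom z y × ℓW n z ≡ suc (ℓW n x)

-- Iterating neighbour makes ℓW strictly monotone, so the neighbours are covers and every cover is one.
module Graded (n : ℕ) (neighbour : WachsStep n) (wid : IsWachs n (rng 0 n)) (ww₀ : IsWachs n (w₀ n)) where

  ρ : List ℤ → ℕ
  ρ = ℓW n

  suc-ρ⇒≢ : ∀ {x z} → ρ z ≡ suc (ρ x) → x ≢ z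
  suc-ρ⇒≢ e refl = 1+n≢n (sym e)

  less-fuel : ∀ {x y z} fuel → IsWachs n x → IsWachs n z → Dom x z → x ≢ z →
    ℓB y ≤ ℓB x + suc fuel → ℓB y ≤ ℓB z + fuel
  less-fuel {x} {y} {z} fuel wx wz d ne h = begin
    ℓB y               ≤⟨ h ⟩
    ℓB x + suc fuel    ≡⟨ +-suc (ℓB x) fuel ⟩
    suc (ℓB x) + fuel  ≤⟨ +-monoˡ-≤ fuel (Dom-ℓB (proj₁ wx) (proj₁ wz) d ne) ⟩
    ℓB z + fuel        ∎
    where open ≤-Reasoning

  no-fuel : ∀ {x y} → IsWachs n x → IsWachs n y → Dom x y → x ≢ y → ¬ ℓB y ≤ ℓB x + 0
  no-fuel {x} {y} wx wy d ne h =
    <⇒≱ (Dom-ℓB (proj₁ wx) (proj₁ wy) d ne) (subst (ℓB y ≤_) (+-identityʳ (ℓB x)) h)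

  -- The recursion is on the difference of ℓ_B, already known to be strictly monotone; `ρ` itself
  -- cannot serve as the measure yet.
  ρ-mono-fuel : ∀ fuel {x y} → IsWachs n x → IsWachs n y → Dom x y → x ≢ y → ℓB y ≤ ℓB x + fuel → ρ x < ρ y
  ρ-mono-fuel zero wx wy d ne h = contradiction h (no-fuel wx wy d ne)
  ρ-mono-fuel (suc fuel) {x} {y} wx wy d ne h with neighbour wx wy d ne
  ... | z , wz , d₁ , d₂ , e with ≡-dec ℤ._≟_ z y
  ... | yes refl = ≡⇒≥ e
  ... | no z≢y = <-trans (≡⇒≥ e) (ρ-mono-fuel fuel wz wy d₂ z≢y (less-fuel {x} {y} fuel wx wz d₁ (suc-ρ⇒≢ e) h))

  ρ-mono : ∀ {x y} → IsWachs n x → IsWachs n y → Dom x y → x ≢ y → ρ x < ρ y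
  ρ-mono {x} {y} wx wy d ne = ρ-mono-fuel (ℓB y) wx wy d ne (m≤n+m (ℓB y) (ℓB x))

  strictly : ∀ {x y} → IsWachs n x → IsWachs n y → Dom x y → x ≢ y → x <W[ n ] y
  strictly wx wy d ne = Dom⇒Bruhat (proj₁ wx) (proj₁ wy) d , ne

  covers-intro : ∀ {x z} → IsWachs n x → IsWachs n z → Dom x z → ρ z ≡ suc (ρ x) → Covers n x z
  covers-intro wx wz d e = wx , wz , strictly wx wz d (suc-ρ⇒≢ e) , between
    where
    between : ∀ y → IsWachs n y → _ <W[ n ] y → y <W[ n ] _ → ⊥
    between y wy (b₁ , n₁) (b₂ , n₂) = <⇒≱ (ρ-mono wx wy (Bruhat⇒Dom b₁) n₁)
      (≤-pred (≤-trans (ρ-mono wy wz (Bruhat⇒Dom b₂) n₂) (≡⇒≤ e)))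

  covers-ρ : ∀ x y → Covers n x y → ρ y ≡ suc (ρ x)
  covers-ρ x y (wx , wy , (b , ne) , none) with neighbour wx wy (Bruhat⇒Dom b) ne
  ... | z , wz , d₁ , d₂ , e with ≡-dec ℤ._≟_ z y
  ... | yes refl = e
  ... | no z≢y = ⊥-elim (none z wz (strictly wx wz d₁ (suc-ρ⇒≢ e)) (strictly wz wy d₂ z≢y))

  chain-ρ : ∀ {x z k} → Chain n x z k → ρ z ≡ k + ρ x
  chain-ρ (done _) = refl
  chain-ρ {x} {z} (step {y = y} {k = k} c ch) =
    trans (chain-ρ ch) (trans (cong (k ℕ.+_) (covers-ρ x y c)) (+-suc k (ρ x)))

  chain-fuel : ∀ fuel {x y} → IsWachs n x → IsWachs n y → Dom x y → ℓB y ≤ ℓB x + fuel → ∃ λ k → Chain n x y k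
  chain-fuel fuel {x} {y} wx wy d h with ≡-dec ℤ._≟_ x y
  ... | yes refl = 0 , done wx
  chain-fuel zero wx wy d h | no ne = contradiction h (no-fuel wx wy d ne)
  chain-fuel (suc fuel) {x} {y} wx wy d h | no ne with neighbour wx wy d ne
  ... | z , wz , d₁ , d₂ , e with chain-fuel fuel wz wy d₂ (less-fuel {x} {y} fuel wx wz d₁ (suc-ρ⇒≢ e) h)
  ... | k , ch = suc k , step (covers-intro wx wz d₁ e) ch

  below-≡ : ∀ {u v} → IsWachs n u → IsWachs n v → Dom u v → Bruhat n v u → v ≡ u
  below-≡ {u} {v} wu wv d b with Star-ℓB b
  ... | inj₁ e = e
  ... | inj₂ h with Star-ℓB (Dom⇒Bruhat (proj₁ wu) (proj₁ wv) d)
  ... | inj₁ e = sym e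
  ... | inj₂ h′ = contradiction h (<-asym h′)

  minimal-identity : Minimal n (rng 0 n)
  minimal-identity = wid , λ z wz b → below-≡ wid wz (Dom-identity (proj₁ wz)) b

  maximal-w₀ : Maximal n (w₀ n)
  maximal-w₀ = ww₀ , λ z wz b → sym (below-≡ wz ww₀ (Dom-w₀ (proj₁ wz)) b)

  minimal-unique : ∀ x → Minimal n x → rng 0 n ≡ x
  minimal-unique x (wx , least) = least _ wid (Dom⇒Bruhat (proj₁ wid) (proj₁ wx) (Dom-identity (proj₁ wx)))

  maximal-unique : ∀ x → Maximal n x → w₀ n ≡ x
  maximal-unique x (wx , greatest) = greatest _ ww₀ (Dom⇒Bruhat (proj₁ wx) (proj₁ ww₀) (Dom-w₀ (proj₁ wx)))

  ρ-identity : ρ (rng 0 n) ≡ 0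
  ρ-identity = trans (cong (_∸ ℓB (sigmaOf n (rng 0 n))) (ℓB-rng n)) (0∸n≡0 (ℓB (sigmaOf n (rng 0 n))))

  graded : ∀ R → ρ (w₀ n) ≡ R → GradedWithRank n (ℓW n) R
  graded R top =
    (λ x mn → subst (λ x → ρ x ≡ 0) (minimal-unique x mn) ρ-identity) ,
    covers-ρ ,
    (λ x z k mn mx ch → lengthOf (minimal-unique x mn) (maximal-unique z mx) ch) ,
    rng 0 n , w₀ n , minimal-identity , maximal-w₀ , full
    where
    lengthOf : ∀ {x z k} → rng 0 n ≡ x → w₀ n ≡ z → Chain n x z k → k ≡ R
    lengthOf {k = k} refl refl ch = trans (sym (trans (chain-ρ ch)
        (trans (cong (k ℕ.+_) ρ-identity) (+-identityʳ k)))) top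
    full : Chain n (rng 0 n) (w₀ n) R
    full with chain-fuel (ℓB (w₀ n)) wid ww₀ (Dom-identity (proj₁ ww₀)) (m≤n+m _ (ℓB (rng 0 n)))
    ... | k , ch = subst (Chain n (rng 0 n) (w₀ n)) (lengthOf refl refl ch) ch

-- The step for signed Wachs permutations, and the codes of the extreme elements

even-code : ∀ {m v} → IsWachs (m + m) v → ∃ λ A → v ≡ enc A × IsB m (σ A)
even-code {m} {v} w@((len , bounds , distinct) , _)
  with decode {m} v (Wachs⇒Paired {m} ≤-refl w) distinct (All.map (λ b → m≤n⇒m≤1+n (proj₂ b)) bounds)
... | inj₁ (A , refl) = A , refl , IsB-dec {m} {A} (proj₁ w)
... | inj₂ (A , x , A′ , refl , ∣x∣) = contradiction
  (proj₂ (All.lookup bounds (∈-++⁺ʳ (enc A) (here refl)))) (<⇒≱ (≡⇒≥ ∣x∣))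

Wachs-enc : ∀ {m A} → IsB m (σ A) → IsWachs (m + m) (enc A)
Wachs-enc {m} {A} b = Paired⇒Wachs (IsB-enc {m} {A} b) (n≤1+n (m + m))
  (subst (Paired (m + m)) (++-identityʳ (enc A)) (Paired-enc-++ A (IsB⇒Nonzero {A = A} b) (λ _ ())))

wachs-step-even : ∀ m → WachsStep (m + m)
wachs-step-even m wx wy d ne with even-code {m} wx | even-code {m} wy
... | A , refl , bA | B , refl , bB with even-step {m} {A} {B} bA bB d (λ e → ne (cong enc e))
... | Z , bZ , d₁ , d₂ , r = enc Z , Wachs-enc {m} {Z} bZ , d₁ , d₂ ,
  trans (ℓW-even {m} {Z} bZ) (trans r (cong suc (sym (ℓW-even {m} {A} bA))))

odd-code : ∀ {m v} → IsWachs (suc (m + m)) v → ∃ λ A → ∃ λ ε → ∃ λ A′ → v ≡ ins m A ε A′ × IsB m (σ (A ++ A′))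
odd-code {m} {v} w@((len , bounds , distinct) , _)
  with decode {m} v (Wachs⇒Paired {m} (n≤1+n (m + m)) w) distinct (All.map proj₂ bounds)
... | inj₁ (A , refl) = contradiction len′ (<⇒≢ (s≤s (h ⊕ h)))
  where
  len′ : length A + length A ≡ suc (m + m)
  len′ = trans (sym (length-enc A)) len
  h : length A ≤ m
  h = half-mono (≡⇒≤ len′)
... | inj₂ (A , x , A′ , refl , ∣x∣) = bySign x ∣x∣ w
  where
  codes : ∀ {x} → ∣ x ∣ ≡ suc (m + m) → IsWachs (suc (m + m)) (enc A ++ x ∷ enc A′) → IsB m (σ (A ++ A′))
  codes ∣x∣ w = IsB-dec {m} {A ++ A′} (subst (IsB (m + m)) (sym (enc-++ A A′))
      (IsB-delete (enc A) (enc A′) ∣x∣ (proj₁ w)))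
  bySign : ∀ x → ∣ x ∣ ≡ suc (m + m) → IsWachs (suc (m + m)) (enc A ++ x ∷ enc A′) →
    ∃ λ B → ∃ λ ε → ∃ λ B′ → enc A ++ x ∷ enc A′ ≡ ins m B ε B′ × IsB m (σ (B ++ B′))
  bySign (+ _) e@refl w = A , true , A′ , refl , codes e w
  bySign -[1+ _ ] e@refl w = A , false , A′ , refl , codes e w

Wachs-ins : ∀ {m} A ε A′ → IsB m (σ (A ++ A′)) → IsWachs (suc (m + m)) (ins m A ε A′)
Wachs-ins {m} A ε A′ b = Paired⇒Wachs
  (IsB-insert (enc A) (enc A′) (∣ent∣ {m} ε) (subst (IsB (m + m)) (enc-++ A A′) (IsB-enc {m} {A ++ A′} b)))
  ≤-refl
  (Paired-enc-++ A (Allₚ.++⁻ˡ A nz) (Paired-∷ (≡⇒≥ (∣ent∣ {m} ε))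
    (subst (Paired (m + m)) (++-identityʳ (enc A′)) (Paired-enc-++ A′ (Allₚ.++⁻ʳ A nz) (λ _ ())))))
  where
  nz : Nonzero (A ++ A′)
  nz = IsB⇒Nonzero {A = A ++ A′} b

wachs-step-odd : ∀ m → WachsStep (suc (m + m))
wachs-step-odd m wx wy d ne with odd-code {m} wx | odd-code {m} wy
... | A , ε , A′ , refl , bA | B , ε′ , B′ , refl , bB with odd-step {m} ε A A′ ε′ B B′ bA bB d ne
... | Z , ζ , Z′ , bZ , d₁ , d₂ , r = ins m Z ζ Z′ , Wachs-ins Z ζ Z′ bZ , d₁ , d₂ ,
  trans (ℓW-odd Z ζ Z′ bZ) (trans r (cong suc (sym (ℓW-odd A ε A′ bA))))

identityCode : ℕ → ℕ → List Code
identityCode c zero = []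
identityCode c (suc m) = (+ suc c , false) ∷ identityCode (suc c) m

σ-identityCode : ∀ c m → σ (identityCode c m) ≡ rng c m
σ-identityCode c zero = refl
σ-identityCode c (suc m) = cong (+ suc c ∷_) (σ-identityCode (suc c) m)

enc-identityCode : ∀ c m → enc (identityCode c m) ≡ rng (c + c) (m + m)
enc-identityCode c zero = refl
enc-identityCode c (suc m) = cong (+ suc (c + c) ∷_) (trans
  (cong (+ suc (suc (c + c)) ∷_) (trans (enc-identityCode (suc c) m)
    (cong (λ k → rng (suc k) (m + m)) (+-suc c c))))
  (cong (rng (suc (c + c))) (sym (+-suc m m))))

IsB-identityCode : ∀ m → IsB m (σ (identityCode 0 m))
IsB-identityCode m = subst (IsB m) (sym (σ-identityCode 0 m)) (IsB-rng m)

-- Negation reverses the order inside a block, `- lo s = hi (- s)`, so each bit flips: the identity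
-- has no bit set and its negative `w₀` has all of them.
negate : List Code → List Code
negate = map (λ a → - proj₁ a , not (proj₂ a))

enc-negate : ∀ A → enc (negate A) ≡ map -_ (enc A)
enc-negate [] = refl
enc-negate ((s , false) ∷ A) = cong₂ _∷_ (sym (neg-lo s)) (cong₂ _∷_ (sym (neg-hi s)) (enc-negate A))
enc-negate ((s , true) ∷ A) = cong₂ _∷_ (sym (neg-hi s)) (cong₂ _∷_ (sym (neg-lo s)) (enc-negate A))

σ-w₀-code : ∀ m → σ (negate (identityCode 0 m)) ≡ w₀ m
σ-w₀-code m = trans (trans (sym (map-∘ (identityCode 0 m))) (map-∘ (identityCode 0 m)))
    (cong (map -_) (σ-identityCode 0 m))

IsB-w₀-code : ∀ m → IsB m (σ (negate (identityCode 0 m)))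
IsB-w₀-code m = subst (IsB m) (sym (σ-w₀-code m)) (IsB-neg (IsB-rng m))

enc-w₀-code : ∀ m → enc (negate (identityCode 0 m)) ≡ w₀ (m + m)
enc-w₀-code m = trans (enc-negate (identityCode 0 m)) (cong (map -_) (enc-identityCode 0 m))

rng-snoc : ∀ c r → rng c (suc r) ≡ rng c r ++ + suc (c + r) ∷ []
rng-snoc c zero = cong (λ k → + suc k ∷ []) (sym (+-identityʳ c))
rng-snoc c (suc r) = cong (+ suc c ∷_) (trans (rng-snoc (suc c) r)
    (cong (λ k → rng (suc c) r ++ + suc k ∷ []) (sym (+-suc c r))))

ins-identityCode : ∀ m → ins m (identityCode 0 m) true [] ≡ rng 0 (suc (m + m))
ins-identityCode m = trans (cong (_++ + suc (m + m) ∷ []) (enc-identityCode 0 m)) (sym (rng-snoc 0 (m + m)))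

ins-w₀-code : ∀ m → ins m (negate (identityCode 0 m)) false [] ≡ w₀ (suc (m + m))
ins-w₀-code m = trans (cong (_++ -[1+ m + m ] ∷ []) (enc-negate (identityCode 0 m)))
  (trans (sym (map-++ -_ (enc (identityCode 0 m)) (+ suc (m + m) ∷ []))) (cong (map -_) (ins-identityCode m)))

-- The two squares are the lengths of the longest elements of B_n and B_m.
ℓW-w₀ : ∀ n m → sigmaOf n (w₀ n) ≡ w₀ m → n / 2 ≡ m → ℓW n (w₀ n) ≡ n * n ∸ (n / 2) * (n / 2)
ℓW-w₀ n m e h rewrite h = cong₂ _∸_ (ℓB-w₀ n) (trans (cong ℓB e) (ℓB-w₀ m))

theorem4p10 : (n : ℕ) → 1 ≤ n →
    GradedWithRank n (ℓW n) (n * n ∸ (n / 2) * (n / 2))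
theorem4p10 n _ with half n
... | m , inj₁ refl = Graded.graded (m + m) (wachs-step-even m)
  (subst (IsWachs (m + m)) (enc-identityCode 0 m) (Wachs-enc {m} {identityCode 0 m} (IsB-identityCode m)))
  (subst (IsWachs (m + m)) (enc-w₀-code m) (Wachs-enc {m} {negate (identityCode 0 m)} (IsB-w₀-code m)))
  _ (ℓW-w₀ (m + m) m (trans (cong (sigmaOf (m + m)) (sym (enc-w₀-code m)))
    (trans (sigmaOf-even m _) (σ-w₀-code m))) ([k+k]/2 m))
... | m , inj₂ refl = Graded.graded (suc (m + m)) (wachs-step-odd m)
  (subst (IsWachs (suc (m + m))) (ins-identityCode m)
    (Wachs-ins (identityCode 0 m) true [] (codes (IsB-identityCode m))))
  (subst (IsWachs (suc (m + m))) (ins-w₀-code m) (Wachs-ins (negate (identityCode 0 m)) false [] w₀-codes))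
  _ (ℓW-w₀ (suc (m + m)) m
      (trans (cong (sigmaOf (suc (m + m))) (sym (ins-w₀-code m)))
        (trans (sigmaOf-odd m (negate (identityCode 0 m)) false [] w₀-codes)
          (trans (cong σ (++-identityʳ (negate (identityCode 0 m)))) (σ-w₀-code m))))
      ([1+k+k]/2 m))
  where
  codes : ∀ {A} → IsB m (σ A) → IsB m (σ (A ++ []))
  codes {A} = subst (IsB m ∘ σ) (sym (++-identityʳ A))
  w₀-codes = codes {negate (identityCode 0 m)} (IsB-w₀-code m)
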